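{- Let $1/n\ll c\ll\mu\ll1$ and let $t_1,t_2\in\mathbb N$ satisfy $t_1+t_2=n$ and $t_1\ge(2-\mu)t_2$. If $G$ is a red/blue coloured complete graph with $\max\{t_1+2t_2,2t_1\}-1$ vertices which is Type II $(\mu,t_1,t_2)$-extremal, then $G$ contains a monochromatic copy of every $n$-vertex tree $T$ with $\Delta(T)\le cn$ whose bipartition classes have sizes $t_1$ and $t_2$.
   Context: Hierarchy notation "$1/n\ll c\ll\mu\ll1$": each parameter is chosen sufficiently small in terms of those to its right. For a red/blue coloured graph, $d_{\mathrm{red}}(u,S)$, $d_{\mathrm{blue}}(u,S)$ denote numbers of red/blue neighbours of $u$ in $S$. With $n=t_1+t_2$, a red/blue coloured complete graph $G$ is Type II $(\mu,t_1,t_2)$-extremal if there are disjoint $U_1,U_2\subseteq V(G)$ with $|U_1|,|U_2|\ge(1-\mu)t_1$ and, for each $i\in[2]$ and $u\in U_i$, $d_{\mathrm{red}}(u,U_i)\le\mu n$ and $d_{\mathrm{blue}}(u,U_{3-i})\le\mu n$; or the same holds with red and blue swapped. -}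

module Defs where

open import Data.Nat as ℕ using (ℕ; zero; suc)
open import Data.Integer using (+_)
open import Data.Rational using (ℚ; _/_; _≤_; _*_; _-_; 1ℚ)
open import Data.Bool using (Bool; true; false; _∧_; not; if_then_else_)
open import Data.Fin using (Fin; _≟_)
open import Data.Fin using () renaming (zero to fz; suc to fs)
open import Data.List using (List; []; _∷_)
open import Data.List.Relation.Unary.Unique.Propositional using (Unique)
open import Data.Product using (Σ; ∃; _×_; _,_)
open import Data.Sum using (_⊎_)
open import Relation.Nullary using (¬_)
open import Relation.Nullary.Decidable using (⌊_⌋)
open import Relation.Binary.PropositionalEquality using (_≡_)
open import Function.Definitions using (Injective)

ℕ→ℚ : ℕ → ℚ
ℕ→ℚ n = (+ n) / 1

count : ∀ {n} → (Fin n → Bool) → ℕ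
count {zero}  P = 0
count {suc n} P = (if P fz then 1 else 0) ℕ.+ count (λ i → P (fs i))

record SimpleGraph (n : ℕ) : Set where
  field
    adj   : Fin n → Fin n → Bool
    sym   : ∀ u v → adj u v ≡ adj v u
    irrefl : ∀ u → adj u u ≡ false
open SimpleGraph public

data Walk {n} (T : SimpleGraph n) : Fin n → Fin n → List (Fin n) → Set where
  here : ∀ v → Walk T v v (v ∷ [])
  step : ∀ {u v w vs} → adj T u v ≡ true → Walk T v w vs → Walk T u w (u ∷ vs)

Connected : ∀ {n} → SimpleGraph n → Set
Connected {n} T = ∀ (u v : Fin n) → ∃ λ vs → Walk T u v vs

HasCycle : ∀ {n} → SimpleGraph n → Set
HasCycle {n} T = Σ (Fin n) λ u → Σ (Fin n) λ v → Σ (Fin n) λ x → Σ (Fin n) λ y →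
  Σ (List (Fin n)) λ vs →
    Walk T u v (u ∷ x ∷ y ∷ vs) × Unique (u ∷ x ∷ y ∷ vs) × adj T v u ≡ true

IsTree : ∀ {n} → SimpleGraph n → Set
IsTree T = Connected T × ¬ HasCycle T

degree : ∀ {n} → SimpleGraph n → Fin n → ℕ
degree T v = count (adj T v)

MaxDegreeAtMost : ∀ {n} → SimpleGraph n → ℚ → Set
MaxDegreeAtMost {n} T c = ∀ v → ℕ→ℚ (degree T v) ≤ c * ℕ→ℚ n

HasBipartitionClasses : ∀ {n} → SimpleGraph n → ℕ → ℕ → Set
HasBipartitionClasses {n} T t₁ t₂ = Σ (Fin n → Bool) λ side →
  (∀ u v → adj T u v ≡ true → side u ≡ not (side v)) ×
  count side ≡ t₁ × count (λ v → not (side v)) ≡ t₂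

data Colour : Set where
  red blue : Colour

other : Colour → Colour
other red  = blue
other blue = red

_==ᶜ_ : Colour → Colour → Bool
red  ==ᶜ red  = true
blue ==ᶜ blue = true
_    ==ᶜ _    = false

-- a 2-edge-coloured complete graph on Fin N (diagonal values are irrelevant)
record ColouredKN (N : ℕ) : Set where
  field
    colour : Fin N → Fin N → Colour
    colour-sym : ∀ u v → colour u v ≡ colour v u
open ColouredKN public

deg : ∀ {N} → ColouredKN N → Colour → Fin N → (Fin N → Bool) → ℕ
deg G k u S = count (λ w → S w ∧ not ⌊ w ≟ u ⌋ ∧ (colour G u w ==ᶜ k))

-- Type II extremal with the first colour k (k = red: as in the definition;
-- k = blue: red and blue swapped).  Here n = t₁ + t₂.
TypeIIWith : ∀ {N} → Colour → ColouredKN N → ℚ → ℕ → ℕ → Set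
TypeIIWith {N} k G μ t₁ t₂ =
  Σ (Fin N → Bool) λ U₁ → Σ (Fin N → Bool) λ U₂ →
    (∀ u → U₁ u ∧ U₂ u ≡ false) ×
    ((1ℚ - μ) * ℕ→ℚ t₁ ≤ ℕ→ℚ (count U₁)) ×
    ((1ℚ - μ) * ℕ→ℚ t₁ ≤ ℕ→ℚ (count U₂)) ×
    (∀ u → U₁ u ≡ true →
       ℕ→ℚ (deg G k u U₁) ≤ μ * ℕ→ℚ (t₁ ℕ.+ t₂) ×
       ℕ→ℚ (deg G (other k) u U₂) ≤ μ * ℕ→ℚ (t₁ ℕ.+ t₂)) ×
    (∀ u → U₂ u ≡ true →
       ℕ→ℚ (deg G k u U₂) ≤ μ * ℕ→ℚ (t₁ ℕ.+ t₂) ×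
       ℕ→ℚ (deg G (other k) u U₁) ≤ μ * ℕ→ℚ (t₁ ℕ.+ t₂))

TypeIIExtremal : ∀ {N} → ColouredKN N → ℚ → ℕ → ℕ → Set
TypeIIExtremal G μ t₁ t₂ = TypeIIWith red G μ t₁ t₂ ⊎ TypeIIWith blue G μ t₁ t₂

HasMonochromaticCopy : ∀ {N n} → ColouredKN N → SimpleGraph n → Set
HasMonochromaticCopy {N} {n} G T = Σ Colour λ k → Σ (Fin n → Fin N) λ f →
  Injective _≡_ _≡_ f × (∀ u v → adj T u v ≡ true → colour G (f u) (f v) ≡ k)

{-# OPTIONS --safe #-}
-- Let χ be the colour that is dense across (U₁, U₂), and let T be cut at one or two vertices, along k edges, into two
-- parts of at most 0.665 n vertices, where k is as small as possible. By minimality no set of fewer than k vertices is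
-- adjacent to almost all low-degree vertices of the larger class. Let A be the set of vertices sending fewer than k
-- edges of the other colour to U₂, and define B likewise with U₁.
--
-- If |A| ≥ t₁, then T embeds in colour χ with its larger class onto A: the other vertices are placed greedily, and the
-- low-degree vertices of the larger class are assigned by one-step augmentations, since every vertex of A suits many of
-- them. The same works if |A| = t₁ - 1 and some vertex outside A has a neighbour in U₂ in colour χ, which then hosts the
-- parent of a leaf. If a vertex has many χ-neighbours in both U₁ and U₂, then T embeds in colour χ with the two classes
-- exchanged beyond that vertex, which leaves room on both sides. Otherwise each vertex is joined to almost all of U₁ or
-- of U₂ in the other colour; two such vertices with k edges to the opposite side carry the cut vertices of T. In the
-- one remaining case |A| = |B| = t₁ - 1, everything is clean, and T embeds around its centroid in two cliques of the
-- other colour sharing the one vertex outside A ∪ B.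
module Submission where

open import Defs renaming (sym to adj-sym)
open import Data.Nat using (ℕ; zero; suc; _+_; _*_; _∸_; _⊔_; _≤_; _<_; _≥_; _≤ᵇ_; z≤n; s≤s; z<s; _≤?_; _<?_)
open import Data.Nat.Properties renaming (suc-injective to ℕ-suc-injective)
open import Data.Nat.Induction using (<-wellFounded)
open import Induction.WellFounded using (Acc; acc)
open import Data.Bool using (Bool; true; false; _∧_; _∨_; not; if_then_else_; T)
open import Data.Bool.Properties using (not-involutive; T-∧) renaming (_≟_ to _≟ᵇ_)
open import Data.Fin using (Fin; toℕ) renaming (zero to fz; suc to fs; _≟_ to _≟ᶠ_)
open import Data.Fin.Properties using (any?; all?; toℕ<n; toℕ-injective) renaming (suc-injective to fs-injective)
open import Data.List using (List; []; _∷_; _++_)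
open import Data.List.Relation.Unary.All using (All; []; _∷_)
import Data.List.Relation.Unary.All as AllM
import Data.List.Relation.Unary.All.Properties as AllP
import Data.List.Relation.Unary.Unique.Propositional.Properties as UniqueP
open import Data.List.Relation.Unary.Any using (here)
open import Data.List.Relation.Unary.AllPairs using ([]; _∷_)
open import Data.List.Relation.Unary.Unique.Propositional using (Unique)
open import Data.Product using (Σ; ∃; _×_; _,_; proj₁; proj₂)
open import Data.Sum using (_⊎_; inj₁; inj₂; [_,_]′)
open import Data.Empty using (⊥; ⊥-elim)
open import Data.Unit using (⊤; tt)
open import Function using (_∘_; case_of_)
open import Function.Bundles using (Equivalence)
open import Relation.Nullary using (¬_; Dec; yes; no)
open import Relation.Nullary.Decidable using (⌊_⌋; _×-dec_; _→-dec_)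
open import Relation.Binary.PropositionalEquality using (_≡_; _≢_; refl; sym; trans; cong; cong₂; subst; subst₂)
open import Relation.Binary using (tri<; tri≈; tri>)
import Data.Vec as Vec
import Data.Vec.Properties as VecP
open import Data.Fin.Subset.Properties using (anySubset?)
open import Data.Nat.DivMod using (_/_; _%_; m≡m%n+[m/n]*n; m%n<n; m*n/n≡m; /-monoˡ-≤)
import Data.Integer as ℤ
import Data.Integer.Properties as ℤP
open import Data.Rational as ℚ using (ℚ; 0ℚ; 1ℚ)
import Data.Rational.Properties as ℚP
import Data.Rational.Unnormalised as ℚᵘ
import Data.Rational.Unnormalised.Properties as ℚᵘP

-- The obstacle is that nothing is spare. G may have only 2t₁ - 1 vertices, while U₁ and U₂ are each
-- guaranteed only t₁ - e, so up to 3e vertices of unknown behaviour may all have to be used. Each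
-- of them must be useful in one of the two colours, and one number k has to separate the two uses
-- without a gap. A vertex that is almost completely joined to U₁ in the other colour can carry a
-- cut vertex of T as soon as it has k such edges to U₂, because at most k tree edges must enter
-- that side. With fewer than k it can host the larger class, because the few neighbours that it
-- misses cannot spoil almost all low-degree vertices. The bound 0.665 lies just below 2/3, since
-- |Uᵢ| is at least about 2n/3; the difference, about n/600, is more than 33e and pays for all
-- losses. Everything is stated over the naturals with the single slack e, so that each numerical
-- step is one linear certificate.

-- Linear arithmetic over the naturals by certificates

data Lin : Set where
  ‵_ κ_ : ℕ → Lin
  _⊕_   : Lin → Lin → Lin
  _⊛_   : ℕ → Lin → Lin

infix  9 ‵_ κ_
infixr 8 _⊛_
infixl 7 _⊕_

at : List ℕ → ℕ → ℕ
at []      _       = 0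
at (x ∷ _) zero    = x
at (_ ∷ ρ) (suc i) = at ρ i

-- The literal factor stands on the right, where it does not unfold.
⟦_⟧ : Lin → List ℕ → ℕ
⟦ ‵ i ⟧   ρ = at ρ i
⟦ κ k ⟧   ρ = k
⟦ s ⊕ t ⟧ ρ = ⟦ s ⟧ ρ + ⟦ t ⟧ ρ
⟦ k ⊛ t ⟧ ρ = ⟦ t ⟧ ρ * k

unit : ℕ → List ℕ
unit zero    = 1 ∷ []
unit (suc i) = 0 ∷ unit i

plus : List ℕ → List ℕ → List ℕ
plus []       bs       = bs
plus as       []       = as
plus (a ∷ as) (b ∷ bs) = a + b ∷ plus as bs

scale : ℕ → List ℕ → List ℕ
scale k []       = []
scale k (a ∷ as) = k * a ∷ scale k as

-- Coefficient vectors list the constant term first.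
coeffs : Lin → List ℕ
coeffs (‵ i)   = 0 ∷ unit i
coeffs (κ k)   = k ∷ []
coeffs (s ⊕ t) = plus (coeffs s) (coeffs t)
coeffs (k ⊛ t) = scale k (coeffs t)

dot : List ℕ → List ℕ → ℕ
dot []       ρ = 0
dot (a ∷ as) ρ = a * at ρ 0 + dot as (tail ρ)
  where
  tail : List ℕ → List ℕ
  tail []      = []
  tail (_ ∷ ρ) = ρ

dot-unit : ∀ i ρ → dot (unit i) ρ ≡ at ρ i
dot-unit zero    ρ        = trans (+-identityʳ _) (*-identityˡ _)
dot-unit (suc i) []       = trans (dot-unit i []) refl
dot-unit (suc i) (x ∷ ρ)  = dot-unit i ρ

private
  +-swap : ∀ a b c d → (a + b) + (c + d) ≡ (a + c) + (b + d)
  +-swap a b c d = trans (+-assoc a b (c + d)) (trans (cong (a +_) (trans (sym (+-assoc b c d))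
    (trans (cong (_+ d) (+-comm b c)) (+-assoc c b d)))) (sym (+-assoc a c (b + d))))

dot-plus : ∀ as bs ρ → dot (plus as bs) ρ ≡ dot as ρ + dot bs ρ
dot-plus []       bs       ρ = refl
dot-plus (a ∷ as) []       ρ = sym (+-identityʳ _)
dot-plus (a ∷ as) (b ∷ bs) ρ = trans (cong₂ _+_ (*-distribʳ-+ (at ρ 0) a b) (dot-plus as bs _))
  (+-swap (a * at ρ 0) (b * at ρ 0) _ _)

dot-scale : ∀ k as ρ → dot (scale k as) ρ ≡ k * dot as ρ
dot-scale k []       ρ = sym (*-zeroʳ k)
dot-scale k (a ∷ as) ρ = trans (cong₂ _+_ (*-assoc k a (at ρ 0)) (dot-scale k as _))
  (sym (*-distribˡ-+ k (a * at ρ 0) _))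

dot-coeffs : ∀ t ρ → dot (coeffs t) (1 ∷ ρ) ≡ ⟦ t ⟧ ρ
dot-coeffs (‵ i)   ρ = dot-unit i ρ
dot-coeffs (κ k)   ρ = trans (+-identityʳ _) (*-identityʳ k)
dot-coeffs (s ⊕ t) ρ = trans (dot-plus (coeffs s) (coeffs t) (1 ∷ ρ)) (cong₂ _+_ (dot-coeffs s ρ) (dot-coeffs t ρ))
dot-coeffs (k ⊛ t) ρ = trans (dot-scale k (coeffs t) (1 ∷ ρ)) (trans (cong (k *_) (dot-coeffs t ρ)) (*-comm k _))

-- The test sees closed coefficient vectors only. It therefore evaluates while the atoms of ρ stay
-- opaque, and the implicit argument of `linear` is solved by computation.
dominated : List ℕ → List ℕ → Bool
dominated []       bs       = true
dominated (a ∷ as) []       = (a ≤ᵇ 0) ∧ dominated as []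
dominated (a ∷ as) (b ∷ bs) = (a ≤ᵇ b) ∧ dominated as bs

-- The values are naturals, so comparing column by column is sound, and a certificate never has to
-- list facts of the form 0 ≤ x.
dot-mono : ∀ as bs ρ → T (dominated as bs) → dot as ρ ≤ dot bs ρ
dot-mono []       bs       ρ _ = z≤n
dot-mono (a ∷ as) []       ρ h with Equivalence.to (T-∧ {a ≤ᵇ 0}) h
... | h₁ , h₂ = +-mono-≤ (*-monoˡ-≤ (at ρ 0) (≤ᵇ⇒≤ a 0 h₁)) (dot-mono as [] _ h₂)
dot-mono (a ∷ as) (b ∷ bs) ρ h with Equivalence.to (T-∧ {a ≤ᵇ b}) h
... | h₁ , h₂ = +-mono-≤ (*-monoˡ-≤ (at ρ 0) (≤ᵇ⇒≤ a b h₁)) (dot-mono as bs _ h₂)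

infix  5 _⋆_⊑_by_
infixr 4 _∙_


data Fact (ρ : List ℕ) : Set where
  _⋆_⊑_by_ : ℕ → (s t : Lin) → ⟦ s ⟧ ρ ≤ ⟦ t ⟧ ρ → Fact ρ

data Facts (ρ : List ℕ) : Set where
  end : Facts ρ
  _∙_ : Fact ρ → Facts ρ → Facts ρ

left right : ∀ {ρ} → Facts ρ → Lin
left  end = κ 0
left  (k ⋆ s ⊑ t by _ ∙ hs) = k ⊛ s ⊕ left hs
right end = κ 0
right (k ⋆ s ⊑ t by _ ∙ hs) = k ⊛ t ⊕ right hs

left≤right : ∀ {ρ} (hs : Facts ρ) → ⟦ left hs ⟧ ρ ≤ ⟦ right hs ⟧ ρ
left≤right end = z≤n
left≤right (k ⋆ s ⊑ t by p ∙ hs) = +-mono-≤ (*-monoˡ-≤ k p) (left≤right hs)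

abstract
  -- Farkas certificate: the facts, weighted, refute k copies of t < s; this also covers the strict goal that
  -- integrality gives.
  linear : ∀ ρ (hs : Facts ρ) k s t
    {_ : T (dominated (coeffs (κ 1 ⊕ k ⊛ s ⊕ right hs)) (coeffs (κ k ⊕ k ⊛ t ⊕ left hs)))} →
    ⟦ s ⟧ ρ ≤ ⟦ t ⟧ ρ
  linear ρ hs k s t {h} = ≤-pred (*-cancelʳ-< k _ _ bound)
    where
    whole : 1 + ⟦ s ⟧ ρ * k + ⟦ right hs ⟧ ρ ≤ k + ⟦ t ⟧ ρ * k + ⟦ left hs ⟧ ρ
    whole = subst₂ _≤_ (dot-coeffs (κ 1 ⊕ k ⊛ s ⊕ right hs) ρ) (dot-coeffs (κ k ⊕ k ⊛ t ⊕ left hs) ρ)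
      (dot-mono (coeffs (κ 1 ⊕ k ⊛ s ⊕ right hs)) (coeffs (κ k ⊕ k ⊛ t ⊕ left hs)) (1 ∷ ρ) h)
    bound : ⟦ s ⟧ ρ * k < suc (⟦ t ⟧ ρ) * k
    bound = +-cancelʳ-≤ (⟦ right hs ⟧ ρ) _ _ (≤-trans whole (+-monoʳ-≤ (k + ⟦ t ⟧ ρ * k) (left≤right hs)))

  linear-absurd : ∀ ρ (hs : Facts ρ)
    {_ : T (dominated (coeffs (κ 1 ⊕ right hs)) (coeffs (left hs)))} → ⊥
  linear-absurd ρ hs {h} = <-irrefl refl (≤-trans
    (subst₂ _≤_ (dot-coeffs (κ 1 ⊕ right hs) ρ) (dot-coeffs (left hs) ρ)
      (dot-mono (coeffs (κ 1 ⊕ right hs)) (coeffs (left hs)) (1 ∷ ρ) h))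
    (left≤right hs))

-- Counting

both : ∀ {a b} → a ≡ true → b ≡ true → a ∧ b ≡ true
both refl refl = refl

∧₁ : ∀ {a b} → a ∧ b ≡ true → a ≡ true
∧₁ {true} _ = refl

∧₂ : ∀ {a b} → a ∧ b ≡ true → b ≡ true
∧₂ {true} h = h

∨₁ : ∀ {a b} → a ≡ true → a ∨ b ≡ true
∨₁ refl = refl

∨₂ : ∀ {a b} → b ≡ true → a ∨ b ≡ true
∨₂ {true}  _ = refl
∨₂ {false} h = h

∨-elim : ∀ {a b} → a ∨ b ≡ true → a ≡ true ⊎ b ≡ true
∨-elim {true}  h = inj₁ refl
∨-elim {false} h = inj₂ h

not-intro : ∀ {a} → ¬ (a ≡ true) → not a ≡ true
not-intro {true}  h = ⊥-elim (h refl)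
not-intro {false} h = refl

not-elim : ∀ {a} → not a ≡ true → ¬ (a ≡ true)
not-elim {true} () _
not-elim {false} _ ()

false-intro : ∀ {a} → ¬ (a ≡ true) → a ≡ false
false-intro {true}  h = ⊥-elim (h refl)
false-intro {false} h = refl

false-elim : ∀ {a} → a ≡ false → ¬ (a ≡ true)
false-elim refl ()

truth : ∀ a → a ≡ true ⊎ not a ≡ true
truth true  = inj₁ refl
truth false = inj₂ refl

⌊⌋-intro : ∀ {P : Set} (d : Dec P) → P → ⌊ d ⌋ ≡ true
⌊⌋-intro (yes _) _ = refl
⌊⌋-intro (no ¬p) p = ⊥-elim (¬p p)

⌊⌋-elim : ∀ {P : Set} (d : Dec P) → ⌊ d ⌋ ≡ true → P
⌊⌋-elim (yes p) _ = p

_==_ : ∀ {n} → Fin n → Fin n → Bool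
i == j = ⌊ i ≟ᶠ j ⌋

==-refl : ∀ {n} (i : Fin n) → i == i ≡ true
==-refl i = ⌊⌋-intro (i ≟ᶠ i) refl

==-elim : ∀ {n} {i j : Fin n} → i == j ≡ true → i ≡ j
==-elim {i = i} {j} = ⌊⌋-elim (i ≟ᶠ j)

bit : Bool → ℕ
bit b = if b then 1 else 0

bit-mono : ∀ {a b} → (a ≡ true → b ≡ true) → bit a ≤ bit b
bit-mono {false}         h = z≤n
bit-mono {true}  {true}  h = ≤-refl
bit-mono {true}  {false} h = case h refl of λ ()

bit≤1 : ∀ b → bit b ≤ 1
bit≤1 true  = ≤-refl
bit≤1 false = z≤n

bit-true : ∀ {a} → a ≡ true → bit a ≡ 1
bit-true refl = refl

∑ : ∀ {n} → (Fin n → ℕ) → ℕ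
∑ {zero}  f = 0
∑ {suc n} f = f fz + ∑ (f ∘ fs)

∑-mono : ∀ {n} {f g : Fin n → ℕ} → (∀ i → f i ≤ g i) → ∑ f ≤ ∑ g
∑-mono {zero}  h = z≤n
∑-mono {suc n} h = +-mono-≤ (h fz) (∑-mono (h ∘ fs))

∑-cong : ∀ {n} {f g : Fin n → ℕ} → (∀ i → f i ≡ g i) → ∑ f ≡ ∑ g
∑-cong h = ≤-antisym (∑-mono (≤-reflexive ∘ h)) (∑-mono (≤-reflexive ∘ sym ∘ h))

∑-+ : ∀ {n} (f g : Fin n → ℕ) → ∑ (λ i → f i + g i) ≡ ∑ f + ∑ g
∑-+ {zero}  f g = refl
∑-+ {suc n} f g = ≤-antisym (linear (∑ (λ i → f (fs i) + g (fs i)) ∷ ∑ (f ∘ fs) ∷ ∑ (g ∘ fs) ∷ f fz ∷ g fz ∷ []) (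
  1 ⋆ ‵ 0 ⊑ ‵ 1 ⊕ ‵ 2 by ≤-reflexive (∑-+ (f ∘ fs) (g ∘ fs)) ∙ end)
  1 (‵ 3 ⊕ ‵ 4 ⊕ ‵ 0) (‵ 3 ⊕ ‵ 1 ⊕ (‵ 4 ⊕ ‵ 2))) (linear (∑ (f ∘ fs) ∷ ∑ (g ∘ fs) ∷ ∑ (λ i → f (fs i) + g (fs i)) ∷
  f fz ∷ g fz ∷ []) (1 ⋆ ‵ 0 ⊕ ‵ 1 ⊑ ‵ 2 by ≤-reflexive (sym (∑-+ (f ∘ fs) (g ∘ fs))) ∙ end)
  1 (‵ 3 ⊕ ‵ 0 ⊕ (‵ 4 ⊕ ‵ 1)) (‵ 3 ⊕ ‵ 4 ⊕ ‵ 2))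

∑-const : ∀ n k → ∑ {n} (λ _ → k) ≡ n * k
∑-const zero    k = refl
∑-const (suc n) k = cong (k +_) (∑-const n k)

∑-* : ∀ {n} k (f : Fin n → ℕ) → ∑ (λ i → f i * k) ≡ ∑ f * k
∑-* {zero}  k f = refl
∑-* {suc n} k f = trans (cong (f fz * k +_) (∑-* k (f ∘ fs))) (sym (*-distribʳ-+ k (f fz) _))

∑-swap : ∀ {n m} (f : Fin n → Fin m → ℕ) → ∑ (λ i → ∑ (f i)) ≡ ∑ (λ j → ∑ (λ i → f i j))
∑-swap {zero} {m} f = sym (trans (∑-const m 0) (*-zeroʳ m))
∑-swap {suc n} f = trans (cong (∑ (f fz) +_) (∑-swap (f ∘ fs))) (sym (∑-+ (f fz) _))

∑-point : ∀ {n} (f : Fin n → ℕ) i → f i ≤ ∑ f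
∑-point f fz     = m≤m+n _ _
∑-point f (fs i) = ≤-trans (∑-point (f ∘ fs) i) (m≤n+m _ _)

∑-positive : ∀ {n} (f : Fin n → ℕ) → 0 < ∑ f → ∃ λ i → 0 < f i
∑-positive {suc n} f h with f fz in eq
... | suc k = fz , subst (0 <_) (sym eq) z<s
... | zero with ∑-positive (f ∘ fs) h
...   | i , p = fs i , p

count≡∑ : ∀ {n} (P : Fin n → Bool) → count P ≡ ∑ (bit ∘ P)
count≡∑ {zero}  P = refl
count≡∑ {suc n} P = cong (bit (P fz) +_) (count≡∑ (P ∘ fs))

count-mono : ∀ {n} (P Q : Fin n → Bool) → (∀ i → P i ≡ true → Q i ≡ true) → count P ≤ count Q
count-mono P Q h = subst₂ _≤_ (sym (count≡∑ P)) (sym (count≡∑ Q)) (∑-mono (λ i → bit-mono (h i)))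

count-cover : ∀ {n} (P Q R : Fin n → Bool) → (∀ i → P i ≡ true → Q i ≡ true ⊎ R i ≡ true) →
  count P ≤ count Q + count R
count-cover {zero} P Q R h = z≤n
count-cover {suc n} P Q R h =
  (linear (bit (P fz) ∷ bit (Q fz) ∷ bit (R fz) ∷ count (P ∘ fs) ∷ count (Q ∘ fs) ∷ count (R ∘ fs) ∷ []) (
    1 ⋆ ‵ 0 ⊑ ‵ 1 ⊕ ‵ 2 by one (h fz) ∙ 1 ⋆ ‵ 3 ⊑ ‵ 4 ⊕ ‵ 5 by count-cover (P ∘ fs) (Q ∘ fs) (R ∘ fs) (h ∘ fs) ∙
    end) 1 (‵ 0 ⊕ ‵ 3) (‵ 1 ⊕ ‵ 4 ⊕ (‵ 2 ⊕ ‵ 5)))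
  where
  one : ∀ {a b c} → (a ≡ true → b ≡ true ⊎ c ≡ true) → bit a ≤ bit b + bit c
  one {false}         _ = z≤n
  one {true} {true}   _ = s≤s z≤n
  one {true} {false} {true}  _ = ≤-refl
  one {true} {false} {false} k = case k refl of λ { (inj₁ ()) ; (inj₂ ()) }

count-pack : ∀ {n} (P Q R : Fin n → Bool) → (∀ i → Q i ≡ true → P i ≡ true) → (∀ i → R i ≡ true → P i ≡ true) →
  (∀ i → Q i ≡ true → R i ≡ true → ⊥) → count Q + count R ≤ count P
count-pack {zero} P Q R _ _ _ = z≤n
count-pack {suc n} P Q R h k d =
  (linear (bit (Q fz) ∷ bit (R fz) ∷ bit (P fz) ∷ count (Q ∘ fs) ∷ count (R ∘ fs) ∷ count (P ∘ fs) ∷ []) (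
    1 ⋆ ‵ 0 ⊕ ‵ 1 ⊑ ‵ 2 by one (h fz) (k fz) (d fz) ∙
    1 ⋆ ‵ 3 ⊕ ‵ 4 ⊑ ‵ 5 by count-pack (P ∘ fs) (Q ∘ fs) (R ∘ fs) (h ∘ fs) (k ∘ fs) (d ∘ fs) ∙ end)
    1 (‵ 0 ⊕ ‵ 3 ⊕ (‵ 1 ⊕ ‵ 4)) (‵ 2 ⊕ ‵ 5))
  where
  one : ∀ {a b c} → (b ≡ true → a ≡ true) → (c ≡ true → a ≡ true) → (b ≡ true → c ≡ true → ⊥) → bit b + bit c ≤ bit
      a
  one {true}  {true}  {true}  _ _ x = ⊥-elim (x refl refl)
  one {true}  {true}  {false} _ _ _ = ≤-refl
  one {true}  {false} {true}  _ _ _ = ≤-refl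
  one {true}  {false} {false} _ _ _ = z≤n
  one {false} {true}          y _ _ = case y refl of λ ()
  one {false} {false} {true}  _ y _ = case y refl of λ ()
  one {false} {false} {false} _ _ _ = z≤n

count-split : ∀ {n} (P Q : Fin n → Bool) → count P ≡ count (λ i → P i ∧ Q i) + count (λ i → P i ∧ not (Q i))
count-split P Q = ≤-antisym
  (count-cover P (λ i → P i ∧ Q i) (λ i → P i ∧ not (Q i)) (λ i p → case truth (Q i) of λ
      { (inj₁ q) → inj₁ (both p q) ; (inj₂ q) → inj₂ (both p q) }))
  (count-pack P (λ i → P i ∧ Q i) (λ i → P i ∧ not (Q i)) (λ i → ∧₁) (λ i → ∧₁) (λ i q r → not-elim (∧₂ {P i} r)
      (∧₂ {P i} q)))

count-all : ∀ n → count {n} (λ _ → true) ≡ n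
count-all zero    = refl
count-all (suc n) = cong suc (count-all n)

count≤ : ∀ {n} (P : Fin n → Bool) → count P ≤ n
count≤ {n} P = subst (count P ≤_) (count-all n) (count-mono P (λ _ → true) (λ _ _ → refl))

count-not : ∀ {n} (P : Fin n → Bool) → count P + count (not ∘ P) ≡ n
count-not {n} P = trans (sym (count-split (λ _ → true) P)) (count-all n)

count-point : ∀ {n} (P : Fin n → Bool) {i} → P i ≡ true → 1 ≤ count P
count-point P {i} h = subst (1 ≤_) (sym (count≡∑ P)) (≤-trans (≤-reflexive (sym (bit-true h)))
    (∑-point (bit ∘ P) i))

count-positive : ∀ {n} (P : Fin n → Bool) → 0 < count P → ∃ λ i → P i ≡ true
count-positive P h with ∑-positive (bit ∘ P) (subst (0 <_) (count≡∑ P) h)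
... | i , b with P i in eq
...   | true = i , eq

count-none : ∀ {n} (P : Fin n → Bool) → (∀ i → P i ≡ true → ⊥) → count P ≡ 0
count-none P h with count P in eq
... | zero  = refl
... | suc k with count-positive P (subst (0 <_) (sym eq) z<s)
...   | i , p = ⊥-elim (h i p)

count-unique : ∀ {n} (P : Fin n → Bool) → (∀ i j → P i ≡ true → P j ≡ true → i ≡ j) → count P ≤ 1
count-unique {zero}  P h = z≤n
count-unique {suc n} P h with P fz in eq
... | true  = ≤-reflexive (cong suc (count-none (P ∘ fs) (λ i p → case h fz (fs i) eq p of λ ())))
... | false = count-unique (P ∘ fs) (λ i j p q → fs-injective (h (fs i) (fs j) p q))

count-== : ∀ {n} (a : Fin n) → count (_== a) ≤ 1
count-== a = count-unique (_== a) (λ i j p q → trans (==-elim p) (sym (==-elim q)))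

-- Double counting of the pairs in R: every row of P contains at least one, every column of Q at
-- most one. A relation instead of a function allows preimages to be counted without choosing them.
count-match : ∀ {n m} (P : Fin n → Bool) (Q : Fin m → Bool) (R : Fin n → Fin m → Bool) →
  (∀ i → P i ≡ true → ∃ λ j → Q j ≡ true × R i j ≡ true) →
  (∀ i i' j → P i ≡ true → P i' ≡ true → R i j ≡ true → R i' j ≡ true → i ≡ i') → count P ≤ count Q
count-match P Q R total unique = begin
  count P                                       ≡⟨ count≡∑ P ⟩
  ∑ (bit ∘ P)                                   ≤⟨ ∑-mono row ⟩
  ∑ (λ i → ∑ (λ j → bit (P i ∧ Q j ∧ R i j)))   ≡⟨ ∑-swap (λ i j → bit (P i ∧ Q j ∧ R i j)) ⟩
  ∑ (λ j → ∑ (λ i → bit (P i ∧ Q j ∧ R i j)))   ≤⟨ ∑-mono column ⟩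
  ∑ (bit ∘ Q)                                   ≡⟨ sym (count≡∑ Q) ⟩
  count Q                                       ∎
  where
  open ≤-Reasoning
  row : ∀ i → bit (P i) ≤ ∑ (λ j → bit (P i ∧ Q j ∧ R i j))
  row i with P i in eq
  ... | false = z≤n
  ... | true with total i eq
  ...   | j , q , r = ≤-trans (≤-reflexive (sym (bit-true (both q r)))) (∑-point (λ j → bit (Q j ∧ R i j)) j)
  column : ∀ j → ∑ (λ i → bit (P i ∧ Q j ∧ R i j)) ≤ bit (Q j)
  column j with Q j in eq
  ... | false = ≤-reflexive (trans (sym (count≡∑ (λ i → P i ∧ false)))
      (count-none (λ i → P i ∧ false) (λ i h → false-elim refl (∧₂ {P i} h))))
  ... | true  = subst (_≤ 1) (count≡∑ (λ i → P i ∧ R i j)) (count-unique _ (λ i i' h h' →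
      unique i i' j (∧₁ h) (∧₁ h') (∧₂ {P i} h) (∧₂ {P i'} h')))

count-injection : ∀ {n m} (P : Fin n → Bool) (Q : Fin m → Bool) (f : Fin n → Fin m) →
  (∀ i → P i ≡ true → Q (f i) ≡ true) → (∀ i j → P i ≡ true → P j ≡ true → f i ≡ f j → i ≡ j) → count P ≤ count Q
count-injection P Q f into injective = count-match P Q (λ i j → f i == j)
  (λ i p → f i , into i p , ==-refl (f i))
  (λ i i' j p p' h h' → injective i i' p p' (trans (==-elim h) (sym (==-elim h'))))

exists? : ∀ {n} (P : Fin n → Bool) → (∃ λ i → P i ≡ true) ⊎ (∀ i → ¬ (P i ≡ true))
exists? P with any? (λ i → P i ≟ᵇ true)
... | yes h = inj₁ h
... | no h  = inj₂ (λ i p → h (i , p))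

argmin : ∀ {n} (f : Fin n → ℕ) (P : Fin n → Bool) {i} → P i ≡ true →
  ∃ λ j → P j ≡ true × (∀ k → P k ≡ true → f j ≤ f k)
argmin f P {i} p = go i p (<-wellFounded (f i))
  where
  go : ∀ i → P i ≡ true → Acc _<_ (f i) → ∃ λ j → P j ≡ true × (∀ k → P k ≡ true → f j ≤ f k)
  go i p (acc rec) with any? (λ k → (P k ≟ᵇ true) ×-dec (f k <? f i))
  ... | yes (k , q , lt) = go k q (rec lt)
  ... | no h = i , p , λ k q → ≮⇒≥ (λ lt → h (k , q , lt))

-- Minimises `∑ f ∸ f i`; the truncated subtraction is exact because no value exceeds the sum.
argmax : ∀ {n} (f : Fin n → ℕ) (P : Fin n → Bool) {i} → P i ≡ true →
  ∃ λ j → P j ≡ true × (∀ k → P k ≡ true → f k ≤ f j)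
argmax f P p with argmin (λ i → ∑ f ∸ f i) P p
... | j , q , h = j , q , λ k r → +-cancelʳ-≤ (∑ f ∸ f k) _ _ (subst (_≤ f j + (∑ f ∸ f k))
    (sym (m+[n∸m]≡n (∑-point f k)))
  (≤-trans (≤-reflexive (sym (m+[n∸m]≡n (∑-point f j)))) (+-monoʳ-≤ (f j) (h k r))))

-- Rooted trees

least : {P : ℕ → Set} → (∀ k → Dec (P k)) → ∀ k → P k → ∃ λ m → P m × (∀ j → P j → m ≤ j)
least {P} P? k p = go k p (<-wellFounded k)
  where
  below? : ∀ k → (∃ λ j → j < k × P j) ⊎ (∀ j → P j → k ≤ j)
  below? zero = inj₂ (λ _ _ → z≤n)
  below? (suc k) with below? k | P? k
  ... | inj₁ (j , lt , q) | _     = inj₁ (j , m<n⇒m<1+n lt , q)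
  ... | inj₂ h            | yes q = inj₁ (k , ≤-refl , q)
  ... | inj₂ h            | no ¬q = inj₂ (λ j q → ≤∧≢⇒< (h j q) (λ { refl → ¬q q }))
  go : ∀ k → P k → Acc _<_ k → ∃ λ m → P m × (∀ j → P j → m ≤ j)
  go k p (acc rec) with below? k
  ... | inj₁ (j , lt , q) = go j q (rec lt)
  ... | inj₂ h            = k , p , h

-- The field `edge`, that every edge is a parent edge, is the form in which acyclicity is used from
-- here on. `parent r` is an arbitrary value.
record Rooted {n} (T : SimpleGraph n) (r : Fin n) : Set where
  field
    depth       : Fin n → ℕ
    parent      : Fin n → Fin n
    depth-root  : depth r ≡ 0
    parent-adj  : ∀ x → x ≢ r → adj T (parent x) x ≡ true
    parent-depth : ∀ x → x ≢ r → depth x ≡ suc (depth (parent x))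
    edge        : ∀ x y → adj T x y ≡ true → (x ≢ r × parent x ≡ y) ⊎ (y ≢ r × parent y ≡ x)

module _ {n} (T : SimpleGraph n) (tree : IsTree T) (class : Fin n → Bool)
  (alternate : ∀ u v → adj T u v ≡ true → class u ≡ not (class v)) (r : Fin n) where

  private
    Reach : ℕ → Fin n → Set
    Reach zero    x = x ≡ r
    Reach (suc k) x = ∃ λ y → adj T y x ≡ true × Reach k y

    reach? : ∀ k x → Dec (Reach k x)
    reach? zero    x = x ≟ᶠ r
    reach? (suc k) x = any? (λ y → (adj T y x ≟ᵇ true) ×-dec reach? k y)

    reach-walk : ∀ {x z vs} k → Walk T x z vs → Reach k x → ∃ λ m → Reach m z
    reach-walk k (here _)   h = k , h
    reach-walk k (step e w) h = reach-walk (suc k) w (_ , e , h)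

    shortest : ∀ x → ∃ λ m → Reach m x × (∀ j → Reach j x → m ≤ j)
    shortest x with reach-walk 0 (proj₂ (proj₁ tree r x)) refl
    ... | k , h = least (λ k → reach? k x) k h

    δ : Fin n → ℕ
    δ x = proj₁ (shortest x)

    δ-least : ∀ x j → Reach j x → δ x ≤ j
    δ-least x = proj₂ (proj₂ (shortest x))

    δ-root : δ r ≡ 0
    δ-root = n≤0⇒n≡0 (δ-least r 0 refl)

    δ-step : ∀ x y → adj T x y ≡ true → δ y ≤ suc (δ x)
    δ-step x y e = δ-least y (suc (δ x)) (x , e , proj₁ (proj₂ (shortest x)))

    closer : ∀ x k → δ x ≡ suc k → ∃ λ y → adj T y x ≡ true × δ y ≡ k
    closer x k eq with shortest x | eq
    ... | .(suc k) , (y , e , h) , low | refl = y , e , ≤-antisym (δ-least y k h)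
      (≤-pred (low _ (y , e , proj₁ (proj₂ (shortest y)))))

    parity : ℕ → Bool
    parity zero    = class r
    parity (suc k) = not (parity k)

    parity-class : ∀ x k → δ x ≡ k → class x ≡ parity k
    parity-class x zero eq with shortest x | eq
    ... | .0 , refl , _ | refl = refl
    parity-class x (suc k) eq with closer x k eq
    ... | y , e , h = trans (sym (not-involutive (class x)))
      (cong not (trans (sym (alternate y x e)) (parity-class y k h)))

    -- The parity of the depth determines the class, so the bipartition excludes edges within a
    -- level and no odd cycle has to be built.
    levels : ∀ x y → adj T x y ≡ true → δ x ≢ δ y
    levels x y e eq with class x | class y | alternate x y e | trans (parity-class x (δ x) refl)
        (trans (cong parity eq)
      (sym (parity-class y (δ y) refl)))
    ... | true  | true  | () | _
    ... | true  | false | _  | ()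
    ... | false | true  | _  | ()
    ... | false | false | () | _

    snoc : ∀ {x y z vs} → Walk T x y vs → adj T y z ≡ true → Walk T x z (vs ++ z ∷ [])
    snoc (here y)   e  = step e (here _)
    snoc (step h w) e  = step h (snoc w e)

    Bridge : ℕ → Fin n → Fin n → Set
    Bridge k y z = ∃ λ m → ∃ λ vs → Walk T y z (y ∷ m ∷ vs) × Unique (y ∷ m ∷ vs) × All (λ v → δ v ≤ k) (y ∷ m ∷ vs)

    apart : ∀ {y vs} → All (λ v → δ v ≤ δ y) vs → All (λ v → suc (δ v) ≤ δ y) vs → All (y ≢_) vs
    apart _ []       = []
    apart (_ ∷ q) (p ∷ ps) = (λ { refl → <-irrefl refl p }) ∷ apart q ps

    -- Both vertices climb in step until they meet. All depths stay at most k, which keeps the ends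
    -- added at depth k + 1 off the path built so far.
    bridge : ∀ k y z → δ y ≡ k → δ z ≡ k → y ≢ z → Bridge k y z
    bridge zero y z p q y≢z with shortest y | p | shortest z | q
    ... | .0 , refl , _ | refl | .0 , refl , _ | refl = ⊥-elim (y≢z refl)
    bridge (suc k) y z p q y≢z with closer y k p | closer z k q
    ... | y' , e , h | z' , e' , h' with y' ≟ᶠ z'
    ...   | yes refl = y' , z ∷ [] , step (trans (adj-sym T y y') e) (step e' (here z)) ,
            ((λ { refl → 1+n≢n (trans (sym p) h) }) ∷ y≢z ∷ []) ∷ ((λ { refl → 1+n≢n (trans (sym q) h) }) ∷ []) ∷ []
                ∷ [] ,
            ≤-reflexive p ∷ m≤n⇒m≤1+n (≤-reflexive h) ∷ ≤-reflexive q ∷ []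
    ...   | no y'≢z' with bridge k y' z' h h' y'≢z'
    ...     | m , vs , w , u , low = y' , (m ∷ vs) ++ z ∷ [] , step (trans (adj-sym T y y') e) (snoc w e') ,
              AllP.++⁺ (AllM.map (λ l → λ { refl → 1+n≰n (≤-trans (≤-reflexive (sym p)) l) }) low) (y≢z ∷ []) ∷
              UniqueP.++⁺ u ([] ∷ []) (λ { (i , here refl) → 1+n≰n (≤-trans (≤-reflexive (sym q))
                  (AllM.lookup low i)) }) ,
              ≤-reflexive p ∷ AllP.++⁺ (AllM.map m≤n⇒m≤1+n low) (≤-reflexive q ∷ [])

    -- Two neighbours one level up would close a cycle through x, which lies below every vertex of
    -- the bridge between them. The bridge has two vertices at least, so the cycle has the three
    -- that `HasCycle` asks for.
    closer-unique : ∀ x y z → adj T y x ≡ true → adj T z x ≡ true → suc (δ y) ≡ δ x → suc (δ z) ≡ δ x → y ≡ z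
    closer-unique x y z e e' p q with y ≟ᶠ z
    ... | yes eq = eq
    ... | no y≢z with bridge (δ y) y z refl (ℕ-suc-injective (trans q (sym p))) y≢z
    ...   | m , vs , w , u , low = ⊥-elim (proj₂ tree (x , z , y , m , vs , step (trans (adj-sym T x y) e) w ,
            AllM.map (λ l → λ { refl → 1+n≰n (≤-trans (≤-reflexive p) l) }) low ∷ u , e'))

    above : ∀ x → ∃ λ y → x ≢ r → adj T y x ≡ true × δ x ≡ suc (δ y)
    above x = go (δ x) refl
      where
      go : ∀ k → δ x ≡ k → ∃ λ y → x ≢ r → adj T y x ≡ true × δ x ≡ suc (δ y)
      go (suc k) eq with closer x k eq
      ... | y , e , h = y , λ _ → e , trans eq (cong suc (sym h))
      go zero eq with shortest x | eq
      ... | .0 , h , _ | refl = r , λ x≢r → ⊥-elim (x≢r h)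

    up : Fin n → Fin n
    up x = proj₁ (above x)

    up-spec : ∀ x → x ≢ r → adj T (up x) x ≡ true × δ x ≡ suc (δ (up x))
    up-spec x = proj₂ (above x)

    nonroot : ∀ {x k} → δ x ≡ suc k → x ≢ r
    nonroot eq refl = case trans (sym δ-root) eq of λ ()

    up-unique : ∀ x y → adj T y x ≡ true → δ x ≡ suc (δ y) → x ≢ r × up x ≡ y
    up-unique x y e eq with up-spec x (nonroot eq)
    ... | e' , eq' = nonroot eq , closer-unique x (up x) y e' e (sym eq') (sym eq)

  abstract
    root-at : Rooted T r
    root-at = record
      { depth = δ ; parent = up ; depth-root = δ-root
      ; parent-adj = λ x h → proj₁ (up-spec x h) ; parent-depth = λ x h → proj₂ (up-spec x h)
      ; edge = λ x y e → case <-cmp (δ x) (δ y) of λ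
          { (tri< lt _ _) → inj₂ (up-unique y x e (≤-antisym (δ-step x y e) lt))
          ; (tri≈ _ eq _) → ⊥-elim (levels x y e eq)
          ; (tri> _ _ gt) → inj₁ (up-unique x y (trans (adj-sym T y x) e)
              (≤-antisym (δ-step y x (trans (adj-sym T y x) e)) gt)) } }

-- Weighted sums and cheapest subsets

wsum : ∀ {n} → (Fin n → Bool) → (Fin n → ℕ) → ℕ
wsum H g = ∑ (λ z → if H z then g z else 0)

if-mono : ∀ {a b x y} → (a ≡ true → b ≡ true) → (a ≡ true → x ≤ y) → (if a then x else 0) ≤ (if b then y else 0)
if-mono {false}         _ _ = z≤n
if-mono {true}  {true}  _ k = k refl
if-mono {true}  {false} h _ = case h refl of λ ()

wsum-mono : ∀ {n} {H K : Fin n → Bool} {g h : Fin n → ℕ} → (∀ z → H z ≡ true → K z ≡ true) →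
  (∀ z → H z ≡ true → g z ≤ h z) → wsum H g ≤ wsum K h
wsum-mono H⊆K g≤h = ∑-mono (λ z → if-mono (H⊆K z) (g≤h z))

wsum-split : ∀ {n} (H K : Fin n → Bool) g → wsum H g ≡ wsum (λ z → H z ∧ K z) g + wsum (λ z → H z ∧ not (K z)) g
wsum-split H K g = trans (∑-cong (λ z → one (H z) (K z) (g z)))
  (∑-+ (λ z → if H z ∧ K z then g z else 0) (λ z → if H z ∧ not (K z) then g z else 0))
  where
  one : ∀ a b x → (if a then x else 0) ≡ (if a ∧ b then x else 0) + (if a ∧ not b then x else 0)
  one false b     x = refl
  one true  true  x = sym (+-identityʳ x)
  one true  false x = refl

wsum-point : ∀ {n} (H : Fin n → Bool) g {z} → H z ≡ true → g z ≤ wsum H g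
wsum-point H g {z} h = ≤-trans (≤-reflexive (one h)) (∑-point (λ z → if H z then g z else 0) z)
  where
  one : ∀ {a x} → a ≡ true → x ≡ (if a then x else 0)
  one refl = refl

wsum-single : ∀ {n} (H : Fin n → Bool) g z → wsum (λ y → H y ∧ (y == z)) g ≤ g z
wsum-single {suc n} H g fz = begin
  (if H fz ∧ true then g fz else 0) + wsum (λ y → H (fs y) ∧ false) (g ∘ fs)
    ≤⟨ +-mono-≤ (if-mono {b = true} (λ _ → refl) (λ _ → ≤-refl)) (≤-reflexive (trans
        (∑-cong (λ y → none (H (fs y)))) (trans (∑-const n 0) (*-zeroʳ n)))) ⟩
  g fz + 0 ≡⟨ +-identityʳ _ ⟩
  g fz ∎
  where
  open ≤-Reasoning
  none : ∀ a {x} → (if a ∧ false then x else 0) ≡ 0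
  none true  = refl
  none false = refl
wsum-single {suc n} H g (fs z) = begin
  (if H fz ∧ false then g fz else 0) + wsum (λ y → H (fs y) ∧ (fs y == fs z)) (g ∘ fs)
    ≤⟨ +-mono-≤ (none (H fz)) (wsum-mono {g = g ∘ fs} (λ y h → both (∧₁ h)
        (⌊⌋-intro (y ≟ᶠ z) (fs-injective (==-elim (∧₂ {H (fs y)} h))))) (λ _ _ → ≤-refl)) ⟩
  wsum (λ y → H (fs y) ∧ (y == z)) (g ∘ fs) ≤⟨ wsum-single (H ∘ fs) (g ∘ fs) z ⟩
  g (fs z) ∎
  where
  open ≤-Reasoning
  none : ∀ a {x} → (if a ∧ false then x else 0) ≤ 0
  none true  = z≤n
  none false = z≤n

wsum-bound : ∀ {n} (H : Fin n → Bool) g m → (∀ z → H z ≡ true → g z ≤ m) → wsum H g ≤ count H * m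
wsum-bound {zero}  H g m h = z≤n
wsum-bound {suc n} H g m h with H fz | h fz
... | false | _ = wsum-bound (H ∘ fs) (g ∘ fs) m (h ∘ fs)
... | true  | k = +-mono-≤ (k refl) (wsum-bound (H ∘ fs) (g ∘ fs) m (h ∘ fs))

wsum-bound-below : ∀ {n} (H : Fin n → Bool) g m → (∀ z → H z ≡ true → m ≤ g z) → count H * m ≤ wsum H g
wsum-bound-below {zero}  H g m h = z≤n
wsum-bound-below {suc n} H g m h with H fz | h fz
... | false | _ = wsum-bound-below (H ∘ fs) (g ∘ fs) m (h ∘ fs)
... | true  | k = +-mono-≤ (k refl) (wsum-bound-below (H ∘ fs) (g ∘ fs) m (h ∘ fs))

_⊆_ : ∀ {n} → (Fin n → Bool) → (Fin n → Bool) → Set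
P ⊆ Q = ∀ i → P i ≡ true → Q i ≡ true

-- Minimality is by cardinality, not by inclusion, so it speaks about every smaller `Q` in `C`. This
-- is the source of robustness: fewer than k vertices meet fewer than k of the disjoint subtrees,
-- and these weigh less than ℓ.
record Cheapest {n} (C : Fin n → Bool) (g : Fin n → ℕ) (ℓ : ℕ) : Set where
  field
    set     : Fin n → Bool
    inside  : set ⊆ C
    enough  : ℓ ≤ wsum set g
    minimal : ∀ Q → Q ⊆ C → count Q < count set → wsum Q g < ℓ

  -- Without z the set has fewer members, hence weight below ℓ.
  bound : ∀ {z} → set z ≡ true → wsum set g < ℓ + g z
  bound {z} h = begin-strict
    wsum set g ≡⟨ wsum-split set (_== z) g ⟩
    wsum (λ y → set y ∧ (y == z)) g + wsum rest g ≤⟨ +-monoˡ-≤ _ (wsum-single set g z) ⟩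
    g z + wsum rest g <⟨ +-monoʳ-< (g z) (minimal rest (λ i → inside i ∘ ∧₁) fewer) ⟩
    g z + ℓ ≡⟨ +-comm (g z) ℓ ⟩
    ℓ + g z ∎
    where
    open ≤-Reasoning
    rest = λ y → set y ∧ not (y == z)
    fewer : count rest < count set
    fewer = linear (count (λ y → set y ∧ (y == z)) ∷ count rest ∷ count set ∷ []) (
      1 ⋆ ‵ 0 ⊕ ‵ 1 ⊑ ‵ 2 by ≤-reflexive (sym (count-split set (_== z))) ∙
      1 ⋆ κ 1 ⊑ ‵ 0 by count-point (λ y → set y ∧ (y == z)) {z} (both h (==-refl z)) ∙ end) 1 (κ 1 ⊕ ‵ 1) (‵ 2)

abstract
  cheapest : ∀ {n} (C : Fin n → Bool) (g : Fin n → ℕ) ℓ → ℓ ≤ wsum C g → Cheapest C g ℓ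
  -- Exhaustive search is available for vectors, so subsets are tabulated; predicates and their
  -- tables agree only pointwise, which the transfers below take care of.
  cheapest {n} C g ℓ h with least size? (count (mem whole)) (whole , refl , (λ i → to≗ C i) , ≤-trans h (≗-wsum C))
    where
    mem : Vec.Vec Bool n → Fin n → Bool
    mem = Vec.lookup
    whole : Vec.Vec Bool n
    whole = Vec.tabulate C
    to≗ : ∀ Q i → mem (Vec.tabulate Q) i ≡ true → Q i ≡ true
    to≗ Q i = trans (sym (VecP.lookup∘tabulate Q i))
    ≗-wsum : ∀ Q → wsum Q g ≤ wsum (mem (Vec.tabulate Q)) g
    ≗-wsum Q = wsum-mono (λ i q → trans (VecP.lookup∘tabulate Q i) q) (λ _ _ → ≤-refl)
    size? : ∀ k → Dec (∃ λ v → count (mem v) ≡ k × (mem v ⊆ C) × ℓ ≤ wsum (mem v) g)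
    size? k = anySubset? (λ v → (count (mem v) ≟ k) ×-dec
      (all? (λ i → (mem v i ≟ᵇ true) →-dec (C i ≟ᵇ true)) ×-dec (ℓ ≤? wsum (mem v) g)))
  ... | k , (v , refl , sub , ok) , low = record
    { set = Vec.lookup v ; inside = sub ; enough = ok
    ; minimal = λ Q Q⊆C lt → ≰⇒> (λ le → <⇒≱ lt (≤-trans (low _ (Vec.tabulate Q , refl ,
        (λ i q → Q⊆C i (trans (sym (VecP.lookup∘tabulate Q i)) q)) ,
        ≤-trans le (wsum-mono (λ i q → trans (VecP.lookup∘tabulate Q i) q) (λ _ _ → ≤-refl))))
        (count-mono (Vec.lookup (Vec.tabulate Q)) Q (λ i q → trans (sym (VecP.lookup∘tabulate Q i)) q)))) }

-- Subtrees of a rooted tree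

module Subtrees {n} {T : SimpleGraph n} {r : Fin n} (R : Rooted T r) where
  open Rooted R public

  -- The ancestor order, with the root at the bottom: the subtree at w consists of all x with
  -- `w ⊑ x`.
  data _⊑_ (w : Fin n) : Fin n → Set where
    stop : w ⊑ w
    down : ∀ {x} → x ≢ r → w ⊑ parent x → w ⊑ x

  ⊑-trans : ∀ {u v w} → u ⊑ v → v ⊑ w → u ⊑ w
  ⊑-trans p stop       = p
  ⊑-trans p (down h q) = down h (⊑-trans p q)

  ⊑-depth : ∀ {w x} → w ⊑ x → depth w ≤ depth x
  ⊑-depth stop       = ≤-refl
  ⊑-depth (down h p) = ≤-trans (m≤n⇒m≤1+n (⊑-depth p)) (≤-reflexive (sym (parent-depth _ h)))

  ⊑-level : ∀ {w x} → w ⊑ x → depth x ≤ depth w → x ≡ w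
  ⊑-level stop       _ = refl
  ⊑-level (down h p) l = ⊥-elim (1+n≰n (≤-trans (≤-reflexive (sym (parent-depth _ h))) (≤-trans l (⊑-depth p))))

  ⊑-unique : ∀ {v w x} → v ⊑ x → w ⊑ x → depth v ≡ depth w → v ≡ w
  ⊑-unique stop       q          eq = ⊑-level q (≤-reflexive eq)
  ⊑-unique (down h p) stop       eq = sym (⊑-level (down h p) (≤-reflexive (sym eq)))
  ⊑-unique (down h p) (down _ q) eq = ⊑-unique p q eq

  Child : Fin n → Fin n → Set
  Child w z = z ≢ r × parent z ≡ w

  child-depth : ∀ {w z} → Child w z → depth z ≡ suc (depth w)
  child-depth (h , refl) = parent-depth _ h

  child-⊑ : ∀ {w z x} → Child w z → z ⊑ x → w ⊑ x
  child-⊑ (h , refl) p = ⊑-trans (down h stop) p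

  below-child : ∀ {w x} → w ⊑ x → x ≢ w → ∃ λ z → Child w z × z ⊑ x
  below-child stop h = ⊥-elim (h refl)
  below-child {w} {x} (down x≢r p) h with parent x ≟ᶠ w
  ... | yes eq = x , (x≢r , eq) , stop
  ... | no ne with below-child p ne
  ...   | z , c , q = z , c , down x≢r q

  -- Every edge is a parent edge, so a subtree can be left only by climbing from its top vertex. All
  -- claims about edges that cross a cut reduce to this.
  exit : ∀ {z x y} → adj T x y ≡ true → z ⊑ x → ¬ (z ⊑ y) → x ≡ z × Child y z
  exit {z} {x} {y} e p q with edge x y e | p
  ... | inj₂ (h , refl) | p        = ⊥-elim (q (down h p))
  ... | inj₁ (h , refl) | stop     = refl , h , refl
  ... | inj₁ (h , refl) | down _ k = ⊥-elim (q k)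

  abstract
   ⊑? : ∀ w x → Dec (w ⊑ x)
   ⊑? w x = go (depth x) x ≤-refl
     where
     go : ∀ k x → depth x ≤ k → Dec (w ⊑ x)
     go k x le with x ≟ᶠ w
     ... | yes refl = yes stop
     ... | no ne with x ≟ᶠ r
     ...   | yes refl = no (λ { stop → ne refl ; (down h _) → h refl })
     go zero x le | no ne | no x≢r = ⊥-elim
         (1+n≰n (≤-trans (s≤s z≤n) (≤-trans (≤-reflexive (sym (parent-depth x x≢r))) le)))
     go (suc k) x le | no ne | no x≢r with go k (parent x) (≤-pred (≤-trans (≤-reflexive (sym (parent-depth x x≢r)))
         le))
     ... | yes p = yes (down x≢r p)
     ... | no ¬p = no (λ { stop → ne refl ; (down _ p) → ¬p p })

  root-⊑ : ∀ x → r ⊑ x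
  root-⊑ x = go (depth x) x ≤-refl
    where
    go : ∀ k x → depth x ≤ k → r ⊑ x
    go k x le with x ≟ᶠ r
    ... | yes refl = stop
    go zero    x le | no h = ⊥-elim (1+n≰n (≤-trans (s≤s z≤n) (≤-trans (≤-reflexive (sym (parent-depth x h))) le)))
    go (suc k) x le | no h = down h (go k (parent x) (≤-pred (≤-trans (≤-reflexive (sym (parent-depth x h))) le)))

  sub : Fin n → Fin n → Bool
  sub w x = ⌊ ⊑? w x ⌋

  sub⇒ : ∀ {w x} → sub w x ≡ true → w ⊑ x
  sub⇒ = ⌊⌋-elim (⊑? _ _)

  sub⇐ : ∀ {w x} → w ⊑ x → sub w x ≡ true
  sub⇐ = ⌊⌋-intro (⊑? _ _)

  child : Fin n → Fin n → Bool
  child w z = not (z == r) ∧ (parent z == w)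

  child⇒ : ∀ {w z} → child w z ≡ true → Child w z
  child⇒ {w} {z} h = (λ { refl → not-elim (∧₁ h) (==-refl r) }) , ==-elim (∧₂ {not (z == r)} h)

  child⇐ : ∀ {w z} → Child w z → child w z ≡ true
  child⇐ {w} {z} (h , refl) = both (not-intro (h ∘ ==-elim)) (==-refl (parent z))

  weight : (Fin n → Bool) → Fin n → ℕ
  weight P z = count (λ x → sub z x ∧ P x)

  size : Fin n → ℕ
  size z = count (sub z)

  union : (Fin n → Bool) → Fin n → Bool
  union H x = ⌊ any? (λ z → (H z ≟ᵇ true) ×-dec (sub z x ≟ᵇ true)) ⌋

  union⇒ : ∀ {H x} → union H x ≡ true → ∃ λ z → H z ≡ true × z ⊑ x
  union⇒ h with ⌊⌋-elim (any? _) h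
  ... | z , p , q = z , p , sub⇒ q

  union⇐ : ∀ {H z x} → H z ≡ true → z ⊑ x → union H x ≡ true
  union⇐ p q = ⌊⌋-intro (any? _) (_ , p , sub⇐ q)

  Disjoint : (Fin n → Bool) → Set
  Disjoint H = ∀ {y z x} → H y ≡ true → H z ≡ true → y ⊑ x → z ⊑ x → y ≡ z

  disjoint-⊆ : ∀ {H K} → H ⊆ K → Disjoint K → Disjoint H
  disjoint-⊆ h d p q = d (h _ p) (h _ q)

  children-disjoint : ∀ w → Disjoint (child w)
  children-disjoint w p q y⊑x z⊑x = ⊑-unique y⊑x z⊑x (trans (child-depth (child⇒ p)) (sym (child-depth (child⇒ q))))

  -- Interchange of summation; disjointness means that exactly one subtree accounts for each vertex
  -- of the union.
  union-weight : ∀ H P → Disjoint H → count (λ x → union H x ∧ P x) ≡ wsum H (weight P)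
  union-weight H P d = begin
    count (λ x → union H x ∧ P x)                              ≡⟨ count≡∑ (λ x → union H x ∧ P x) ⟩
    ∑ (λ x → bit (union H x ∧ P x))                            ≡⟨ ∑-cong column ⟩
    ∑ (λ x → ∑ (λ z → bit (H z ∧ sub z x ∧ P x)))              ≡⟨ ∑-swap (λ x z → bit (H z ∧ sub z x ∧ P x)) ⟩
    ∑ (λ z → ∑ (λ x → bit (H z ∧ sub z x ∧ P x)))              ≡⟨ ∑-cong row ⟩
    wsum H (weight P)                                          ∎
    where
    open Relation.Binary.PropositionalEquality.≡-Reasoning
    row : ∀ z → ∑ (λ x → bit (H z ∧ sub z x ∧ P x)) ≡ (if H z then weight P z else 0)
    row z with H z
    ... | true  = sym (count≡∑ (λ x → sub z x ∧ P x))
    ... | false = trans (∑-const n 0) (*-zeroʳ n)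
    column : ∀ x → bit (union H x ∧ P x) ≡ ∑ (λ z → bit (H z ∧ sub z x ∧ P x))
    column x = ≤-antisym hit (subst (_≤ bit (union H x ∧ P x)) (count≡∑ (λ z → H z ∧ sub z x ∧ P x)) once)
      where
      hit : bit (union H x ∧ P x) ≤ ∑ (λ z → bit (H z ∧ sub z x ∧ P x))
      hit with union H x ∧ P x in eq
      ... | false = z≤n
      ... | true with union⇒ {H} {x} (∧₁ eq)
      ...   | z , p , q = ≤-trans (≤-reflexive (sym (bit-true (both p (both (sub⇐ q) (∧₂ {union H x} eq))))))
                (∑-point (λ z → bit (H z ∧ sub z x ∧ P x)) z)
      once : count (λ z → H z ∧ sub z x ∧ P x) ≤ bit (union H x ∧ P x)
      once with union H x ∧ P x in eq
      ... | true  = count-unique (λ z → H z ∧ sub z x ∧ P x) (λ y z p q → d (∧₁ p) (∧₁ q) (sub⇒ (∧₁ (∧₂ {H y} p)))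
          (sub⇒ (∧₁ (∧₂ {H z} q))))
      ... | false = ≤-reflexive (count-none (λ z → H z ∧ sub z x ∧ P x)
          (λ z p → false-elim eq (both (union⇐ {H} (∧₁ p) (sub⇒ (∧₁ (∧₂ {H z} p))))
          (∧₂ {sub z x} (∧₂ {H z} p)))))

  weight-all : ∀ z → weight (λ _ → true) z ≡ size z
  weight-all z = ≤-antisym (count-mono (λ x → sub z x ∧ true) (sub z) (λ x → ∧₁))
      (count-mono (sub z) (λ x → sub z x ∧ true) (λ x h → both h refl))

  union-size : ∀ H → Disjoint H → count (union H) ≡ wsum H size
  union-size H d = trans (≤-antisym (count-mono (union H) (λ x → union H x ∧ true) (λ x h → both h refl))
    (count-mono (λ x → union H x ∧ true) (union H) (λ x → ∧₁)))
    (trans (union-weight H (λ _ → true) d) (∑-cong (λ z → cong (λ s → if H z then s else 0) (weight-all z))))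

  weight-children : ∀ P w → weight P w ≤ bit (P w) + wsum (child w) (weight P)
  weight-children P w = begin
    weight P w ≤⟨ count-cover (λ x → sub w x ∧ P x) (λ x → (x == w) ∧ P x) (λ x → union (child w) x ∧ P x) cases ⟩
    count (λ x → (x == w) ∧ P x) + count (λ x → union (child w) x ∧ P x)
      ≤⟨ +-mono-≤ point (≤-reflexive (union-weight (child w) P (children-disjoint w))) ⟩
    bit (P w) + wsum (child w) (weight P) ∎
    where
    open ≤-Reasoning
    cases : ∀ x → sub w x ∧ P x ≡ true → (x == w) ∧ P x ≡ true ⊎ union (child w) x ∧ P x ≡ true
    cases x h with truth (x == w)
    ... | inj₁ eq = inj₁ (both eq (∧₂ {sub w x} h))
    ... | inj₂ ne with below-child (sub⇒ (∧₁ h)) (λ eq → not-elim ne (⌊⌋-intro (x ≟ᶠ w) eq))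
    ...   | z , c , q = inj₂ (both (union⇐ {child w} (child⇐ c) q) (∧₂ {sub w x} h))
    point : count (λ x → (x == w) ∧ P x) ≤ bit (P w)
    point with P w in eq
    ... | true  = ≤-trans (count-mono (λ x → (x == w) ∧ P x) (_== w) (λ x → ∧₁)) (count-== w)
    ... | false = ≤-reflexive (count-none (λ x → (x == w) ∧ P x)
        (λ x h → false-elim eq (subst (λ v → P v ≡ true) (==-elim (∧₁ h)) (∧₂ {x == w} h))))

  size-children : ∀ w → size w ≤ 1 + wsum (child w) size
  size-children w = ≤-trans (≤-reflexive (sym (weight-all w))) (≤-trans (weight-children (λ _ → true) w)
    (≤-reflexive (cong suc (∑-cong (λ z → cong (λ s → if child w z then s else 0) (weight-all z))))))

  wsum-children≤ : ∀ P w → bit (P w) + wsum (child w) (weight P) ≤ weight P w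
  wsum-children≤ P w = subst (λ s → bit (P w) + s ≤ weight P w) (union-weight (child w) P (children-disjoint w))
    (≤-trans (+-monoˡ-≤ _ point) (count-pack (λ x → sub w x ∧ P x) (λ x → (x == w) ∧ P x)
        (λ x → union (child w) x ∧ P x)
      (λ x h → both (sub⇐ (subst (w ⊑_) (sym (==-elim (∧₁ h))) stop)) (∧₂ {x == w} h))
      (λ x h → case union⇒ {child w} (∧₁ h) of λ { (z , c , q) → both (sub⇐ (child-⊑ (child⇒ c) q))
          (∧₂ {union (child w) x} h) })
      (λ x h k → case union⇒ {child w} (∧₁ k) of λ
          { (z , c , q) → 1+n≰n (≤-trans (≤-reflexive (sym (child-depth (child⇒ c))))
        (subst (λ v → depth z ≤ depth v) (==-elim (∧₁ h)) (⊑-depth q))) })))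
    where
    point : bit (P w) ≤ count (λ x → (x == w) ∧ P x)
    point with P w in eq
    ... | true  = count-point (λ x → (x == w) ∧ P x) {w} (both (==-refl w) eq)
    ... | false = z≤n

  size-child : ∀ {w z} → Child w z → size z < size w
  size-child {w} {z} c = ≤-trans (s≤s (wsum-point (child w) size (child⇐ c)))
    (subst₂ _≤_ (cong suc (∑-cong (λ z → cong (λ s → if child w z then s else 0) (weight-all z)))) (weight-all w)
      (wsum-children≤ (λ _ → true) w))

  weight≤size : ∀ P z → weight P z ≤ size z
  weight≤size P z = count-mono (λ x → sub z x ∧ P x) (sub z) (λ x → ∧₁)

  size-root : size r ≡ n
  size-root = trans (≤-antisym (count-mono (sub r) (λ _ → true) (λ _ _ → refl)) (count-mono (λ _ → true) (sub r)
      (λ x _ → sub⇐ (root-⊑ x)))) (count-all n)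

  touched : (Fin n → Bool) → (Fin n → Bool) → Fin n → Bool
  touched H Q z = H z ∧ ⌊ any? (λ p → (Q p ≟ᵇ true) ×-dec (sub z p ≟ᵇ true)) ⌋

  -- A vertex of Q lies in at most one of the subtrees. Together with `Cheapest.minimal` this bounds
  -- the total size of the subtrees that a small Q can meet.
  touched-count : ∀ H Q → Disjoint H → count (touched H Q) ≤ count Q
  touched-count H Q d = count-match (touched H Q) Q sub
    (λ z h → case ⌊⌋-elim (any? _) (∧₂ {H z} h) of λ { (p , q , s) → p , q , s })
    (λ y z p h h' s s' → d (∧₁ h) (∧₁ h') (sub⇒ s) (sub⇒ s'))

  touched-intro : ∀ {H Q z p} → H z ≡ true → Q p ≡ true → z ⊑ p → touched H Q z ≡ true
  touched-intro h q s = both h (⌊⌋-intro (any? _) (_ , q , sub⇐ s))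

-- A vertex with minimal sum of distances. Moving the root to a child u brings the vertices below u
-- one step nearer and takes the others at most one step further away; as the sum cannot drop, at
-- most half of the vertices lie below u.
centroid : ∀ {n} (T : SimpleGraph n) → (∀ r → Rooted T r) → Fin n →
  ∃ λ r → Σ (Rooted T r) λ R → let open Subtrees R in ∀ u → Child r u → size u * 2 ≤ n
centroid {n} T root r₀ with argmin (λ r → ∑ (Rooted.depth (root r))) (λ _ → true) {r₀} refl
... | r , _ , low = r , root r , half
  where
  open Subtrees (root r)
  module _ (u : Fin n) (c : Child r u) where
    module U = Subtrees (root u)
    lipschitz : ∀ x y → adj T x y ≡ true → U.depth y ≤ suc (U.depth x)
    lipschitz x y e with U.edge x y e
    ... | inj₁ (h , refl) = ≤-trans (≤-trans (n≤1+n _) (≤-reflexive (sym (U.parent-depth x h)))) (n≤1+n _)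
    ... | inj₂ (h , refl) = ≤-reflexive (U.parent-depth y h)
    edge-ru : adj T r u ≡ true
    edge-ru = subst (λ v → adj T v u ≡ true) (proj₂ c) (parent-adj u (proj₁ c))
    far : ∀ {x} → r ⊑ x → U.depth x ≤ suc (depth x)
    far stop = ≤-trans (lipschitz u r (trans (adj-sym T u r) edge-ru))
        (s≤s (≤-trans (≤-reflexive U.depth-root) z≤n))
    far (down {x} h p) = linear (U.depth x ∷ U.depth (parent x) ∷ depth (parent x) ∷ depth x ∷ []) (
      1 ⋆ ‵ 0 ⊑ κ 1 ⊕ ‵ 1 by lipschitz (parent x) x (parent-adj x h) ∙ 1 ⋆ ‵ 1 ⊑ κ 1 ⊕ ‵ 2 by far p ∙
      1 ⋆ κ 1 ⊕ ‵ 2 ⊑ ‵ 3 by ≤-reflexive (sym (parent-depth x h)) ∙ end) 1 (‵ 0) (κ 1 ⊕ ‵ 3)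
    near : ∀ {x} → u ⊑ x → suc (U.depth x) ≤ depth x
    near stop = subst₂ (λ a b → suc a ≤ b) (sym U.depth-root) (sym (child-depth c)) (s≤s z≤n)
    near (down {x} h p) = linear (U.depth x ∷ U.depth (parent x) ∷ depth (parent x) ∷ depth x ∷ []) (
      1 ⋆ ‵ 0 ⊑ κ 1 ⊕ ‵ 1 by lipschitz (parent x) x (parent-adj x h) ∙ 1 ⋆ κ 1 ⊕ ‵ 1 ⊑ ‵ 2 by near p ∙
      1 ⋆ κ 1 ⊕ ‵ 2 ⊑ ‵ 3 by ≤-reflexive (sym (parent-depth x h)) ∙ end) 1 (κ 1 ⊕ ‵ 0) (‵ 3)
    pointwise : ∀ x → U.depth x + bit (sub u x) * 2 ≤ depth x + 1
    pointwise x with ⊑? u x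
    ... | yes p = linear (U.depth x ∷ depth x ∷ []) (1 ⋆ κ 1 ⊕ ‵ 0 ⊑ ‵ 1 by near p ∙ end) 1 (‵ 0 ⊕ κ 2) (‵ 1 ⊕ κ 1)
    ... | no _  = linear (U.depth x ∷ depth x ∷ []) (1 ⋆ ‵ 0 ⊑ κ 1 ⊕ ‵ 1 by far (root-⊑ x) ∙ end)
      1 (‵ 0 ⊕ κ 0) (‵ 1 ⊕ κ 1)
    half : size u * 2 ≤ n
    half = linear (∑ (λ x → U.depth x + bit (sub u x) * 2) ∷ ∑ (λ x → depth x + 1) ∷ ∑ U.depth ∷
      ∑ (λ x → bit (sub u x) * 2) ∷ ∑ (bit ∘ sub u) ∷ size u ∷ ∑ depth ∷ ∑ {n} (λ _ → 1) ∷ n ∷ []) (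
      1 ⋆ ‵ 0 ⊑ ‵ 1 by ∑-mono pointwise ∙
      1 ⋆ ‵ 2 ⊕ ‵ 3 ⊑ ‵ 0 by ≤-reflexive (sym (∑-+ U.depth (λ x → bit (sub u x) * 2))) ∙
      1 ⋆ 2 ⊛ ‵ 4 ⊑ ‵ 3 by ≤-reflexive (sym (∑-* 2 (bit ∘ sub u))) ∙
      2 ⋆ ‵ 5 ⊑ ‵ 4 by ≤-reflexive (count≡∑ (sub u)) ∙ 1 ⋆ ‵ 1 ⊑ ‵ 6 ⊕ ‵ 7 by ≤-reflexive (∑-+ depth (λ _ → 1)) ∙
      1 ⋆ ‵ 7 ⊑ ‵ 8 by ≤-reflexive (trans (∑-const n 1) (*-identityʳ n)) ∙ 1 ⋆ ‵ 6 ⊑ ‵ 2 by low u refl ∙ end)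
      1 (2 ⊛ ‵ 5) (‵ 8)

-- Greedy embedding

pick : ∀ {N} (S B : Fin N → Bool) → count B < count S → ∃ λ h → S h ≡ true × ¬ (B h ≡ true)
pick S B lt with exists? (λ h → S h ∧ not (B h))
... | inj₁ (h , p) = h , ∧₁ p , not-elim (∧₂ {S h} p)
... | inj₂ none = ⊥-elim (<⇒≱ lt (count-mono S B (λ h s → case truth (B h) of λ
    { (inj₁ b) → b ; (inj₂ b) → ⊥-elim (none h (both s b)) })))

image : ∀ {n N} → (Fin n → Fin N) → (Fin n → Bool) → Fin N → Bool
image f P h = ⌊ any? (λ x → (P x ≟ᵇ true) ×-dec (f x ≟ᶠ h)) ⌋

image⇐ : ∀ {n N} (f : Fin n → Fin N) (P : Fin n → Bool) {x} → P x ≡ true → image f P (f x) ≡ true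
image⇐ f P {x} p = ⌊⌋-intro (any? _) (x , p , refl)

image⇒ : ∀ {n N} (f : Fin n → Fin N) (P : Fin n → Bool) {h} → image f P h ≡ true → ∃ λ x → P x ≡ true × f x ≡ h
image⇒ f P e = ⌊⌋-elim (any? _) e

image-count : ∀ {n N} (f : Fin n → Fin N) (P Q : Fin n → Bool) (S : Fin N → Bool) →
  (∀ x → P x ≡ true → S (f x) ≡ true → Q x ≡ true) → count (λ h → S h ∧ image f P h) ≤ count Q
image-count f P Q S h = count-match (λ v → S v ∧ image f P v) Q (λ v x → f x == v)
  (λ v e → case image⇒ f P (∧₂ {S v} e) of λ { (x , p , refl) → x , h x p (∧₁ e) , ==-refl (f x) })
  (λ v v' x _ _ p q → trans (sym (==-elim p)) (==-elim q))

-- The map is total throughout, but `Partial` constrains only its values at ranks below t, so the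
-- initial `f₀` may be arbitrary. Keeping E and C abstract allows trivial relations, which reduce
-- the procedure to zones and injectivity.
module _ {n N : ℕ} (rank : Fin n → ℕ) (rank-injective : ∀ x y → rank x ≡ rank y → x ≡ y)
  (D : Fin n → Bool) (Z : Fin n → Fin N → Bool) (E : Fin n → Fin n → Set) (C : Fin N → Fin N → Set)
  (C-sym : ∀ u v → C u v → C v u) (E-sym : ∀ x y → E x y → E y x) where

  record Partial (t : ℕ) (f : Fin n → Fin N) : Set where
    field
      zoned     : ∀ x → D x ≡ true → rank x < t → Z x (f x) ≡ true
      injective : ∀ x y → D x ≡ true → D y ≡ true → rank x < t → rank y < t → f x ≡ f y → x ≡ y
      edges     : ∀ x y → D x ≡ true → D y ≡ true → rank x < t → rank y < t → E x y → C (f x) (f y)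

  module _ (E-irrefl : ∀ x → ¬ E x x)
    (choose : ∀ f w → D w ≡ true → Partial (rank w) f → ∃ λ h → Z w h ≡ true ×
      (∀ x → D x ≡ true → rank x < rank w → f x ≢ h) × (∀ x → D x ≡ true → rank x < rank w → E x w → C (f x) h))
    (f₀ : Fin n → Fin N) where

    private
      earlier : ∀ {t x w} → rank w ≡ t → rank x < suc t → x ≢ w → rank x < t
      earlier refl lt ne = ≤∧≢⇒< (≤-pred lt) (λ eq → ne (rank-injective _ _ eq))

      extend : ∀ t f → Partial t f → ∃ (Partial (suc t))
      extend t f P with any? (λ w → (rank w ≟ t) ×-dec (D w ≟ᵇ true))
      ... | no none = f , record
        { zoned = λ x d lt → zoned x d (drop d lt)
        ; injective = λ x y d e lt lt' → injective x y d e (drop d lt) (drop e lt')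
        ; edges = λ x y d e lt lt' → edges x y d e (drop d lt) (drop e lt') }
        where
        open Partial P
        drop : ∀ {x} → D x ≡ true → rank x < suc t → rank x < t
        drop {x} d lt = ≤∧≢⇒< (≤-pred lt) (λ eq → none (x , eq , d))
      ... | yes (w , refl , dw) with choose f w dw P
      ...   | h , zh , new , good = g , record { zoned = gz ; injective = gi ; edges = ge }
        where
        open Partial P
        g : Fin n → Fin N
        g x with x ≟ᶠ w
        ... | yes _ = h
        ... | no _  = f x
        gz : ∀ x → D x ≡ true → rank x < suc (rank w) → Z x (g x) ≡ true
        gz x d lt with x ≟ᶠ w
        ... | yes refl = zh
        ... | no ne    = zoned x d (earlier refl lt ne)
        gi : ∀ x y → D x ≡ true → D y ≡ true → rank x < suc (rank w) → rank y < suc (rank w) → g x ≡ g y → x ≡ y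
        gi x y d e lt lt' eq with x ≟ᶠ w | y ≟ᶠ w
        ... | yes refl | yes refl = refl
        ... | yes refl | no ne = ⊥-elim (new y e (earlier refl lt' ne) (sym eq))
        ... | no ne | yes refl = ⊥-elim (new x d (earlier refl lt ne) eq)
        ... | no ne | no ne' = injective x y d e (earlier refl lt ne) (earlier refl lt' ne') eq
        ge : ∀ x y → D x ≡ true → D y ≡ true → rank x < suc (rank w) → rank y < suc (rank w) → E x y → C (g x) (g y)
        ge x y d e lt lt' adj with x ≟ᶠ w | y ≟ᶠ w
        ... | yes refl | yes refl = ⊥-elim (E-irrefl w adj)
        ... | yes refl | no ne = C-sym (f y) h (good y e (earlier refl lt' ne) (E-sym _ _ adj))
        ... | no ne | yes refl = good x d (earlier refl lt ne) adj
        ... | no ne | no ne' = edges x y d e (earlier refl lt ne) (earlier refl lt' ne') adj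

      upto : ∀ t → ∃ (Partial t)
      upto zero = f₀ , record { zoned = λ _ _ () ; injective = λ _ _ _ _ () ; edges = λ _ _ _ _ () }
      upto (suc t) with upto t
      ... | f , P = extend t f P

    greedy : ∃ λ f → (∀ x → D x ≡ true → Z x (f x) ≡ true) ×
      (∀ x y → D x ≡ true → D y ≡ true → f x ≡ f y → x ≡ y) ×
      (∀ x y → D x ≡ true → D y ≡ true → E x y → C (f x) (f y))
    -- No rank exceeds the sum of all ranks, so at this time every vertex has been treated.
    greedy with upto (suc (∑ rank))
    ... | f , P = f , (λ x d → zoned x d (s≤s (∑-point rank x))) ,
        (λ x y d e → injective x y d e (s≤s (∑-point rank x)) (s≤s (∑-point rank y))) ,
        (λ x y d e → edges x y d e (s≤s (∑-point rank x)) (s≤s (∑-point rank y)))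
      where open Partial P

-- The index of a vertex, being below n, is a last digit in base n: it breaks ties of q without
-- disturbing the order.
lexicographic : ∀ {n} (q : Fin n → ℕ) → ∃ λ (rank : Fin n → ℕ) →
  (∀ x y → rank x ≡ rank y → x ≡ y) × (∀ x y → rank x < rank y → q x ≤ q y)
lexicographic {n} q = (λ x → q x * n + toℕ x) , injective , (λ x y lt → ≮⇒≥ (λ h → <-asym lt (below y x h)))
  where
  below : ∀ x y → q x < q y → q x * n + toℕ x < q y * n + toℕ y
  below x y lt = begin-strict
    q x * n + toℕ x   <⟨ +-monoʳ-< (q x * n) (toℕ<n x) ⟩
    q x * n + n       ≡⟨ +-comm (q x * n) n ⟩
    suc (q x) * n     ≤⟨ *-monoˡ-≤ n lt ⟩
    q y * n           ≤⟨ m≤m+n _ _ ⟩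
    q y * n + toℕ y   ∎
    where open ≤-Reasoning
  injective : ∀ x y → q x * n + toℕ x ≡ q y * n + toℕ y → x ≡ y
  injective x y eq with <-cmp (q x) (q y)
  ... | tri< lt _ _ = ⊥-elim (<-irrefl eq (below x y lt))
  ... | tri> _ _ gt = ⊥-elim (<-irrefl (sym eq) (below y x gt))
  ... | tri≈ _ h _ = toℕ-injective (+-cancelˡ-≡ (q x * n) _ _ (trans eq (cong (λ k → k * n + toℕ y) (sym h))))

-- The number 1 + ∑ depth exceeds every depth and serves as the base in which the phase is the
-- leading digit.
priority : ∀ {n} (phase depth : Fin n → ℕ) → ∃ λ (rank : Fin n → ℕ) → (∀ x y → rank x ≡ rank y → x ≡ y) ×
  (∀ x y → rank x < rank y → phase x ≤ phase y) × (∀ x y → rank x < rank y → phase x ≡ phase y → depth x ≤ depth y)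
priority phase depth with lexicographic (λ x → phase x * suc (∑ depth) + depth x)
... | rank , injective , mono = rank , injective , (λ x y lt → ≮⇒≥ (λ l → <⇒≱ (begin-strict
      phase y * M + depth y  <⟨ +-monoʳ-< (phase y * M) (s≤s (∑-point depth y)) ⟩
      phase y * M + M        ≡⟨ +-comm (phase y * M) M ⟩
      suc (phase y) * M      ≤⟨ *-monoˡ-≤ M l ⟩
      phase x * M            ≤⟨ m≤m+n _ _ ⟩
      phase x * M + depth x  ∎) (mono x y lt))) ,
    (λ x y lt eq → +-cancelˡ-≤ (phase x * M) _ _ (subst (λ k → phase x * M + depth x ≤ k * M + depth y) (sym eq)
        (mono x y lt)))
  where
  M = suc (∑ depth)
  open ≤-Reasoning

-- Colours, and greedy embedding around one or two special vertices

==ᶜ-elim : ∀ c d → (c ==ᶜ d) ≡ true → c ≡ d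
==ᶜ-elim red  red  _ = refl
==ᶜ-elim blue blue _ = refl

==ᶜ-refl : ∀ c → (c ==ᶜ c) ≡ true
==ᶜ-refl red  = refl
==ᶜ-refl blue = refl

other-other : ∀ c → other (other c) ≡ c
other-other red  = refl
other-other blue = refl

not-other : ∀ c d → ¬ ((c ==ᶜ other d) ≡ true) → c ≡ d
not-other red  red  _ = refl
not-other blue blue _ = refl
not-other red  blue h = ⊥-elim (h refl)
not-other blue red  h = ⊥-elim (h refl)

not-this : ∀ c d → ¬ ((c ==ᶜ d) ≡ true) → c ≡ other d
not-this c d h = not-other c (other d) (subst (λ e → ¬ ((c ==ᶜ e) ≡ true)) (sym (other-other d)) h)

other≢ : ∀ c → c ≢ other c
other≢ red  ()
other≢ blue ()

same : Bool → Bool → Bool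
same x y = ⌊ x ≟ᵇ y ⌋

same-refl : ∀ x → same x x ≡ true
same-refl x = ⌊⌋-intro (x ≟ᵇ x) refl

implies : Bool → Bool → Bool
implies a b = not a ∨ b

implies-elim : ∀ {a b} → implies a b ≡ true → a ≡ true → b ≡ true
implies-elim h refl = h

implies-intro : ∀ {a b} → (a ≡ true → b ≡ true) → implies a b ≡ true
implies-intro {false} _ = refl
implies-intro {true}  h = h refl

module _ {N} (G : ColouredKN N) (χ : Colour) where
  miss : Fin N → Fin N → Bool
  miss u h = not ⌊ h ≟ᶠ u ⌋ ∧ (colour G u h ==ᶜ other χ)

  miss-elim : ∀ {u h} → ¬ (miss u h ≡ true) → u ≢ h → colour G u h ≡ χ
  miss-elim {u} {h} ¬m ne = not-other _ χ (λ c → ¬m (both (not-intro (λ e → ne (sym (==-elim e)))) c))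

-- The special vertices a, b are embedded first, then the ports, then the remaining vertices by increasing depth; a
-- remaining vertex then has at most two neighbours embedded before it, its parent and one child on the path to b.
module _ {n N} {T : SimpleGraph n} {a : Fin n} (R : Rooted T a) (G : ColouredKN N) (χ : Colour)
  (b : Fin n) (ha hb : Fin N) (a≡b→ : a ≡ b → ha ≡ hb) (a≢b→ : a ≢ b → ha ≢ hb) (a≁b : ¬ (adj T a b ≡ true))
  (D port z : Fin n → Bool) (Da : D a ≡ true) (Db : D b ≡ true)
  (U : Bool → Fin N → Bool) (U-disjoint : ∀ h → U true h ≡ true → U false h ≡ true → ⊥)
  (ha∉U : ∀ i → ¬ (U i ha ≡ true)) (hb∉U : ∀ i → ¬ (U i hb ≡ true)) (m : ℕ)
  (port-adj : ∀ x → port x ≡ true → adj T a x ≡ true ⊎ adj T b x ≡ true)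
  (ports-apart : ∀ x y → port x ≡ true → port y ≡ true → ¬ (adj T x y ≡ true))
  (port-room : ∀ w → D w ≡ true → port w ≡ true → count (λ x → port x ∧ same (z x) (z w)) ≤
    count (λ h → U (z w) h ∧ implies (adj T a w) (colour G ha h ==ᶜ χ) ∧ implies (adj T b w) (colour G hb h ==ᶜ χ)))
  (dense : ∀ x y → adj T x y ≡ true → D x ≡ true → D y ≡ true → x ≢ a → x ≢ b → y ≢ a → y ≢ b →
    ∀ h → U (z x) h ≡ true → deg G (other χ) h (U (z y)) ≤ m)
  (dense-a : ∀ w → D w ≡ true → ¬ (port w ≡ true) → adj T a w ≡ true → deg G (other χ) ha (U (z w)) ≤ m)
  (dense-b : ∀ w → D w ≡ true → ¬ (port w ≡ true) → adj T b w ≡ true → deg G (other χ) hb (U (z w)) ≤ m)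
  (room : ∀ i → count (λ x → D x ∧ same (z x) i) + m * 2 ≤ count (U i)) where

  open Rooted R

  private
    special : Fin n → Bool
    special x = (x == a) ∨ (x == b)

    special⇒ : ∀ {x} → special x ≡ true → x ≡ a ⊎ x ≡ b
    special⇒ {x} h with ∨-elim {x == a} h
    ... | inj₁ e = inj₁ (==-elim e)
    ... | inj₂ e = inj₂ (==-elim e)

    ordinary : ∀ {x} → ¬ (special x ≡ true) → x ≢ a × x ≢ b
    ordinary {x} h = (λ { refl → h (∨₁ (==-refl a)) }) , (λ { refl → h (∨₂ {b == a} (==-refl b)) })

    b≁a : ¬ (adj T b a ≡ true)
    b≁a e = a≁b (trans (adj-sym T a b) e)

    a≁a : ¬ (adj T a a ≡ true)
    a≁a = false-elim (irrefl T a)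

    b≁b : ¬ (adj T b b ≡ true)
    b≁b = false-elim (irrefl T b)

    port-ordinary : ∀ {x} → port x ≡ true → ¬ (special x ≡ true)
    port-ordinary {x} p s with special⇒ {x} s | port-adj x p
    ... | inj₁ refl | inj₁ e = a≁a e
    ... | inj₁ refl | inj₂ e = b≁a e
    ... | inj₂ refl | inj₁ e = a≁b e
    ... | inj₂ refl | inj₂ e = b≁b e

    phase : Fin n → ℕ
    phase x = if special x then 0 else if port x then 1 else 2

    abstract
      ordering : ∃ λ (rank : Fin n → ℕ) → (∀ x y → rank x ≡ rank y → x ≡ y) ×
        (∀ x y → rank x < rank y → phase x ≤ phase y) × (∀ x y → rank x < rank y → phase x ≡ phase y → depth x ≤
            depth y)
      ordering = priority phase depth

    rank : Fin n → ℕ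
    rank = proj₁ ordering

    rank-injective : ∀ x y → rank x ≡ rank y → x ≡ y
    rank-injective = proj₁ (proj₂ ordering)

    -- Special vertices have a single admissible host. If a and b coincide, the first test decides
    -- and `a≡b→` identifies the two hosts.
    Z : Fin n → Fin N → Bool
    Z x h = if x == a then h == ha else if x == b then h == hb else U (z x) h

    Z-a : ∀ {h} → Z a h ≡ true → h ≡ ha
    Z-a {h} p rewrite ==-refl a = ==-elim p

    Z-b : ∀ {h} → Z b h ≡ true → h ≡ hb
    Z-b {h} p with b ≟ᶠ a
    ... | yes eq = trans (==-elim p) (a≡b→ (sym eq))
    ... | no _ rewrite ==-refl b = ==-elim p

    Z-ordinary : ∀ {x h} → x ≢ a → x ≢ b → Z x h ≡ true → U (z x) h ≡ true
    Z-ordinary {x} na nb p with x ≟ᶠ a | x ≟ᶠ b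
    ... | yes e | _     = ⊥-elim (na e)
    ... | no _  | yes e = ⊥-elim (nb e)
    ... | no _  | no _  = p

    Z-ordinary⁻¹ : ∀ {x h} → x ≢ a → x ≢ b → U (z x) h ≡ true → Z x h ≡ true
    Z-ordinary⁻¹ {x} na nb p with x ≟ᶠ a | x ≟ᶠ b
    ... | yes e | _     = ⊥-elim (na e)
    ... | no _  | yes e = ⊥-elim (nb e)
    ... | no _  | no _  = p

    Z-a⁻¹ : Z a ha ≡ true
    Z-a⁻¹ rewrite ==-refl a = ==-refl ha

    Z-b⁻¹ : Z b hb ≡ true
    Z-b⁻¹ with b ≟ᶠ a
    ... | yes eq = ⌊⌋-intro (hb ≟ᶠ ha) (sym (a≡b→ (sym eq)))
    ... | no _ rewrite ==-refl b = ==-refl hb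

    E : Fin n → Fin n → Set
    E x y = adj T x y ≡ true

    C : Fin N → Fin N → Set
    C u v = colour G u v ≡ χ

    phase-special : ∀ {x} → special x ≡ true → phase x ≡ 0
    phase-special {x} h rewrite h = refl

    phase-port : ∀ {x} → ¬ (special x ≡ true) → port x ≡ true → phase x ≡ 1
    phase-port {x} h p rewrite false-intro h | p = refl

    phase-rest : ∀ {x} → ¬ (special x ≡ true) → ¬ (port x ≡ true) → phase x ≡ 2
    phase-rest {x} h p rewrite false-intro h | false-intro p = refl

    module Step (f : Fin n → Fin N) (w : Fin n) (Dw : D w ≡ true)
      (P : Partial rank rank-injective D Z E C (λ u v e → trans (colour-sym G v u) e)
          (λ x y e → trans (adj-sym T y x) e)
        (rank w) f) where
      open Partial P

      Choice : Set
      Choice = ∃ λ h → Z w h ≡ true × (∀ x → D x ≡ true → rank x < rank w → f x ≢ h) ×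
        (∀ x → D x ≡ true → rank x < rank w → E x w → C (f x) h)

      order : ∀ x → rank x < rank w → phase x ≤ phase w
      order x = proj₁ (proj₂ (proj₂ ordering)) x w

      fa : rank a < rank w → f a ≡ ha
      fa lt = Z-a (zoned a Da lt)

      fb : rank b < rank w → f b ≡ hb
      fb lt = Z-b (zoned b Db lt)

      fU : ∀ {x} → ¬ (special x ≡ true) → D x ≡ true → rank x < rank w → U (z x) (f x) ≡ true
      fU s d lt = Z-ordinary (proj₁ (ordinary s)) (proj₂ (ordinary s)) (zoned _ d lt)

      zone-eq : ∀ {i j h} → U i h ≡ true → U j h ≡ true → i ≡ j
      zone-eq {true}  {true}  _ _ = refl
      zone-eq {false} {false} _ _ = refl
      zone-eq {true}  {false} p q = ⊥-elim (U-disjoint _ p q)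
      zone-eq {false} {true}  p q = ⊥-elim (U-disjoint _ q p)

      earlier : Fin n → Bool
      earlier x = D x ∧ ⌊ rank x <? rank w ⌋

      earlier⇒ : ∀ {x} → earlier x ≡ true → D x ≡ true × rank x < rank w
      earlier⇒ {x} h = ∧₁ h , ⌊⌋-elim (rank x <? rank w) (∧₂ {D x} h)

      earlier⇐ : ∀ {x} → D x ≡ true → rank x < rank w → earlier x ≡ true
      earlier⇐ {x} d lt = both d (⌊⌋-intro (rank x <? rank w) lt)

      earlier-ordinary : ∀ {x} → earlier x ≡ true → U (z w) (f x) ≡ true → ¬ (special x ≡ true)
      earlier-ordinary {x} e u s with earlier⇒ {x} e | special⇒ {x} s
      ... | d , lt | inj₁ refl = ha∉U (z w) (subst (λ h → U (z w) h ≡ true) (fa lt) u)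
      ... | d , lt | inj₂ refl = hb∉U (z w) (subst (λ h → U (z w) h ≡ true) (fb lt) u)

      before-special : special w ≡ true → ∀ x → rank x < rank w → x ≡ a ⊎ x ≡ b
      before-special s x lt with truth (special x)
      ... | inj₁ t = special⇒ {x} t
      ... | inj₂ t with truth (port x)
      ...   | inj₁ p = ⊥-elim (1+n≰n (subst₂ _≤_ (phase-port (not-elim t) p) (phase-special {w} s) (order x lt)))
      ...   | inj₂ p = ⊥-elim (1+n≰n (≤-trans (s≤s z≤n)
                (subst₂ _≤_ (phase-rest (not-elim t) (not-elim p)) (phase-special {w} s) (order x lt))))

      choose-special : special w ≡ true → Choice
      choose-special s with special⇒ {w} s
      ... | inj₁ refl = ha , Z-a⁻¹ , fresh , clear
        where
        fresh : ∀ x → D x ≡ true → rank x < rank a → f x ≢ ha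
        fresh x d lt eq with before-special s x lt
        ... | inj₁ refl = <-irrefl refl lt
        ... | inj₂ refl = a≢b→ (λ { refl → <-irrefl refl lt }) (trans (sym eq) (fb lt))
        clear : ∀ x → D x ≡ true → rank x < rank a → E x a → C (f x) ha
        clear x d lt e with before-special s x lt
        ... | inj₁ refl = ⊥-elim (a≁a e)
        ... | inj₂ refl = ⊥-elim (b≁a e)
      ... | inj₂ refl = hb , Z-b⁻¹ , fresh , clear
        where
        fresh : ∀ x → D x ≡ true → rank x < rank b → f x ≢ hb
        fresh x d lt eq with before-special s x lt
        ... | inj₁ refl = a≢b→ (λ { refl → <-irrefl refl lt }) (trans (sym (fa lt)) eq)
        ... | inj₂ refl = <-irrefl refl lt
        clear : ∀ x → D x ≡ true → rank x < rank b → E x b → C (f x) hb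
        clear x d lt e with before-special s x lt
        ... | inj₁ refl = ⊥-elim (a≁b e)
        ... | inj₂ refl = ⊥-elim (b≁b e)

      module PortStep (p : port w ≡ true) where
        candidate : Fin N → Bool
        candidate h = U (z w) h ∧ implies (adj T a w) (colour G ha h ==ᶜ χ) ∧ implies (adj T b w)
            (colour G hb h ==ᶜ χ)

        peer rival : Fin n → Bool
        peer x = port x ∧ same (z x) (z w)
        rival x = peer x ∧ not (x == w)

        before : ∀ x → rank x < rank w → ¬ (special x ≡ true) → port x ≡ true
        before x lt s with truth (port x)
        ... | inj₁ q = q
        ... | inj₂ q = ⊥-elim (1+n≰n (subst₂ _≤_ (phase-rest s (not-elim q)) (phase-port (port-ordinary p) p)
            (order x lt)))

        rivals : ∀ x → earlier x ≡ true → candidate (f x) ≡ true → rival x ≡ true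
        rivals x e c with earlier⇒ {x} e
        ... | d , lt = both (both (before x lt s) (⌊⌋-intro (z x ≟ᵇ z w) (zone-eq (fU s d lt) u)))
              (not-intro (λ eq → case ==-elim eq of λ { refl → <-irrefl refl lt }))
          where
          u : U (z w) (f x) ≡ true
          u = ∧₁ c
          s = earlier-ordinary e u

        occupied : Fin N → Bool
        occupied h = candidate h ∧ image f earlier h

        -- w is one of its own peers but has not been placed; this makes the inequality strict
        -- although `port-room` is not.
        free : count occupied < count candidate
        free = linear (count occupied ∷ count rival ∷ count (λ x → peer x ∧ (x == w)) ∷ count peer ∷
          count candidate ∷ []) (1 ⋆ ‵ 0 ⊑ ‵ 1 by image-count f earlier rival candidate rivals ∙
          1 ⋆ ‵ 2 ⊕ ‵ 1 ⊑ ‵ 3 by ≤-reflexive (sym (count-split peer (_== w))) ∙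
          1 ⋆ κ 1 ⊑ ‵ 2 by count-point (λ x → peer x ∧ (x == w)) {w} (both (both p (same-refl (z w))) (==-refl w)) ∙
          1 ⋆ ‵ 3 ⊑ ‵ 4 by port-room w Dw p ∙ end) 1 (κ 1 ⊕ ‵ 0) (‵ 4)

        complete : (∃ λ h → candidate h ≡ true × ¬ (occupied h ≡ true)) → Choice
        complete (h , c , new) = h , Z-ordinary⁻¹ {w} (proj₁ (ordinary (port-ordinary p)))
            (proj₂ (ordinary (port-ordinary p))) (∧₁ c) ,
            (λ { x d lt refl → new (both c (image⇐ f earlier (earlier⇐ d lt))) }) , clear
          where
          clear : ∀ x → D x ≡ true → rank x < rank w → E x w → C (f x) h
          clear x d lt e with truth (special x)
          ... | inj₂ s = ⊥-elim (ports-apart x w (before x lt (not-elim s)) p e)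
          ... | inj₁ s with special⇒ {x} s
          ...   | inj₁ refl = trans (cong (λ v → colour G v h) (fa lt))
              (==ᶜ-elim _ _ (implies-elim (∧₁ (∧₂ {U (z w) h} c)) e))
          ...   | inj₂ refl = trans (cong (λ v → colour G v h) (fb lt))
                  (==ᶜ-elim _ _ (implies-elim (∧₂ {implies (adj T a w) (colour G ha h ==ᶜ χ)} (∧₂ {U (z w) h} c))
                      e))

        choice : Choice
        choice = complete (pick candidate occupied free)

      module RestStep (ns : ¬ (special w ≡ true)) (np : ¬ (port w ≡ true)) where
        w≢a = proj₁ (ordinary {w} ns)
        w≢b = proj₂ (ordinary {w} ns)

        active : Fin n → Bool
        active x = earlier x ∧ adj T x w

        bad : Fin n → Fin N → Bool
        bad x h = U (z w) h ∧ active x ∧ miss G χ (f x) h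

        bad-count : ∀ x → count (bad x) ≤ m
        bad-count x with truth (active x)
        ... | inj₂ na = ≤-trans (≤-reflexive (count-none (bad x) (λ h e → not-elim na (∧₁ (∧₂ {U (z w) h} e))))) z≤n
        ... | inj₁ act = ≤-trans (count-mono (bad x) (λ h → U (z w) h ∧ miss G χ (f x) h)
              (λ h e → both {U (z w) h} (∧₁ e) (∧₂ {active x} (∧₂ {U (z w) h} e)))) bound
          where
          d = proj₁ (earlier⇒ {x} (∧₁ act))
          lt = proj₂ (earlier⇒ {x} (∧₁ act))
          e : adj T x w ≡ true
          e = ∧₂ {earlier x} act
          bound : deg G (other χ) (f x) (U (z w)) ≤ m
          bound with truth (special x)
          ... | inj₂ s = dense x w e d Dw (proj₁ (ordinary (not-elim s))) (proj₂ (ordinary (not-elim s))) w≢a w≢b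
              (f x)
                (fU (not-elim s) d lt)
          ... | inj₁ s with special⇒ {x} s
          ...   | inj₁ refl = subst (λ v → deg G (other χ) v (U (z w)) ≤ m) (sym (fa lt)) (dense-a w Dw np e)
          ...   | inj₂ refl = subst (λ v → deg G (other χ) v (U (z w)) ≤ m) (sym (fb lt)) (dense-b w Dw np e)

        -- A child of w that precedes w is b or a port. A port below w is not a neighbour of the
        -- root a, since w ≢ a, nor a child of b, since w ≢ b; so it is the parent of b. The two
        -- possibilities exclude each other, and one vertex c covers both.
        c : Fin n
        c = if parent b == w then b else parent b

        c-child : parent b ≡ w → c ≡ b
        c-child eq rewrite ⌊⌋-intro (parent b ≟ᶠ w) eq = refl

        c-parent : parent b ≢ w → c ≡ parent b
        c-parent ne rewrite false-intro {parent b == w} (ne ∘ ==-elim) = refl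

        early-neighbour : ∀ x → D x ≡ true → rank x < rank w → E x w → x ≡ parent w ⊎ x ≡ c
        early-neighbour x d lt e with edge x w e
        ... | inj₂ (_ , eq) = inj₁ (sym eq)
        ... | inj₁ (x≢a , refl) with truth (special x)
        ...   | inj₁ s with special⇒ {x} s
        ...     | inj₁ eq = ⊥-elim (x≢a eq)
        ...     | inj₂ refl = inj₂ (sym (c-child refl))
        early-neighbour x d lt e | inj₁ (x≢a , refl) | inj₂ s with truth (port x)
        ... | inj₂ p = ⊥-elim (1+n≰n (≤-trans (≤-reflexive (sym (parent-depth x x≢a)))
            (proj₂ (proj₂ (proj₂ ordering)) x w lt
              (trans (phase-rest (not-elim s) (not-elim p)) (sym (phase-rest ns np))))))
        ... | inj₁ p with port-adj x p
        ...   | inj₁ ax with edge a x ax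
        ...     | inj₁ (ne , _) = ⊥-elim (ne refl)
        ...     | inj₂ (_ , eq) = ⊥-elim (w≢a eq)
        early-neighbour x d lt e | inj₁ (x≢a , refl) | inj₂ s | inj₁ p | inj₂ bx with edge b x bx
        ... | inj₂ (_ , eq) = ⊥-elim (w≢b eq)
        ... | inj₁ (_ , refl) = inj₂ (sym
            (c-parent (λ eq → false-elim (irrefl T x) (subst (λ v → adj T x v ≡ true) (sym eq) e))))

        peer rival : Fin n → Bool
        peer x = D x ∧ same (z x) (z w)
        rival x = peer x ∧ not (x == w)

        rivals : ∀ x → earlier x ≡ true → U (z w) (f x) ≡ true → rival x ≡ true
        rivals x e u with earlier⇒ {x} e
        ... | d , lt = both (both d (⌊⌋-intro (z x ≟ᵇ z w) (zone-eq (fU (earlier-ordinary e u) d lt) u)))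
              (not-intro (λ eq → case ==-elim eq of λ { refl → <-irrefl refl lt }))

        occupied blocked : Fin N → Bool
        occupied h = U (z w) h ∧ image f earlier h
        blocked h = occupied h ∨ (bad (parent w) h ∨ bad c h)

        -- The images of the two possible earlier neighbours exclude at most m hosts each, whence
        -- the term `m * 2` in `room`.
        free : count blocked < count (U (z w))
        free = linear (count occupied ∷ count rival ∷ count (λ x → peer x ∧ (x == w)) ∷ count peer ∷ m ∷
          count (U (z w)) ∷ count blocked ∷ count (λ h → bad (parent w) h ∨ bad c h) ∷ count (bad (parent w)) ∷
          count (bad c) ∷ []) (1 ⋆ ‵ 0 ⊑ ‵ 1 by image-count f earlier rival (U (z w)) rivals ∙
          1 ⋆ ‵ 2 ⊕ ‵ 1 ⊑ ‵ 3 by ≤-reflexive (sym (count-split peer (_== w))) ∙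
          1 ⋆ κ 1 ⊑ ‵ 2 by count-point (λ x → peer x ∧ (x == w)) {w} (both (both Dw (same-refl (z w)))
              (==-refl w)) ∙
          1 ⋆ ‵ 3 ⊕ 2 ⊛ ‵ 4 ⊑ ‵ 5 by room (z w) ∙
          1 ⋆ ‵ 6 ⊑ ‵ 0 ⊕ ‵ 7 by count-cover blocked occupied (λ h → bad (parent w) h ∨ bad c h) (λ h → ∨-elim) ∙
          1 ⋆ ‵ 7 ⊑ ‵ 8 ⊕ ‵ 9 by count-cover (λ h → bad (parent w) h ∨ bad c h) (bad (parent w)) (bad c)
              (λ h → ∨-elim) ∙
          1 ⋆ ‵ 8 ⊑ ‵ 4 by bad-count (parent w) ∙ 1 ⋆ ‵ 9 ⊑ ‵ 4 by bad-count c ∙ end) 1 (κ 1 ⊕ ‵ 6) (‵ 5)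

        complete : (∃ λ h → U (z w) h ≡ true × ¬ (blocked h ≡ true)) → Choice
        complete (h , u , ok) = h , Z-ordinary⁻¹ {w} w≢a w≢b u , new , clear
          where
          new : ∀ x → D x ≡ true → rank x < rank w → f x ≢ h
          new x d lt refl = ok (∨₁ (both u (image⇐ f earlier (earlier⇐ d lt))))
          fine : ∀ x → D x ≡ true → rank x < rank w → E x w → ¬ (bad x h ≡ true) → C (f x) h
          fine x d lt e nb = miss-elim G χ (λ ms → nb (both u (both (both (earlier⇐ d lt) e) ms))) (new x d lt)
          clear : ∀ x → D x ≡ true → rank x < rank w → E x w → C (f x) h
          clear x d lt e with early-neighbour x d lt e
          ... | inj₁ refl = fine x d lt e (λ k → ok (∨₂ {occupied h} (∨₁ k)))
          ... | inj₂ eq = fine x d lt e (λ k → ok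
              (∨₂ {occupied h} (∨₂ {bad (parent w) h} (subst (λ v → bad v h ≡ true) eq k))))

        choice : Choice
        choice = complete (pick (U (z w)) blocked free)

    choose : ∀ f w → D w ≡ true → Partial rank rank-injective D Z E C (λ u v e → trans (colour-sym G v u) e)
      (λ x y e → trans (adj-sym T y x) e) (rank w) f → ∃ λ h → Z w h ≡ true ×
      (∀ x → D x ≡ true → rank x < rank w → f x ≢ h) × (∀ x → D x ≡ true → rank x < rank w → E x w → C (f x) h)
    choose f w Dw P with truth (special w)
    ... | inj₁ s = Step.choose-special f w Dw P s
    ... | inj₂ s with truth (port w)
    ...   | inj₁ p = Step.PortStep.choice f w Dw P p
    ...   | inj₂ p = Step.RestStep.choice f w Dw P (not-elim s) (not-elim p)

  embed : ∃ λ f → f a ≡ ha × f b ≡ hb × (∀ x → D x ≡ true → x ≢ a → x ≢ b → U (z x) (f x) ≡ true) ×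
    (∀ x y → D x ≡ true → D y ≡ true → f x ≡ f y → x ≡ y) ×
    (∀ x y → D x ≡ true → D y ≡ true → adj T x y ≡ true → colour G (f x) (f y) ≡ χ)
  embed with greedy rank rank-injective D Z E C (λ u v e → trans (colour-sym G v u) e)
      (λ x y e → trans (adj-sym T y x) e)
    (λ x → false-elim (irrefl T x)) choose (λ _ → ha)
  ... | f , zoned , injective , edges = f , Z-a (zoned a Da) , Z-b (zoned b Db) ,
      (λ x d na nb → Z-ordinary na nb (zoned x d)) , injective , edges

-- Assigning the remaining vertices

-- If a free host accepts no free slot, it can take over the slot of a host that a given free slot accepts.
module _ {n N} (I : Fin n → Bool) (A : Fin N → Bool) (ok : Fin n → Fin N → Bool) (m : ℕ)
  (few-bad : ∀ i → I i ≡ true → count (λ x → A x ∧ not (ok i x)) ≤ m)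
  (many-ok : ∀ x → A x ≡ true → m < count (λ i → I i ∧ ok i x))
  (fits : count I ≤ count A) (g₀ : Fin n → Fin N) where

  private
    record Assigned (J : Fin n → Bool) (g : Fin n → Fin N) : Set where
      field
        within    : J ⊆ I
        hosted    : ∀ i → J i ≡ true → A (g i) ≡ true
        accepted  : ∀ i → J i ≡ true → ok i (g i) ≡ true
        injective : ∀ i j → J i ≡ true → J j ≡ true → g i ≡ g j → i ≡ j

    update : (Fin n → Fin N) → Fin n → Fin N → Fin n → Fin N
    update g i h x = if x == i then h else g x

    update-here : ∀ g i h → update g i h i ≡ h
    update-here g i h rewrite ==-refl i = refl

    update-there : ∀ g i h x → x ≢ i → update g i h x ≡ g x
    update-there g i h x ne rewrite false-intro {x == i} (ne ∘ ==-elim) = refl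

    add : (Fin n → Bool) → Fin n → Fin n → Bool
    add J i x = (x == i) ∨ J x

    insert : ∀ {J g i h} → Assigned J g → I i ≡ true → A h ≡ true → ok i h ≡ true →
      (∀ j → J j ≡ true → g j ≢ h) → Assigned (add J i) (update g i h)
    insert {J} {g} {i} {h} P Ii Ah o new = record
      { within = λ x e → case x ≟ᶠ i of λ { (yes refl) → Ii ; (no ne) → within x (old x e ne) }
      ; hosted = λ x e → case x ≟ᶠ i of λ
          { (yes refl) → subst (λ v → A v ≡ true) (sym (update-here g i h)) Ah
          ; (no ne) → subst (λ v → A v ≡ true) (sym (update-there g i h x ne)) (hosted x (old x e ne)) }
      ; accepted = λ x e → case x ≟ᶠ i of λ
          { (yes refl) → subst (λ v → ok i v ≡ true) (sym (update-here g i h)) o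
          ; (no ne) → subst (λ v → ok x v ≡ true) (sym (update-there g i h x ne)) (accepted x (old x e ne)) }
      ; injective = inj }
      where
      open Assigned P
      old : ∀ x → add J i x ≡ true → x ≢ i → J x ≡ true
      old x e ne with ∨-elim {x == i} e
      ... | inj₁ q = ⊥-elim (ne (==-elim q))
      ... | inj₂ q = q
      inj : ∀ x y → add J i x ≡ true → add J i y ≡ true → update g i h x ≡ update g i h y → x ≡ y
      inj x y e e' eq with x ≟ᶠ i | y ≟ᶠ i
      ... | yes refl | yes refl = refl
      ... | yes refl | no ne = ⊥-elim (new y e' (sym eq))
      ... | no ne | yes refl = ⊥-elim (new x e eq)
      ... | no ne | no ne' = injective x y e e' eq

    move : ∀ {J g i h} → Assigned J g → J i ≡ true → A h ≡ true → ok i h ≡ true →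
      (∀ j → J j ≡ true → g j ≢ h) → Assigned J (update g i h)
    move {J} {g} {i} {h} P Ji Ah o new = record
      { within = within
      ; hosted = λ x e → Assigned.hosted Q x (∨₂ {x == i} e)
      ; accepted = λ x e → Assigned.accepted Q x (∨₂ {x == i} e)
      ; injective = λ x y e e' → Assigned.injective Q x y (∨₂ {x == i} e) (∨₂ {y == i} e') }
      where
      open Assigned P
      Q = insert P (within i Ji) Ah o new

    grow : ∀ {J g i₀} → Assigned J g → I i₀ ≡ true → ¬ (J i₀ ≡ true) →
      ∃ λ i → ∃ λ g' → ¬ (J i ≡ true) × Assigned (add J i) g'
    grow {J} {g} {i₀} P Ii ¬Ji with pick A (λ h → A h ∧ image g J h) room
      where
      open Assigned P
      room : count (λ h → A h ∧ image g J h) < count A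
      room = linear (count (λ h → A h ∧ image g J h) ∷ count J ∷ count (λ x → I x ∧ J x) ∷
        count (λ x → I x ∧ not (J x)) ∷ count I ∷ count A ∷ []) (
        1 ⋆ ‵ 0 ⊑ ‵ 1 by image-count g J J A (λ _ p _ → p) ∙
        1 ⋆ ‵ 2 ⊕ ‵ 3 ⊑ ‵ 4 by ≤-reflexive (sym (count-split I J)) ∙
        1 ⋆ ‵ 1 ⊑ ‵ 2 by count-mono J (λ x → I x ∧ J x) (λ x e → both (within x e) e) ∙
        1 ⋆ κ 1 ⊑ ‵ 3 by count-point (λ x → I x ∧ not (J x)) {i₀} (both Ii (not-intro ¬Ji)) ∙
        1 ⋆ ‵ 4 ⊑ ‵ 5 by fits ∙ end) 1 (κ 1 ⊕ ‵ 0) (‵ 5)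
    ... | h , Ah , free with exists? (λ i → (I i ∧ ok i h) ∧ not (J i))
    ...   | inj₁ (i , e) = i , update g i h , not-elim (∧₂ {I i ∧ ok i h} e) ,
            insert P (∧₁ (∧₁ e)) Ah (∧₂ {I i} (∧₁ e)) (λ { j Jj refl → free (both Ah (image⇐ g J Jj)) })
    -- All slots that accept h are already assigned, and there are more than m of them. At most m
    -- hosts are refused by i₀, so one of these slots sits on a host that i₀ accepts: it moves to h,
    -- and i₀ takes its place.
    ...   | inj₂ none with pick (λ i → I i ∧ ok i h) (λ i → (I i ∧ ok i h) ∧ not (ok i₀ (g i)))
                (≤-<-trans (≤-trans (count-injection (λ i → (I i ∧ ok i h) ∧ not (ok i₀ (g i)))
                    (λ x → A x ∧ not (ok i₀ x)) g
                  (λ i e → both (hosted i (taken i (∧₁ e))) (∧₂ {I i ∧ ok i h} e))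
                  (λ i j e e' → injective i j (taken i (∧₁ e)) (taken j (∧₁ e')))) (few-bad i₀ Ii)) (many-ok h Ah))
      where
      open Assigned P
      taken : ∀ i → I i ∧ ok i h ≡ true → J i ≡ true
      taken i e with truth (J i)
      ... | inj₁ t = t
      ... | inj₂ t = ⊥-elim (none i (both e t))
    ...     | i , e , good = i₀ , update (update g i h) i₀ (g i) , ¬Ji ,
              insert (move P Ji Ah (∧₂ {I i} e) new) Ii (hosted i Ji) accept fresh
      where
      open Assigned P
      Ji : J i ≡ true
      Ji with truth (J i)
      ... | inj₁ t = t
      ... | inj₂ t = ⊥-elim (none i (both e t))
      new : ∀ j → J j ≡ true → g j ≢ h
      new j Jj refl = free (both Ah (image⇐ g J Jj))
      accept : ok i₀ (g i) ≡ true
      accept with truth (ok i₀ (g i))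
      ... | inj₁ t = t
      ... | inj₂ t = ⊥-elim (good (both e t))
      fresh : ∀ j → J j ≡ true → update g i h j ≢ g i
      fresh j Jj eq with j ≟ᶠ i
      ... | yes refl = new i Ji (sym eq)
      ... | no ne    = ne (injective j i Jj Ji eq)

    -- Induction on a bound k for the number of unassigned slots, which each augmentation lowers by
    -- one.
    finish : ∀ k J g → Assigned J g → count I ≤ count J + k → ∃ (Assigned I)
    finish k J g P le with exists? (λ i → I i ∧ not (J i))
    ... | inj₂ none = g , record { within = λ _ e → e ; hosted = λ i e → hosted i (all i e) ; accepted = λ i e →
        accepted i (all i e)
        ; injective = λ i j e e' → injective i j (all i e) (all j e') }
      where
      open Assigned P
      all : ∀ i → I i ≡ true → J i ≡ true
      all i e with truth (J i)
      ... | inj₁ t = t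
      ... | inj₂ t = ⊥-elim (none i (both e t))
    finish zero J g P le | inj₁ (i , e) = ⊥-elim (linear-absurd (count I ∷ count J ∷ count (λ x → I x ∧ J x) ∷
      count (λ x → I x ∧ not (J x)) ∷ []) (1 ⋆ ‵ 0 ⊑ ‵ 1 ⊕ κ 0 by le ∙
      1 ⋆ ‵ 2 ⊕ ‵ 3 ⊑ ‵ 0 by ≤-reflexive (sym (count-split I J)) ∙
      1 ⋆ ‵ 1 ⊑ ‵ 2 by count-mono J (λ x → I x ∧ J x) (λ x e → both (Assigned.within P x e) e) ∙
      1 ⋆ κ 1 ⊑ ‵ 3 by count-point (λ x → I x ∧ not (J x)) {i} e ∙ end))
    finish (suc k) J g P le | inj₁ (i , e) with grow P (∧₁ e) (not-elim (∧₂ {I i} e))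
    ... | i' , g' , ¬J , P' = finish k (add J i') g' P' (linear (count I ∷ count J ∷ k ∷ count (_== i') ∷
      count (add J i') ∷ []) (1 ⋆ ‵ 0 ⊑ ‵ 1 ⊕ (κ 1 ⊕ ‵ 2) by le ∙
      1 ⋆ ‵ 1 ⊕ ‵ 3 ⊑ ‵ 4 by count-pack (add J i') J (_== i') (λ x q → ∨₂ {x == i'} q) (λ x → ∨₁)
          (λ x p q → ¬J (subst (λ v → J v ≡ true) (==-elim q) p)) ∙
      1 ⋆ κ 1 ⊑ ‵ 3 by count-point (_== i') {i'} (==-refl i') ∙ end) 1 (‵ 0) (‵ 4 ⊕ ‵ 2))

  assign : ∃ λ g → (∀ i → I i ≡ true → A (g i) ≡ true) × (∀ i → I i ≡ true → ok i (g i) ≡ true) ×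
    (∀ i j → I i ≡ true → I j ≡ true → g i ≡ g j → i ≡ j)
  assign with finish (count I) (λ _ → false) g₀
    (record { within = λ _ () ; hosted = λ _ () ; accepted = λ _ () ; injective = λ _ _ () }) (m≤n+m _ _)
  ... | g , P = g , hosted , accepted , injective
    where open Assigned P

-- Bipartite trees of bounded degree and their low-degree vertices

record Bipartition {n} (T : SimpleGraph n) (e : ℕ) : Set where
  field
    tree      : IsTree T
    class     : Fin n → Bool
    alternate : ∀ u v → adj T u v ≡ true → class u ≡ not (class v)
    degree≤   : ∀ v → degree T v ≤ e

  rooted : ∀ r → Rooted T r
  rooted = root-at T tree class alternate

  coclass : Fin n → Bool
  coclass v = not (class v)

  t₁ t₂ : ℕ
  t₁ = count class
  t₂ = count coclass

  total : t₁ + t₂ ≡ n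
  total = count-not class

  -- The bound 64 balances two demands: at most n/65 vertices of the class have larger degree, and a
  -- slot refuses at most 64 · 4e = 256e hosts, which is less than n/50.
  slot : Fin n → Bool
  slot x = class x ∧ ⌊ degree T x ≤? 64 ⌋

  free : (Fin n → Bool) → Fin n → Bool
  free Q i = not ⌊ any? (λ p → (Q p ≟ᵇ true) ×-dec (adj T i p ≟ᵇ true)) ⌋

  free-intro : ∀ {Q i} → (∀ p → Q p ≡ true → adj T i p ≡ true → ⊥) → free Q i ≡ true
  free-intro h = not-intro (λ e → case ⌊⌋-elim (any? _) e of λ { (p , q , a) → h p q a })

  free-elim : ∀ {Q i} → free Q i ≡ true → ∀ p → Q p ≡ true → adj T i p ≡ true → ⊥
  free-elim f p q a = not-elim f (⌊⌋-intro (any? _) (p , q , a))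

  -- To be read with Q as the set of tree vertices whose images a given host misses: if there are
  -- fewer than k, then n/50 slots still accept the host.
  Robust : ℕ → Set
  Robust k = ∀ Q → count Q < k → n ≤ count (λ i → slot i ∧ free Q i) * 50

  -- Each edge has exactly one end in the class, so the sum counts edges; every edge is charged to
  -- its lower end, and no vertex is charged twice.
  degree-sum : Fin n → wsum class (degree T) ≤ n
  degree-sum r = begin
    wsum class (degree T)
      ≡⟨ ∑-cong row ⟩
    ∑ (λ u → ∑ (λ v → bit (class u ∧ adj T u v)))
      ≤⟨ ∑-mono (λ u → ∑-mono (λ v → split u v)) ⟩
    ∑ (λ u → ∑ (λ v → bit (class u ∧ (v == parent u)) + bit (coclass v ∧ (u == parent v))))
      ≡⟨ ∑-cong (λ u → ∑-+ (λ v → bit (class u ∧ (v == parent u))) (λ v → bit (coclass v ∧ (u == parent v)))) ⟩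
    ∑ (λ u → ∑ (λ v → bit (class u ∧ (v == parent u))) + ∑ (λ v → bit (coclass v ∧ (u == parent v))))
      ≡⟨ ∑-+ (λ u → ∑ (λ v → bit (class u ∧ (v == parent u)))) (λ u → ∑ (λ v → bit (coclass v ∧ (u == parent v)))) ⟩
    ∑ (λ u → ∑ (λ v → bit (class u ∧ (v == parent u)))) + ∑ (λ u → ∑ (λ v → bit (coclass v ∧ (u == parent v))))
      ≡⟨ cong (∑ (λ u → ∑ (λ v → bit (class u ∧ (v == parent u)))) +_)
          (∑-swap (λ u v → bit (coclass v ∧ (u == parent v)))) ⟩
    ∑ (λ u → ∑ (λ v → bit (class u ∧ (v == parent u)))) + ∑ (λ v → ∑ (λ u → bit (coclass v ∧ (u == parent v))))
      ≤⟨ +-mono-≤ (∑-mono (once class)) (∑-mono (once coclass)) ⟩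
    ∑ (bit ∘ class) + ∑ (bit ∘ coclass)
      ≡⟨ cong₂ _+_ (sym (count≡∑ class)) (sym (count≡∑ coclass)) ⟩
    t₁ + t₂
      ≡⟨ total ⟩
    n ∎
    where
    open ≤-Reasoning
    open Rooted (rooted r)
    row : ∀ u → (if class u then degree T u else 0) ≡ ∑ (λ v → bit (class u ∧ adj T u v))
    row u with class u
    ... | true  = count≡∑ (adj T u)
    ... | false = sym (trans (∑-const n 0) (*-zeroʳ n))
    once : ∀ (P : Fin n → Bool) u → ∑ (λ v → bit (P u ∧ (v == parent u))) ≤ bit (P u)
    once P u with P u
    ... | true  = subst (_≤ 1) (count≡∑ (λ v → v == parent u)) (count-== (parent u))
    ... | false = ≤-reflexive (trans (∑-const n 0) (*-zeroʳ n))
    split : ∀ u v → bit (class u ∧ adj T u v) ≤ bit (class u ∧ (v == parent u)) + bit (coclass v ∧ (u == parent v))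
    split u v with truth (class u ∧ adj T u v)
    ... | inj₂ h = ≤-trans (≤-reflexive (cong bit (false-intro (not-elim h)))) z≤n
    ... | inj₁ h with edge u v (∧₂ {class u} h)
    ...   | inj₁ (_ , eq) = ≤-trans (bit-mono {b = class u ∧ (v == parent u)}
        (λ _ → both (∧₁ h) (⌊⌋-intro (v ≟ᶠ parent u) (sym eq)))) (m≤m+n _ _)
    ...   | inj₂ (_ , eq) = ≤-trans (bit-mono {b = coclass v ∧ (u == parent v)}
        (λ _ → both (not-intro (λ cv → not-elim {class v}
              (trans (sym (alternate u v (∧₂ {class u} h))) (∧₁ h)) cv)) (⌊⌋-intro (u ≟ᶠ parent v) (sym eq))))
                  (m≤n+m _ _)

  many-slots : Fin n → t₁ * 65 ≤ n + count slot * 65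
  many-slots r = linear (t₁ ∷ count slot ∷ count high ∷ wsum class (degree T) ∷ n ∷ wsum high (degree T) ∷ []) (
    65 ⋆ ‵ 0 ⊑ ‵ 1 ⊕ ‵ 2 by ≤-reflexive (count-split class (λ x → ⌊ degree T x ≤? 64 ⌋)) ∙
    1 ⋆ ‵ 3 ⊑ ‵ 4 by degree-sum r ∙
    1 ⋆ ‵ 5 ⊑ ‵ 3 by wsum-mono {H = high} {class} {degree T} {degree T} (λ z → ∧₁) (λ _ _ → ≤-refl) ∙
    1 ⋆ 65 ⊛ ‵ 2 ⊑ ‵ 5 by wsum-bound-below high (degree T) 65
        (λ z h → ≰⇒> (λ le → not-elim (∧₂ {class z} h) (⌊⌋-intro (degree T z ≤? 64) le))) ∙
    end) 1 (65 ⊛ ‵ 0) (‵ 4 ⊕ 65 ⊛ ‵ 1)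
    where
    high : Fin n → Bool
    high x = class x ∧ not ⌊ degree T x ≤? 64 ⌋

  -- If all degrees in the class were at least two, then 2t₁ ≤ n = t₁ + t₂. Rooting the tree at the
  -- vertex found provides its one neighbour.
  leaf : t₂ < t₁ → 2 ≤ n → ∃ λ ℓ → ∃ λ p → class ℓ ≡ true × adj T ℓ p ≡ true × (∀ q → adj T ℓ q ≡ true → q ≡ p)
  leaf t₂<t₁ 2≤n with exists? (λ x → class x ∧ ⌊ degree T x ≤? 1 ⌋)
  ... | inj₂ none = ⊥-elim (linear-absurd (wsum class (degree T) ∷ n ∷ t₁ ∷ t₂ ∷ []) (
    1 ⋆ ‵ 0 ⊑ ‵ 1 by degree-sum (proj₁ (count-positive class (≤-<-trans z≤n t₂<t₁))) ∙
    1 ⋆ ‵ 1 ⊑ ‵ 2 ⊕ ‵ 3 by ≤-reflexive (sym total) ∙ 1 ⋆ κ 1 ⊕ ‵ 3 ⊑ ‵ 2 by t₂<t₁ ∙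
    1 ⋆ 2 ⊛ ‵ 2 ⊑ ‵ 0 by wsum-bound-below class (degree T) 2
        (λ z c → ≰⇒> (λ le → none z (both c (⌊⌋-intro (degree T z ≤? 1) le)))) ∙
    end))
  ... | inj₁ (ℓ , h) with pick (λ _ → true) (_== ℓ) (≤-<-trans (count-== ℓ) (subst (1 <_) (sym (count-all n)) 2≤n))
  ...   | x , _ , x≢ℓ with Subtrees.below-child (rooted ℓ) (Subtrees.root-⊑ (rooted ℓ) x)
      (λ eq → x≢ℓ (⌊⌋-intro (x ≟ᶠ ℓ) eq))
  ...     | p , (p≢ℓ , eq) , _ = ℓ , p , ∧₁ h , ℓp , single
    where
    ℓp : adj T ℓ p ≡ true
    ℓp = subst (λ v → adj T v p ≡ true) eq (Rooted.parent-adj (rooted ℓ) p p≢ℓ)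
    single : ∀ q → adj T ℓ q ≡ true → q ≡ p
    single q ℓq with q ≟ᶠ p
    ... | yes e = e
    ... | no ne = ⊥-elim (<⇒≱ (s≤s (⌊⌋-elim (degree T ℓ ≤? 1) (∧₂ {class ℓ} h))) (≤-trans
          (+-mono-≤ (count-point (_== q) (==-refl q)) (count-point (_== p) (==-refl p)))
          (count-pack (adj T ℓ) (_== q) (_== p) (λ i e → subst (λ v → adj T ℓ v ≡ true) (sym (==-elim e)) ℓq)
            (λ i e → subst (λ v → adj T ℓ v ≡ true) (sym (==-elim e)) ℓp)
                (λ i e e' → ne (trans (sym (==-elim e)) (==-elim e'))))))

  killed : ∀ Q → count slot ≤ count Q * e + count (λ i → slot i ∧ free Q i)
  killed Q = ≤-trans (≤-reflexive (trans (count-split slot (free Q)) (+-comm (count (λ i → slot i ∧ free Q i)) _)))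
    (+-monoˡ-≤ _ (begin
    count (λ i → slot i ∧ not (free Q i))            ≡⟨ count≡∑ (λ i → slot i ∧ not (free Q i)) ⟩
    ∑ (λ i → bit (slot i ∧ not (free Q i)))          ≤⟨ ∑-mono hit ⟩
    ∑ (λ i → ∑ (λ p → bit (Q p ∧ adj T p i)))        ≡⟨ ∑-swap (λ i p → bit (Q p ∧ adj T p i)) ⟩
    ∑ (λ p → ∑ (λ i → bit (Q p ∧ adj T p i)))        ≡⟨ ∑-cong row ⟩
    wsum Q (degree T)                                ≤⟨ wsum-bound Q (degree T) e (λ z _ → degree≤ z) ⟩
    count Q * e                                      ∎))
    where
    open ≤-Reasoning
    row : ∀ p → ∑ (λ i → bit (Q p ∧ adj T p i)) ≡ (if Q p then degree T p else 0)
    row p with Q p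
    ... | true  = sym (count≡∑ (adj T p))
    ... | false = trans (∑-const n 0) (*-zeroʳ n)
    hit : ∀ i → bit (slot i ∧ not (free Q i)) ≤ ∑ (λ p → bit (Q p ∧ adj T p i))
    hit i with truth (slot i ∧ not (free Q i))
    ... | inj₂ h = ≤-trans (≤-reflexive (cong bit (false-intro (not-elim h)))) z≤n
    ... | inj₁ h with ⌊⌋-elim (any? (λ p → (Q p ≟ᵇ true) ×-dec (adj T i p ≟ᵇ true)))
                        (trans (sym (not-involutive _)) (∧₂ {slot i} h))
    ...   | p , q , a = ≤-trans (bit-mono {b = Q p ∧ adj T p i} (λ _ → both q (trans (adj-sym T p i) a)))
        (∑-point (λ p → bit (Q p ∧ adj T p i)) p)

  module _ {r} (R : Rooted T r) where
    open Subtrees R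

    -- A slot below C with a neighbour in Q either shares its subtree with that neighbour, which is
    -- then touched, or is the top of its subtree and adjacent to a or b; there are at most 2e such
    -- tops. Unlike in `killed`, the loss does not grow with |Q| times e.
    killed-below : ∀ a b C → Disjoint C → (∀ z → C z ≡ true → Child a z ⊎ Child b z) → ∀ Q →
      wsum C (weight slot) ≤ wsum (touched C Q) size + e * 2 + count (λ i → slot i ∧ free Q i)
    killed-below a b C d pc Q = linear (wsum C (weight slot) ∷ count (λ x → union C x ∧ slot x) ∷
      count (union (touched C Q)) ∷ wsum (touched C Q) size ∷
      count (λ i → (adj T a i ∨ adj T b i) ∨ (slot i ∧ free Q i)) ∷ count (λ i → adj T a i ∨ adj T b i) ∷
      count (λ i → slot i ∧ free Q i) ∷ degree T a ∷ degree T b ∷ e ∷ []) (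
      1 ⋆ ‵ 0 ⊑ ‵ 1 by ≤-reflexive (sym (union-weight C slot d)) ∙
      1 ⋆ ‵ 2 ⊑ ‵ 3 by ≤-reflexive (union-size (touched C Q) (disjoint-⊆ (λ z → ∧₁) d)) ∙
      1 ⋆ ‵ 1 ⊑ ‵ 2 ⊕ ‵ 4 by count-cover (λ x → union C x ∧ slot x) (union (touched C Q))
          (λ i → (adj T a i ∨ adj T b i) ∨ (slot i ∧ free Q i)) cases ∙
      1 ⋆ ‵ 4 ⊑ ‵ 5 ⊕ ‵ 6 by count-cover (λ i → (adj T a i ∨ adj T b i) ∨ (slot i ∧ free Q i))
          (λ i → adj T a i ∨ adj T b i) (λ i → slot i ∧ free Q i) (λ i → ∨-elim) ∙
      1 ⋆ ‵ 5 ⊑ ‵ 7 ⊕ ‵ 8 by count-cover (λ i → adj T a i ∨ adj T b i) (adj T a) (adj T b) (λ i → ∨-elim) ∙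
      1 ⋆ ‵ 7 ⊑ ‵ 9 by degree≤ a ∙ 1 ⋆ ‵ 8 ⊑ ‵ 9 by degree≤ b ∙ end) 1 (‵ 0) (‵ 3 ⊕ 2 ⊛ ‵ 9 ⊕ ‵ 6)
      where
      cases : ∀ i → union C i ∧ slot i ≡ true → union (touched C Q) i ≡ true ⊎ (adj T a i ∨ adj T b i) ∨
          (slot i ∧ free Q i) ≡ true
      cases i h with truth (union (touched C Q) i) | truth (adj T a i ∨ adj T b i)
      ... | inj₁ t | _      = inj₁ t
      ... | inj₂ _ | inj₁ t = inj₂ (∨₁ t)
      ... | inj₂ t | inj₂ s = inj₂ (∨₂ {adj T a i ∨ adj T b i} (both (∧₂ {union C i} h) (free-intro hit)))
        where
        hit : ∀ p → Q p ≡ true → adj T i p ≡ true → ⊥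
        hit p q ip with union⇒ {C} (∧₁ h)
        ... | z , c , zi with ⊑? z p
        ...   | yes zp = not-elim t (union⇐ {touched C Q} (touched-intro {C} {Q} c q zp) zi)
        ...   | no ¬zp with exit ip zi ¬zp
        ...     | refl , (_ , eq) with pc z c
        ...       | inj₁ (_ , eq') = not-elim s (∨₁ (subst (λ v → adj T v i ≡ true) (trans (sym eq) eq')
            (trans (adj-sym T p i) ip)))
        ...       | inj₂ (_ , eq') = not-elim s (∨₂ {adj T a i} (subst (λ v → adj T v i ≡ true) (trans (sym eq) eq')
            (trans (adj-sym T p i) ip)))

-- Balanced cuts

-- Turns a threshold given in thousandths into an integer, with an error of at most one vertex.
scaled : ∀ m → ∃ λ ℓ → m < ℓ * 1000 × ℓ * 1000 ≤ m + 1000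
scaled m = suc (m / 1000) , (linear (m ∷ m % 1000 ∷ m / 1000 ∷ []) (
  1 ⋆ ‵ 0 ⊑ ‵ 1 ⊕ 1000 ⊛ ‵ 2 by ≤-reflexive (m≡m%n+[m/n]*n m 1000) ∙ 1 ⋆ κ 1 ⊕ ‵ 1 ⊑ κ 1000 by m%n<n m 1000 ∙ end)
  1 (κ 1 ⊕ ‵ 0) (1000 ⊛ (κ 1 ⊕ ‵ 2))) ,
  (linear (m % 1000 ∷ m / 1000 ∷ m ∷ []) (1 ⋆ ‵ 0 ⊕ 1000 ⊛ ‵ 1 ⊑ ‵ 2 by ≤-reflexive (sym (m≡m%n+[m/n]*n m 1000)) ∙
    end) 1 (1000 ⊛ (κ 1 ⊕ ‵ 1)) (‵ 2 ⊕ κ 1000))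

module _ {n} {C : Fin n → Bool} {g : Fin n → ℕ} {ℓ} (H : Cheapest C g ℓ) where
  open Cheapest H

  cheapest-inhabited : 0 < ℓ → ∃ λ z → set z ≡ true
  cheapest-inhabited 0<ℓ with exists? set
  ... | inj₁ h = h
  ... | inj₂ none = ⊥-elim (<⇒≱ 0<ℓ (≤-trans enough (≤-trans (wsum-bound set g 0 (λ z h → ⊥-elim (none z h)))
      (≤-reflexive (*-zeroʳ (count set))))))

  -- Dropping one member of Q brings it under the minimal cardinality. This covers cuts in which one
  -- further branch joins the cheapest set, so that k is larger by one.
  cheapest-next : ∀ m Q → Q ⊆ C → count Q ≤ count set → 0 < ℓ → (∀ z → C z ≡ true → g z ≤ m) → wsum Q g ≤ ℓ + m
  cheapest-next m Q Q⊆C le 0<ℓ g≤m with exists? Q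
  ... | inj₂ none = ≤-trans (wsum-bound Q g 0 (λ z h → ⊥-elim (none z h)))
      (≤-trans (≤-reflexive (*-zeroʳ (count Q))) z≤n)
  ... | inj₁ (z , q) = linear (wsum Q g ∷ wsum (λ y → Q y ∧ (y == z)) g ∷ wsum (λ y → Q y ∧ not (y == z)) g ∷ g z ∷
    m ∷ ℓ ∷ []) (1 ⋆ ‵ 0 ⊑ ‵ 1 ⊕ ‵ 2 by ≤-reflexive (wsum-split Q (_== z) g) ∙ 1 ⋆ ‵ 1 ⊑ ‵ 3 by wsum-single Q g z ∙
    1 ⋆ ‵ 3 ⊑ ‵ 4 by g≤m z (Q⊆C z q) ∙
    1 ⋆ κ 1 ⊕ ‵ 2 ⊑ ‵ 5 by minimal (λ y → Q y ∧ not (y == z)) (λ y h → Q⊆C y (∧₁ h)) fewer ∙ end)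
    1 (‵ 0) (‵ 5 ⊕ ‵ 4)
    where
    fewer : count (λ y → Q y ∧ not (y == z)) < count set
    fewer = linear (count (λ y → Q y ∧ (y == z)) ∷ count (λ y → Q y ∧ not (y == z)) ∷ count Q ∷ count set ∷ []) (
      1 ⋆ ‵ 0 ⊕ ‵ 1 ⊑ ‵ 2 by ≤-reflexive (sym (count-split Q (_== z))) ∙
      1 ⋆ κ 1 ⊑ ‵ 0 by count-point (λ y → Q y ∧ (y == z)) {z} (both q (==-refl z)) ∙ 1 ⋆ ‵ 2 ⊑ ‵ 3 by le ∙ end)
      1 (κ 1 ⊕ ‵ 1) (‵ 3)

module _ {n} {T : SimpleGraph n} {e : ℕ} (B : Bipartition T e) where
  open Bipartition B

  -- Deleting a and b splits T into two balanced parts; only few edges at a, b lead to the part where side is true.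
  -- Robustness makes the same k the threshold below which missing edges cannot obstruct the other colour.
  record Cut : Set where
    field
      a b        : Fin n
      side       : Fin n → Bool
      k          : ℕ
      a≁b        : ¬ (adj T a b ≡ true)
      crossing   : ∀ x y → adj T x y ≡ true → side x ≡ true → ¬ (side y ≡ true) → y ≡ a ⊎ y ≡ b
      ports      : count (λ x → side x ∧ (adj T a x ∨ adj T b x)) ≤ k
      ports-apart : ∀ x y → side x ≡ true → adj T a x ∨ adj T b x ≡ true → side y ≡ true → adj T a y ∨ adj T b y ≡
          true →
        ¬ (adj T x y ≡ true)
      port-once  : ∀ x → side x ≡ true → adj T a x ≡ true → adj T b x ≡ true → a ≡ b
      k≤         : k ≤ e * 2
      part       : count side * 1000 ≤ n * 665 + 1000
      copart     : count (λ x → not (side x)) * 1000 ≤ n * 665 + 1000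
      robust     : Robust k

  module _ {r} (R : Rooted T r) where
    open Subtrees R

    -- Neighbours of a or b inside the union are tops of subtrees, hence members of H, so `count H`
    -- can serve as k. The lower bound 335 on this part is the upper bound 665 on the other.
    cut : ∀ a b H → ¬ (adj T a b ≡ true) → Disjoint H → (∀ z → H z ≡ true → Child a z ⊎ Child b z) →
      ¬ (union H a ≡ true) → ¬ (union H b ≡ true) → n * 335 ≤ wsum H size * 1000 → wsum H size * 1000 ≤ n * 665 +
          1000 →
      Robust (count H) → Cut
    cut a b H a≁b d pc na nb low high rob = record
      { a = a ; b = b ; side = union H ; k = count H ; a≁b = a≁b ; crossing = crossing
      ; ports = count-mono (λ x → union H x ∧ (adj T a x ∨ adj T b x)) H
          (λ x h → port⇒H x (∧₁ h) (∧₂ {union H x} h))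
      ; ports-apart = λ x y sx px sy py xy → apart x y (port⇒H x sx px) sy xy (port⇒H y sy py) sx
      ; port-once = λ x sx ax bx → trans (sym (parent-of na ax sx)) (parent-of nb bx sx)
      ; k≤ = bound ; part = subst (λ s → s * 1000 ≤ n * 665 + 1000) (sym (union-size H d)) high
      ; copart = linear (wsum H size ∷ count (union H) ∷ count (λ x → not (union H x)) ∷ n ∷ []) (
        1000 ⋆ ‵ 0 ⊑ ‵ 1 by ≤-reflexive (sym (union-size H d)) ∙
        1000 ⋆ ‵ 1 ⊕ ‵ 2 ⊑ ‵ 3 by ≤-reflexive (count-not (union H)) ∙ 1 ⋆ 335 ⊛ ‵ 3 ⊑ 1000 ⊛ ‵ 0 by low ∙ end)
        1 (1000 ⊛ ‵ 2) (665 ⊛ ‵ 3 ⊕ κ 1000)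
      ; robust = rob }
      where
      parent-of : ∀ {c x} → ¬ (union H c ≡ true) → adj T c x ≡ true → union H x ≡ true → parent x ≡ c
      parent-of {c} {x} nc cx sx with edge c x cx | union⇒ {H} sx
      ... | inj₂ (_ , eq) | _ = eq
      ... | inj₁ (h , refl) | z , hz , zx = ⊥-elim (nc (union⇐ {H} hz (down h zx)))
      in-H : ∀ {c x} → ¬ (union H c ≡ true) → parent x ≡ c → union H x ≡ true → H x ≡ true
      in-H nc eq sx with union⇒ {H} sx
      ... | z , hz , stop = hz
      ... | z , hz , down _ q = ⊥-elim (nc (union⇐ {H} hz (subst (z ⊑_) eq q)))
      port⇒H : ∀ x → union H x ≡ true → adj T a x ∨ adj T b x ≡ true → H x ≡ true
      port⇒H x sx h with ∨-elim {adj T a x} h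
      ... | inj₁ ax = in-H na (parent-of na ax sx) sx
      ... | inj₂ bx = in-H nb (parent-of nb bx sx) sx
      crossing : ∀ x y → adj T x y ≡ true → union H x ≡ true → ¬ (union H y ≡ true) → y ≡ a ⊎ y ≡ b
      crossing x y xy sx ny with union⇒ {H} sx
      ... | z , hz , zx with exit xy zx (λ zy → ny (union⇐ {H} hz zy))
      ...   | refl , (_ , eq) with pc z hz
      ...     | inj₁ (_ , eq') = inj₁ (trans (sym eq) eq')
      ...     | inj₂ (_ , eq') = inj₂ (trans (sym eq) eq')
      not-parent : ∀ x y → H x ≡ true → union H y ≡ true → ¬ (parent x ≡ y)
      not-parent x y hx sy eq with pc x hx
      ... | inj₁ (_ , eq') = na (subst (λ v → union H v ≡ true) (trans (sym eq) eq') sy)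
      ... | inj₂ (_ , eq') = nb (subst (λ v → union H v ≡ true) (trans (sym eq) eq') sy)
      apart : ∀ x y → H x ≡ true → union H y ≡ true → adj T x y ≡ true → H y ≡ true → union H x ≡ true → ⊥
      apart x y hx sy xy hy sx with edge x y xy
      ... | inj₁ (_ , eq) = not-parent x y hx sy eq
      ... | inj₂ (_ , eq) = not-parent y x hy sx eq
      bound : count H ≤ e * 2
      bound = linear (count H ∷ degree T a ∷ degree T b ∷ e ∷ []) (
        1 ⋆ ‵ 0 ⊑ ‵ 1 ⊕ ‵ 2 by count-cover H (adj T a) (adj T b) (λ z hz → case pc z hz of λ
            { (inj₁ (p , refl)) → inj₁ (parent-adj z p) ; (inj₂ (p , refl)) → inj₂ (parent-adj z p) }) ∙
        1 ⋆ ‵ 1 ⊑ ‵ 3 by degree≤ a ∙ 1 ⋆ ‵ 2 ⊑ ‵ 3 by degree≤ b ∙ end) 1 (‵ 0) (2 ⊛ ‵ 3)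

    cut-at-root : ∀ H → H ⊆ child r → n * 335 ≤ wsum H size * 1000 → wsum H size * 1000 ≤ n * 665 + 1000 → Robust
        (count H) → Cut
    cut-at-root H H⊆ = cut r r H (false-elim (irrefl T r)) (disjoint-⊆ H⊆ (children-disjoint r))
        (λ z h → inj₁ (child⇒ (H⊆ z h))) nr nr
      where
      nr : ¬ (union H r ≡ true)
      nr h with union⇒ {H} h
      ... | z , hz , stop     = proj₁ (child⇒ (H⊆ r hz)) refl
      ... | z , hz , down p _ = p refl

  robust-mono : ∀ {j k} → j ≤ k → Robust k → Robust j
  robust-mono j≤k rob Q lt = rob Q (≤-trans lt j≤k)

  module BalancedCut (1≤e : 1 ≤ e) (tiny : e * 20000 ≤ n) (unbalanced : t₂ * 2 ≤ t₁ + e) (r₀ : Fin n) where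

    -- t₁ is at least about 2n/3, of which at most n/65 is lost to large degrees, and 2/3 - 1/65
    -- exceeds 0.651.
    slots : count slot * 1000 + e * 1000 ≥ n * 651
    slots = linear (t₁ ∷ n ∷ count slot ∷ t₂ ∷ e ∷ []) (600 ⋆ 65 ⊛ ‵ 0 ⊑ ‵ 1 ⊕ 65 ⊛ ‵ 2 by many-slots r₀ ∙
      26000 ⋆ ‵ 1 ⊑ ‵ 0 ⊕ ‵ 3 by ≤-reflexive (sym total) ∙ 13000 ⋆ 2 ⊛ ‵ 3 ⊑ ‵ 0 ⊕ ‵ 4 by unbalanced ∙
      246000 ⋆ κ 1 ⊑ ‵ 4 by 1≤e ∙ 11 ⋆ 20000 ⊛ ‵ 4 ⊑ ‵ 1 by tiny ∙ end) 39 (651 ⊛ ‵ 1) (1000 ⊛ ‵ 2 ⊕ 1000 ⊛ ‵ 4)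

    robust-2 : Robust 2
    robust-2 Q lt = linear (n ∷ count slot ∷ e ∷ count Q * e ∷ count (λ i → slot i ∧ free Q i) ∷ []) (
      10 ⋆ 651 ⊛ ‵ 0 ⊑ 1000 ⊛ ‵ 1 ⊕ 1000 ⊛ ‵ 2 by slots ∙ 10000 ⋆ ‵ 1 ⊑ ‵ 3 ⊕ ‵ 4 by killed Q ∙
      10000 ⋆ ‵ 3 ⊑ ‵ 2 by ≤-trans (*-monoˡ-≤ e (≤-pred lt)) (≤-reflexive (*-identityˡ e)) ∙
      1 ⋆ 20000 ⊛ ‵ 2 ⊑ ‵ 0 by tiny ∙ end) 6509 (‵ 0) (50 ⊛ ‵ 4)

    -- Sizes are measured in thousandths of n. A part of 335 to 665 fits greedily into U₁ or U₂, which have about 667;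
    -- only three components of about 333 at the centroid prevent such a cut there, and then two of them are cut again.
    module Centre {r} (R : Rooted T r) (half : ∀ u → Subtrees.Child R r u → Subtrees.size R u * 2 ≤ n) where
      open Subtrees R

      -- At a centroid a branch has at most n/2 vertices, so a branch that reaches 335 is a part by
      -- itself, with k at most one.
      huge : ∀ z → child r z ≡ true → n * 335 ≤ size z * 1000 → Cut
      huge z c h = cut-at-root R H (λ x → ∧₁) (linear (size z ∷ wsum H size ∷ n ∷ []) (
        1000 ⋆ ‵ 0 ⊑ ‵ 1 by wsum-point H size {z} (both c (==-refl z)) ∙ 1 ⋆ 335 ⊛ ‵ 2 ⊑ 1000 ⊛ ‵ 0 by h ∙ end)
        1 (335 ⊛ ‵ 2) (1000 ⊛ ‵ 1))
        (linear (wsum H size ∷ size z ∷ n ∷ []) (1000 ⋆ ‵ 0 ⊑ ‵ 1 by wsum-single (child r) size z ∙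
          500 ⋆ 2 ⊛ ‵ 1 ⊑ ‵ 2 by half z (child⇒ c) ∙ end) 1 (1000 ⊛ ‵ 0) (665 ⊛ ‵ 2 ⊕ κ 1000))
        (robust-mono (≤-trans (≤-trans (count-mono H (_== z) (λ x → ∧₂ {child r x})) (count-== z)) (s≤s z≤n))
            robust-2)
        where
        H : Fin n → Bool
        H x = child r x ∧ (x == z)

      all-size : n ≤ 1 + wsum (child r) size
      all-size = subst (_≤ 1 + wsum (child r) size) size-root (size-children r)

      all-slots : count slot ≤ 1 + wsum (child r) (weight slot)
      all-slots = ≤-trans (count-mono slot (λ x → sub r x ∧ slot x) (λ x s → both (sub⇐ (root-⊑ x)) s))
        (≤-trans (weight-children slot r) (+-monoˡ-≤ _ (bit≤1 (slot r))))

      module NotHuge (small-size : ∀ z → child r z ≡ true → size z * 1000 < n * 335) where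
        small big : Fin n → Bool
        small z = child r z ∧ ⌊ size z * 1000 ≤? n * 330 ⌋
        big z = child r z ∧ not ⌊ size z * 1000 ≤? n * 330 ⌋

        small⇒ : ∀ z → small z ≡ true → size z * 1000 ≤ n * 330
        small⇒ z h = ⌊⌋-elim (size z * 1000 ≤? n * 330) (∧₂ {child r z} h)

        big⇒ : ∀ z → big z ≡ true → n * 330 < size z * 1000
        big⇒ z h = ≰⇒> (λ le → not-elim (∧₂ {child r z} h) (⌊⌋-intro (size z * 1000 ≤? n * 330) le))

        -- Branches of at most 330 are collected until 335 is passed, so the total stays below 665.
        -- Fewer than k vertices meet branches of total size about 335 at most, which cannot exhaust
        -- 651 slots.
        no-big : (∀ z → ¬ (big z ≡ true)) → Cut
        no-big none = build (scaled (n * 335))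
          where
          is-small : ∀ z → child r z ≡ true → size z * 1000 ≤ n * 330
          is-small z c = ≮⇒≥ (λ lt → none z
              (both c (not-intro (λ h → <⇒≱ lt (⌊⌋-elim (size z * 1000 ≤? n * 330) h)))))
          build : (∃ λ ℓ → n * 335 < ℓ * 1000 × ℓ * 1000 ≤ n * 335 + 1000) → Cut
          build (ℓ , lo , hi) = cut-at-root R set inside
            (linear (ℓ ∷ wsum set size ∷ n ∷ []) (1000 ⋆ ‵ 0 ⊑ ‵ 1 by enough ∙
              1 ⋆ κ 1 ⊕ 335 ⊛ ‵ 2 ⊑ 1000 ⊛ ‵ 0 by lo ∙ end) 1 (335 ⊛ ‵ 2) (1000 ⊛ ‵ 1))
            (linear (wsum set size ∷ ℓ ∷ size z ∷ n ∷ []) (1000 ⋆ κ 1 ⊕ ‵ 0 ⊑ ‵ 1 ⊕ ‵ 2 by bound hz ∙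
              1 ⋆ 1000 ⊛ ‵ 1 ⊑ 335 ⊛ ‵ 3 ⊕ κ 1000 by hi ∙ 1 ⋆ 1000 ⊛ ‵ 2 ⊑ 330 ⊛ ‵ 3 by is-small z (inside z hz) ∙
              end) 1 (1000 ⊛ ‵ 0) (665 ⊛ ‵ 3 ⊕ κ 1000))
            (λ Q lt → (linear (wsum (child r) (weight slot) ∷ wsum (touched (child r) Q) size ∷ e ∷
              count (λ i → slot i ∧ free Q i) ∷ ℓ ∷ n ∷ count slot ∷ []) (
              1000 ⋆ ‵ 0 ⊑ ‵ 1 ⊕ 2 ⊛ ‵ 2 ⊕ ‵ 3 by killed-below R r r (child r) (children-disjoint r)
                  (λ z c → inj₁ (child⇒ c)) Q ∙
              1000 ⋆ κ 1 ⊕ ‵ 1 ⊑ ‵ 4 by minimal (touched (child r) Q) (λ z → ∧₁)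
                  (≤-<-trans (touched-count (child r) Q (children-disjoint r)) lt) ∙
              1 ⋆ 1000 ⊛ ‵ 4 ⊑ 335 ⊛ ‵ 5 ⊕ κ 1000 by hi ∙ 1000 ⋆ ‵ 6 ⊑ κ 1 ⊕ ‵ 0 by all-slots ∙
              1 ⋆ 651 ⊛ ‵ 5 ⊑ 1000 ⊛ ‵ 6 ⊕ 1000 ⊛ ‵ 2 by slots ∙ 296 ⋆ 20000 ⊛ ‵ 2 ⊑ ‵ 5 by tiny ∙
              5917000 ⋆ κ 1 ⊑ ‵ 2 by 1≤e ∙ end) 20 (‵ 5) (50 ⊛ ‵ 3)))
            where
            H : Cheapest (child r) size ℓ
            H = cheapest (child r) size ℓ (linear (n ∷ wsum (child r) size ∷ ℓ ∷ e ∷ []) (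
              1000 ⋆ ‵ 0 ⊑ κ 1 ⊕ ‵ 1 by all-size ∙ 1 ⋆ 1000 ⊛ ‵ 2 ⊑ 335 ⊛ ‵ 0 ⊕ κ 1000 by hi ∙
              665 ⋆ 20000 ⊛ ‵ 3 ⊑ ‵ 0 by tiny ∙ 13300000 ⋆ κ 1 ⊑ ‵ 3 by 1≤e ∙ end) 1000 (‵ 2) (‵ 1))
            open Cheapest H
            some = cheapest-inhabited H (linear (n ∷ ℓ ∷ []) (1 ⋆ κ 1 ⊕ 335 ⊛ ‵ 0 ⊑ 1000 ⊛ ‵ 1 by lo ∙ end)
              1000 (κ 1 ⊕ κ 0) (‵ 1))
            z = proj₁ some
            hz = proj₂ some

        -- One component of about a third of the vertices, completed by small ones.
        module WithSmall (L : Fin n) (bL : big L ≡ true) (rich : n * 80 ≤ wsum small (weight slot) * 1000) where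
          -- The branch L has between 330 and 335, z between 10 and 330, so together they lie
          -- between 340 and 665. Two branches give k ≤ 2.
          with-one : ∀ z → small z ≡ true → n * 10 ≤ size z * 1000 → Cut
          with-one z sz h = cut-at-root R H (λ x → ∧₁)
            (linear (wsum (λ x → H x ∧ (x == L)) size ∷ wsum (λ x → H x ∧ not (x == L)) size ∷ wsum H size ∷
              size L ∷ size z ∷ n ∷ []) (2000 ⋆ ‵ 0 ⊕ ‵ 1 ⊑ ‵ 2 by ≤-reflexive (sym (wsum-split H (_== L) size)) ∙
              2000 ⋆ ‵ 3 ⊑ ‵ 0 by wsum-point (λ x → H x ∧ (x == L)) size {L} (both HL (==-refl L)) ∙
              1000 ⋆ ‵ 4 ⊑ ‵ 1 by wsum-point (λ x → H x ∧ not (x == L)) size {z} (both Hz (not-intro z≢L)) ∙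
              1 ⋆ 10 ⊛ ‵ 5 ⊑ 1000 ⊛ ‵ 4 by h ∙ 2 ⋆ κ 1 ⊕ 330 ⊛ ‵ 5 ⊑ 1000 ⊛ ‵ 3 by big⇒ L bL ∙ end)
              2 (335 ⊛ ‵ 5) (1000 ⊛ ‵ 2))
            (linear (wsum H size ∷ wsum (λ x → H x ∧ (x == L)) size ∷ wsum (λ x → H x ∧ not (x == L)) size ∷
              size L ∷ wsum (λ x → child r x ∧ (x == z)) size ∷ size z ∷ n ∷ []) (
              1000 ⋆ ‵ 0 ⊑ ‵ 1 ⊕ ‵ 2 by ≤-reflexive (wsum-split H (_== L) size) ∙
              1000 ⋆ ‵ 1 ⊑ ‵ 3 by wsum-single H size L ∙
              1000 ⋆ ‵ 2 ⊑ ‵ 4 by wsum-mono {H = λ x → H x ∧ not (x == L)} {λ x → child r x ∧ (x == z)} {size}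
                  {size} other-part (λ _ _ → ≤-refl) ∙
              1000 ⋆ ‵ 4 ⊑ ‵ 5 by wsum-single (child r) size z ∙ 1 ⋆ 1000 ⊛ ‵ 5 ⊑ 330 ⊛ ‵ 6 by small⇒ z sz ∙
              1 ⋆ κ 1 ⊕ 1000 ⊛ ‵ 3 ⊑ 335 ⊛ ‵ 6 by small-size L (∧₁ bL) ∙ end) 1 (1000 ⊛ ‵ 0) (665 ⊛ ‵ 6 ⊕ κ 1000))
            (robust-mono two robust-2)
            where
            H : Fin n → Bool
            H x = child r x ∧ ((x == L) ∨ (x == z))
            HL : H L ≡ true
            HL = both (∧₁ bL) (∨₁ (==-refl L))
            Hz : H z ≡ true
            Hz = both (∧₁ sz) (∨₂ {z == L} (==-refl z))
            z≢L : ¬ (z == L ≡ true)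
            z≢L eq with ==-elim {i = z} {L} eq
            ... | refl = <⇒≱ (big⇒ z bL) (small⇒ z sz)
            other-part : ∀ x → H x ∧ not (x == L) ≡ true → child r x ∧ (x == z) ≡ true
            other-part x h with ∨-elim {x == L} (∧₂ {child r x} (∧₁ h))
            ... | inj₁ eq = ⊥-elim (not-elim (∧₂ {H x} h) eq)
            ... | inj₂ eq = both (∧₁ (∧₁ h)) eq
            two : count H ≤ 2
            two = ≤-trans (count-cover H (_== L) (_== z) (λ x h → ∨-elim (∧₂ {child r x} h)))
                (+-mono-≤ (count-== L) (count-== z))

          -- All small branches are below 10, and a cheapest collection of them exceeding 10
          -- completes L. A set of fewer than k vertices meets small branches of total size at most
          -- 20, so of the 80 slots assumed there nearly 60 survive; n/50 requires 20.
          with-many : (∀ z → small z ≡ true → size z * 1000 < n * 10) → Cut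
          with-many light = build (scaled (n * 10))
            where
            build : (∃ λ ℓ → n * 10 < ℓ * 1000 × ℓ * 1000 ≤ n * 10 + 1000) → Cut
            build (ℓ , lo , hi) = cut-at-root R K (λ x → ∧₁)
              (linear (wsum (λ x → K x ∧ (x == L)) size ∷ wsum (λ x → K x ∧ not (x == L)) size ∷ wsum K size ∷
                size L ∷ wsum set size ∷ ℓ ∷ n ∷ []) (
                2000 ⋆ ‵ 0 ⊕ ‵ 1 ⊑ ‵ 2 by ≤-reflexive (sym (wsum-split K (_== L) size)) ∙
                2000 ⋆ ‵ 3 ⊑ ‵ 0 by wsum-point (λ x → K x ∧ (x == L)) size {L} (both KL (==-refl L)) ∙
                1000 ⋆ ‵ 4 ⊑ ‵ 1 by wsum-mono {H = set} {λ x → K x ∧ not (x == L)} {size} {size} into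
                    (λ _ _ → ≤-refl) ∙
                1000 ⋆ ‵ 5 ⊑ ‵ 4 by enough ∙ 1 ⋆ κ 1 ⊕ 10 ⊛ ‵ 6 ⊑ 1000 ⊛ ‵ 5 by lo ∙
                2 ⋆ κ 1 ⊕ 330 ⊛ ‵ 6 ⊑ 1000 ⊛ ‵ 3 by big⇒ L bL ∙ end) 2 (335 ⊛ ‵ 6) (1000 ⊛ ‵ 2))
              (linear (wsum K size ∷ wsum (λ x → K x ∧ (x == L)) size ∷ wsum (λ x → K x ∧ not (x == L)) size ∷
                size L ∷ wsum set size ∷ n ∷ []) (
                67000 ⋆ ‵ 0 ⊑ ‵ 1 ⊕ ‵ 2 by ≤-reflexive (wsum-split K (_== L) size) ∙
                67000 ⋆ ‵ 1 ⊑ ‵ 3 by wsum-single K size L ∙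
                67000 ⋆ ‵ 2 ⊑ ‵ 4 by wsum-mono {H = λ x → K x ∧ not (x == L)} {set} {size} {size} outof
                    (λ _ _ → ≤-refl) ∙
                67 ⋆ 1000 ⊛ ‵ 4 ⊑ 20 ⊛ ‵ 5 ⊕ κ 1000 by fits set inside ≤-refl ∙
                129 ⋆ κ 1 ⊕ 1000 ⊛ ‵ 3 ⊑ 335 ⊛ ‵ 5 by small-size L (∧₁ bL) ∙ end)
                67 (1000 ⊛ ‵ 0) (665 ⊛ ‵ 5 ⊕ κ 1000))
              (λ Q lt → (linear (wsum small (weight slot) ∷ wsum (touched small Q) size ∷ e ∷
                count (λ i → slot i ∧ free Q i) ∷ n ∷ []) (
                1000 ⋆ ‵ 0 ⊑ ‵ 1 ⊕ 2 ⊛ ‵ 2 ⊕ ‵ 3 by killed-below R r r small small-disjoint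
                    (λ z c → inj₁ (child⇒ (∧₁ c))) Q ∙
                1 ⋆ 1000 ⊛ ‵ 1 ⊑ 20 ⊛ ‵ 4 ⊕ κ 1000 by fits (touched small Q) (λ z → ∧₁)
                    (≤-trans (touched-count small Q small-disjoint) (≤-pred (≤-trans lt K-count))) ∙
                1 ⋆ 80 ⊛ ‵ 4 ⊑ 1000 ⊛ ‵ 0 by rich ∙ 40 ⋆ 20000 ⊛ ‵ 2 ⊑ ‵ 4 by tiny ∙ 798000 ⋆ κ 1 ⊑ ‵ 2 by 1≤e ∙
                end) 20 (‵ 4) (50 ⊛ ‵ 3)))
              where
              small-disjoint : Disjoint small
              small-disjoint = disjoint-⊆ (λ z → ∧₁) (children-disjoint r)
              H : Cheapest small size ℓ
              H = cheapest small size ℓ (linear (wsum small (weight slot) ∷ wsum small size ∷ n ∷ ℓ ∷ e ∷ []) (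
                1000 ⋆ ‵ 0 ⊑ ‵ 1 by wsum-mono {H = small} {small} {weight slot} {size} (λ _ h → h)
                    (λ z _ → weight≤size slot z) ∙
                1 ⋆ 80 ⊛ ‵ 2 ⊑ 1000 ⊛ ‵ 0 by rich ∙ 1 ⋆ 1000 ⊛ ‵ 3 ⊑ 10 ⊛ ‵ 2 ⊕ κ 1000 by hi ∙
                70 ⋆ 20000 ⊛ ‵ 4 ⊑ ‵ 2 by tiny ∙ 1400000 ⋆ κ 1 ⊑ ‵ 4 by 1≤e ∙ end) 1000 (‵ 3) (‵ 1))
              open Cheapest H
              pos : 0 < ℓ
              pos = linear (n ∷ ℓ ∷ []) (1 ⋆ κ 1 ⊕ 10 ⊛ ‵ 0 ⊑ 1000 ⊛ ‵ 1 by lo ∙ end) 1000 (κ 1 ⊕ κ 0) (‵ 1)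
              fits : ∀ Q → Q ⊆ small → count Q ≤ count set → wsum Q size * 1000 ≤ n * 20 + 1000
              fits Q Q⊆ le = from (argmax size small (inside _ (proj₂ (cheapest-inhabited H pos))))
                where
                from : (∃ λ z → small z ≡ true × (∀ y → small y ≡ true → size y ≤ size z)) → wsum Q size * 1000 ≤ n
                    * 20 + 1000
                from (z , sz , top) = linear (wsum Q size ∷ ℓ ∷ size z ∷ n ∷ []) (
                  1000 ⋆ ‵ 0 ⊑ ‵ 1 ⊕ ‵ 2 by cheapest-next H (size z) Q Q⊆ le pos top ∙
                  1 ⋆ κ 1 ⊕ 1000 ⊛ ‵ 2 ⊑ 10 ⊛ ‵ 3 by light z sz ∙ 1 ⋆ 1000 ⊛ ‵ 1 ⊑ 10 ⊛ ‵ 3 ⊕ κ 1000 by hi ∙ end)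
                  1 (1000 ⊛ ‵ 0) (20 ⊛ ‵ 3 ⊕ κ 1000)
              K : Fin n → Bool
              K x = child r x ∧ ((x == L) ∨ set x)
              KL : K L ≡ true
              KL = both (∧₁ bL) (∨₁ (==-refl L))
              into : ∀ x → set x ≡ true → K x ∧ not (x == L) ≡ true
              into x h = both (both (∧₁ (inside x h)) (∨₂ {x == L} h))
                  (not-intro (λ eq → case ==-elim {i = x} {L} eq of λ
                { refl → <⇒≱ (big⇒ x bL) (small⇒ x (inside x h)) }))
              outof : ∀ x → K x ∧ not (x == L) ≡ true → set x ≡ true
              outof x h = case ∨-elim {x == L} (∧₂ {child r x} (∧₁ h)) of λ
                { (inj₁ eq) → ⊥-elim (not-elim (∧₂ {K x} h) eq) ; (inj₂ s) → s }
              K-count : count K ≤ suc (count set)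
              K-count = ≤-trans (count-cover K (_== L) set (λ x h → ∨-elim (∧₂ {child r x} h)))
                  (+-monoˡ-≤ _ (count-== L))

          with-small : Cut
          with-small with exists? (λ z → small z ∧ ⌊ n * 10 ≤? size z * 1000 ⌋)
          ... | inj₁ (z , h) = with-one z (∧₁ h) (⌊⌋-elim (n * 10 ≤? size z * 1000) (∧₂ {small z} h))
          ... | inj₂ none = with-many (λ z s → ≰⇒> (λ le → none z (both s (⌊⌋-intro (n * 10 ≤? size z * 1000) le))))

        -- At least about 571 slots now lie in big branches. Each of these has between 330 and 335
        -- vertices, so there are two or three, and the two richest in slots contain two thirds of
        -- them, at least 380.
        module WithBig (poor : wsum small (weight slot) * 1000 < n * 80) where
          -- A smallest subtree of L that still reaches 329. Its child subtrees are below 329, as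
          -- needed for 335 + 329 ≤ 665, yet L loses only about 335 - 329 = 6 by the descent.
          deep : ∀ L → big L ≡ true → ∃ λ w → L ⊑ w × n * 329 ≤ size w * 1000 × (∀ z → Child w z → size z * 1000 < n
              * 329)
          deep L bL = from (argmin size large {L} (both (sub⇐ stop) (⌊⌋-intro (n * 329 ≤? size L * 1000)
              (linear (n ∷ size L ∷ []) (1 ⋆ κ 1 ⊕ 330 ⊛ ‵ 0 ⊑ 1000 ⊛ ‵ 1 by big⇒ L bL ∙ end)
                1 (329 ⊛ ‵ 0) (1000 ⊛ ‵ 1)))))
            where
            large : Fin n → Bool
            large w = sub L w ∧ ⌊ n * 329 ≤? size w * 1000 ⌋
            from : (∃ λ w → large w ≡ true × (∀ z → large z ≡ true → size w ≤ size z)) →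
              ∃ λ w → L ⊑ w × n * 329 ≤ size w * 1000 × (∀ z → Child w z → size z * 1000 < n * 329)
            from (w , h , low) = w , sub⇒ (∧₁ h) , ⌊⌋-elim (n * 329 ≤? size w * 1000) (∧₂ {sub L w} h) ,
              λ z c → ≰⇒> (λ le → <⇒≱ (size-child c) (low z (both (sub⇐ (⊑-trans (sub⇒ (∧₁ h)) (child-⊑ c stop)))
                (⌊⌋-intro (n * 329 ≤? size z * 1000) le))))

          -- At most `size L` minus `size w` slots of L lie outside the subtree of w; the additional
          -- 1 is for w itself.
          slots-below : ∀ {L w} → L ⊑ w → weight slot L + size w ≤ wsum (child w) (weight slot) + size L + 1
          slots-below {L} {w} Lw = linear (weight slot w ∷ β ∷ wsum (child w) (weight slot) ∷
            count (λ y → sub L y ∧ sub w y) ∷ count (λ y → sub L y ∧ not (sub w y)) ∷ size L ∷ size w ∷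
            weight slot L ∷ []) (1 ⋆ ‵ 0 ⊑ ‵ 1 ⊕ ‵ 2 by weight-children slot w ∙ 1 ⋆ ‵ 1 ⊑ κ 1 by bit≤1 (slot w) ∙
            1 ⋆ ‵ 3 ⊕ ‵ 4 ⊑ ‵ 5 by ≤-reflexive (sym (count-split (sub L) (sub w))) ∙
            1 ⋆ ‵ 6 ⊑ ‵ 3 by count-mono (sub w) (λ y → sub L y ∧ sub w y) (λ y s → both (sub⇐ (⊑-trans Lw (sub⇒ s)))
                s) ∙
            1 ⋆ ‵ 7 ⊑ ‵ 0 ⊕ ‵ 4 by count-cover (λ y → sub L y ∧ slot y) (λ y → sub w y ∧ slot y)
                (λ y → sub L y ∧ not (sub w y)) cases ∙
            end) 1 (‵ 7 ⊕ ‵ 6) (‵ 2 ⊕ ‵ 5 ⊕ κ 1)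
            where
            β : ℕ
            β = bit (slot w)
            cases : ∀ y → sub L y ∧ slot y ≡ true → sub w y ∧ slot y ≡ true ⊎ sub L y ∧ not (sub w y) ≡ true
            cases y h = case truth (sub w y) of λ
              { (inj₁ t) → inj₁ (both t (∧₂ {sub L y} h)) ; (inj₂ t) → inj₂ (both (∧₁ h) t) }

          module Pair (L L' : Fin n) (bL : big L ≡ true) (bL' : big L' ≡ true) (L≢L' : L ≢ L')
            (rich : n * 380 ≤ (weight slot L + weight slot L') * 1000)
            (w w' : Fin n) (Lw : L ⊑ w) (Lw' : L' ⊑ w') (large : n * 329 ≤ size w * 1000)
                (large' : n * 329 ≤ size w' * 1000)
            (light : ∀ z → Child w z → size z * 1000 < n * 329) (light' : ∀ z → Child w' z → size z * 1000 < n *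
                329)
            (ℓ : ℕ) (lo : n * 335 < ℓ * 1000) (hi : ℓ * 1000 ≤ n * 335 + 1000) where

            branch : ∀ {x} → L ⊑ x → L' ⊑ x → ⊥
            branch p q = L≢L' (children-disjoint r (∧₁ bL) (∧₁ bL') p q)

            C : Fin n → Bool
            C z = child w z ∨ child w' z

            C⇒ : ∀ z → C z ≡ true → Child w z ⊎ Child w' z
            C⇒ z c = case ∨-elim {child w z} c of λ { (inj₁ p) → inj₁ (child⇒ p) ; (inj₂ p) → inj₂ (child⇒ p) }

            C-disjoint : Disjoint C
            C-disjoint {y} {z} cy cz p q = from (C⇒ y cy) (C⇒ z cz)
              where
              from : Child w y ⊎ Child w' y → Child w z ⊎ Child w' z → y ≡ z
              from (inj₁ c) (inj₁ d) = children-disjoint w (child⇐ c) (child⇐ d) p q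
              from (inj₂ c) (inj₂ d) = children-disjoint w' (child⇐ c) (child⇐ d) p q
              from (inj₁ c) (inj₂ d) = ⊥-elim (branch (⊑-trans Lw (child-⊑ c p)) (⊑-trans Lw' (child-⊑ d q)))
              from (inj₂ c) (inj₁ d) = ⊥-elim (branch (⊑-trans Lw (child-⊑ d q)) (⊑-trans Lw' (child-⊑ c p)))

            C-sum : ∀ g → wsum (child w) g + wsum (child w') g ≤ wsum C g
            C-sum g = linear (wsum (λ z → C z ∧ child w z) g ∷ wsum (λ z → C z ∧ not (child w z)) g ∷ wsum C g ∷
              wsum (child w) g ∷ wsum (child w') g ∷ []) (
              1 ⋆ ‵ 0 ⊕ ‵ 1 ⊑ ‵ 2 by ≤-reflexive (sym (wsum-split C (child w) g)) ∙
              1 ⋆ ‵ 3 ⊑ ‵ 0 by wsum-mono {H = child w} {λ z → C z ∧ child w z} {g} {g} (λ z h → both (∨₁ h) h)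
                  (λ _ _ → ≤-refl) ∙
              1 ⋆ ‵ 4 ⊑ ‵ 1 by wsum-mono {H = child w'} {λ z → C z ∧ not (child w z)} {g} {g}
                  (λ z h → both (∨₂ {child w z} h) (not-intro (λ k → branch (⊑-trans Lw (child-⊑ (child⇒ k) stop))
                  (⊑-trans Lw' (child-⊑ (child⇒ h) stop))))) (λ _ _ → ≤-refl) ∙
              end) 1 (‵ 3 ⊕ ‵ 4) (‵ 2)

            H : Cheapest C size ℓ
            H = cheapest C size ℓ (linear (size w ∷ wsum (child w) size ∷ size w' ∷ wsum (child w') size ∷
              wsum C size ∷ n ∷ ℓ ∷ e ∷ []) (1000 ⋆ ‵ 0 ⊑ κ 1 ⊕ ‵ 1 by size-children w ∙
              1000 ⋆ ‵ 2 ⊑ κ 1 ⊕ ‵ 3 by size-children w' ∙ 1000 ⋆ ‵ 1 ⊕ ‵ 3 ⊑ ‵ 4 by C-sum size ∙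
              1 ⋆ 329 ⊛ ‵ 5 ⊑ 1000 ⊛ ‵ 0 by large ∙ 1 ⋆ 329 ⊛ ‵ 5 ⊑ 1000 ⊛ ‵ 2 by large' ∙
              1 ⋆ 1000 ⊛ ‵ 6 ⊑ 335 ⊛ ‵ 5 ⊕ κ 1000 by hi ∙ 323 ⋆ 20000 ⊛ ‵ 7 ⊑ ‵ 5 by tiny ∙
              6460000 ⋆ κ 1 ⊑ ‵ 7 by 1≤e ∙ end) 1000 (‵ 6) (‵ 4))
            open Cheapest H

            out : ¬ (union set w ≡ true)
            out u = from (union⇒ {set} u)
              where
              from : (∃ λ z → set z ≡ true × z ⊑ w) → ⊥
              from (z , hz , zw) = case C⇒ z (inside z hz) of λ
                { (inj₁ c) → 1+n≰n (≤-trans (≤-reflexive (sym (child-depth c))) (⊑-depth zw))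
                ; (inj₂ c) → branch Lw (⊑-trans Lw' (child-⊑ c zw)) }

            out' : ¬ (union set w' ≡ true)
            out' u = from (union⇒ {set} u)
              where
              from : (∃ λ z → set z ≡ true × z ⊑ w') → ⊥
              from (z , hz , zw) = case C⇒ z (inside z hz) of λ
                { (inj₁ c) → branch (⊑-trans Lw (child-⊑ c zw)) Lw'
                ; (inj₂ c) → 1+n≰n (≤-trans (≤-reflexive (sym (child-depth c))) (⊑-depth zw)) }

            apart : ¬ (adj T w w' ≡ true)
            apart a with edge w w' a
            ... | inj₁ (h , eq) = branch Lw (⊑-trans Lw' (child-⊑ (h , eq) stop))
            ... | inj₂ (h , eq) = branch (⊑-trans Lw (child-⊑ (h , eq) stop)) Lw'

            light-C : ∀ z → C z ≡ true → size z * 1000 < n * 329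
            light-C z c = case C⇒ z c of λ { (inj₁ p) → light z p ; (inj₂ p) → light' z p }

            pair : Cut
            pair = from (cheapest-inhabited H (linear (n ∷ ℓ ∷ []) (1 ⋆ κ 1 ⊕ 335 ⊛ ‵ 0 ⊑ 1000 ⊛ ‵ 1 by lo ∙ end)
              1000 (κ 1 ⊕ κ 0) (‵ 1)))
              where
              from : (∃ λ z → set z ≡ true) → Cut
              from (z , hz) = cut R w w' set apart (disjoint-⊆ inside C-disjoint) (λ z h → C⇒ z (inside z h)) out
                  out'
                (linear (ℓ ∷ wsum set size ∷ n ∷ []) (1000 ⋆ ‵ 0 ⊑ ‵ 1 by enough ∙
                  1 ⋆ κ 1 ⊕ 335 ⊛ ‵ 2 ⊑ 1000 ⊛ ‵ 0 by lo ∙ end) 1 (335 ⊛ ‵ 2) (1000 ⊛ ‵ 1))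
                (linear (wsum set size ∷ ℓ ∷ size z ∷ n ∷ []) (329000 ⋆ κ 1 ⊕ ‵ 0 ⊑ ‵ 1 ⊕ ‵ 2 by bound hz ∙
                  329 ⋆ 1000 ⊛ ‵ 1 ⊑ 335 ⊛ ‵ 3 ⊕ κ 1000 by hi ∙
                  330 ⋆ κ 1 ⊕ 1000 ⊛ ‵ 2 ⊑ 329 ⊛ ‵ 3 by light-C z (inside z hz) ∙ end)
                  329 (1000 ⊛ ‵ 0) (665 ⊛ ‵ 3 ⊕ κ 1000))
                -- Of 380 slots, twice 6 are lost by descending to w and w', and 335 to touched
                -- subtrees. About 33 remain, more than the 20 required.
                (λ Q lt → (linear (wsum C (weight slot) ∷ wsum (touched C Q) size ∷ e ∷
                  count (λ i → slot i ∧ free Q i) ∷ wsum (child w) (weight slot) ∷ wsum (child w') (weight slot) ∷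
                  weight slot L ∷ size w ∷ size L ∷ weight slot L' ∷ size w' ∷ size L' ∷ ℓ ∷ n ∷ []) (
                  1000 ⋆ ‵ 0 ⊑ ‵ 1 ⊕ 2 ⊛ ‵ 2 ⊕ ‵ 3 by killed-below R w w' C C-disjoint C⇒ Q ∙
                  1000 ⋆ ‵ 4 ⊕ ‵ 5 ⊑ ‵ 0 by C-sum (weight slot) ∙
                  1000 ⋆ ‵ 6 ⊕ ‵ 7 ⊑ ‵ 4 ⊕ ‵ 8 ⊕ κ 1 by slots-below Lw ∙
                  1000 ⋆ ‵ 9 ⊕ ‵ 10 ⊑ ‵ 5 ⊕ ‵ 11 ⊕ κ 1 by slots-below Lw' ∙
                  1000 ⋆ κ 1 ⊕ ‵ 1 ⊑ ‵ 12 by minimal (touched C Q) (λ z → ∧₁)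
                      (≤-<-trans (touched-count C Q C-disjoint) lt) ∙
                  1 ⋆ 1000 ⊛ ‵ 12 ⊑ 335 ⊛ ‵ 13 ⊕ κ 1000 by hi ∙ 1 ⋆ 329 ⊛ ‵ 13 ⊑ 1000 ⊛ ‵ 7 by large ∙
                  1 ⋆ 329 ⊛ ‵ 13 ⊑ 1000 ⊛ ‵ 10 by large' ∙
                  1 ⋆ κ 1 ⊕ 1000 ⊛ ‵ 8 ⊑ 335 ⊛ ‵ 13 by small-size L (∧₁ bL) ∙
                  1 ⋆ κ 1 ⊕ 1000 ⊛ ‵ 11 ⊑ 335 ⊛ ‵ 13 by small-size L' (∧₁ bL') ∙
                  1 ⋆ 380 ⊛ ‵ 13 ⊑ 1000 ⊛ (‵ 6 ⊕ ‵ 9) by rich ∙ 13 ⋆ 20000 ⊛ ‵ 2 ⊑ ‵ 13 by tiny ∙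
                  258000 ⋆ κ 1 ⊑ ‵ 2 by 1≤e ∙ end) 20 (‵ 13) (50 ⊛ ‵ 3)))

          module Largest (L : Fin n) (bL : big L ≡ true) (top : ∀ z → big z ≡ true → weight slot z ≤ weight slot L)
              where
            rest : Fin n → Bool
            rest z = big z ∧ not (z == L)

            rest-slots : n * 571 ≤ (weight slot L + wsum rest (weight slot)) * 1000 + e * 2000
            rest-slots = linear (n ∷ count slot ∷ e ∷ wsum (child r) (weight slot) ∷ wsum small (weight slot) ∷
              wsum big (weight slot) ∷ wsum (λ z → big z ∧ (z == L)) (weight slot) ∷ wsum rest (weight slot) ∷
              weight slot L ∷ []) (1 ⋆ 651 ⊛ ‵ 0 ⊑ 1000 ⊛ ‵ 1 ⊕ 1000 ⊛ ‵ 2 by slots ∙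
              1000 ⋆ ‵ 1 ⊑ κ 1 ⊕ ‵ 3 by all-slots ∙ 1 ⋆ κ 1 ⊕ 1000 ⊛ ‵ 4 ⊑ 80 ⊛ ‵ 0 by poor ∙
              1000 ⋆ ‵ 3 ⊑ ‵ 4 ⊕ ‵ 5 by ≤-reflexive (wsum-split (child r) (λ z → ⌊ size z * 1000 ≤? n * 330 ⌋)
                  (weight slot)) ∙
              1000 ⋆ ‵ 5 ⊑ ‵ 6 ⊕ ‵ 7 by ≤-reflexive (wsum-split big (_== L) (weight slot)) ∙
              1000 ⋆ ‵ 6 ⊑ ‵ 8 by wsum-single big (weight slot) L ∙ 1000 ⋆ κ 1 ⊑ ‵ 2 by 1≤e ∙ end)
              1 (571 ⊛ ‵ 0) (1000 ⊛ (‵ 8 ⊕ ‵ 7) ⊕ 2000 ⊛ ‵ 2)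

            -- With L there would be four branches above 330, more than 1000 together. The integer
            -- part of 330n/1000 is the uniform bound that `wsum-bound-below` takes.
            rest-few : count rest ≤ 2
            rest-few = ≮⇒≥ (λ lt → (linear-absurd (n ∷ n * 330 % 1000 ∷ n * 330 / 1000 ∷
              count rest * (n * 330 / 1000) ∷ wsum rest size ∷ wsum (λ z → big z ∧ (z == L)) size ∷ wsum big size ∷
              size L ∷ wsum (child r) size ∷ count (union (child r)) ∷ e ∷ []) (
              3 ⋆ 330 ⊛ ‵ 0 ⊑ ‵ 1 ⊕ 1000 ⊛ ‵ 2 by ≤-reflexive (m≡m%n+[m/n]*n (n * 330) 1000) ∙
              3 ⋆ κ 1 ⊕ ‵ 1 ⊑ κ 1000 by m%n<n (n * 330) 1000 ∙
              1000 ⋆ 3 ⊛ ‵ 2 ⊑ ‵ 3 by ≤-trans (≤-reflexive (*-comm (n * 330 / 1000) 3)) (*-monoˡ-≤ (n * 330 / 1000)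
                  lt) ∙
              1000 ⋆ ‵ 3 ⊑ ‵ 4 by wsum-bound-below rest size (n * 330 / 1000) heavy ∙
              1000 ⋆ ‵ 5 ⊕ ‵ 4 ⊑ ‵ 6 by ≤-reflexive (sym (wsum-split big (_== L) size)) ∙
              1000 ⋆ ‵ 7 ⊑ ‵ 5 by wsum-point (λ z → big z ∧ (z == L)) size {L} (both bL (==-refl L)) ∙
              1 ⋆ κ 1 ⊕ 330 ⊛ ‵ 0 ⊑ 1000 ⊛ ‵ 7 by big⇒ L bL ∙
              1000 ⋆ ‵ 6 ⊑ ‵ 8 by wsum-mono {H = big} {child r} {size} {size} (λ z → ∧₁) (λ _ _ → ≤-refl) ∙
              1000 ⋆ ‵ 8 ⊑ ‵ 9 by ≤-reflexive (sym (union-size (child r) (children-disjoint r))) ∙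
              1000 ⋆ ‵ 9 ⊑ ‵ 0 by count≤ (union (child r)) ∙ 320 ⋆ 20000 ⊛ ‵ 10 ⊑ ‵ 0 by tiny ∙
              6400000 ⋆ κ 1 ⊑ ‵ 10 by 1≤e ∙ end)))
              where
              heavy : ∀ z → rest z ≡ true → n * 330 / 1000 ≤ size z
              heavy z h = linear (n * 330 % 1000 ∷ n * 330 / 1000 ∷ n ∷ size z ∷ []) (
                1 ⋆ ‵ 0 ⊕ 1000 ⊛ ‵ 1 ⊑ 330 ⊛ ‵ 2 by ≤-reflexive (sym (m≡m%n+[m/n]*n (n * 330) 1000)) ∙
                1 ⋆ κ 1 ⊕ 330 ⊛ ‵ 2 ⊑ 1000 ⊛ ‵ 3 by big⇒ z (∧₁ h) ∙ end) 1000 (‵ 1) (‵ 3)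

            another : ∃ λ z → rest z ≡ true
            another = case exists? rest of λ
              { (inj₁ h) → h
              ; (inj₂ none) → ⊥-elim (linear-absurd (n ∷ weight slot L ∷ wsum rest (weight slot) ∷ e ∷
                count rest * 0 ∷ size L ∷ []) (1 ⋆ 571 ⊛ ‵ 0 ⊑ 1000 ⊛ (‵ 1 ⊕ ‵ 2) ⊕ 2000 ⊛ ‵ 3 by rest-slots ∙
                1000 ⋆ ‵ 2 ⊑ ‵ 4 by wsum-bound rest (weight slot) 0 (λ z h → ⊥-elim (none z h)) ∙
                1000 ⋆ ‵ 4 ⊑ κ 0 by ≤-reflexive (*-zeroʳ (count rest)) ∙ 1000 ⋆ ‵ 1 ⊑ ‵ 5 by weight≤size slot L ∙
                1 ⋆ κ 1 ⊕ 1000 ⊛ ‵ 5 ⊑ 335 ⊛ ‵ 0 by small-size L (∧₁ bL) ∙ 236 ⋆ 20000 ⊛ ‵ 3 ⊑ ‵ 0 by tiny ∙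
                4718000 ⋆ κ 1 ⊑ ‵ 3 by 1≤e ∙ end)) }

            two-big : Cut
            two-big = from (argmax (weight slot) rest {proj₁ another} (proj₂ another))
              where
              from : (∃ λ z → rest z ≡ true × (∀ y → rest y ≡ true → weight slot y ≤ weight slot z)) → Cut
              from (L' , h , top') = go (deep L bL) (deep L' (∧₁ h)) (scaled (n * 335))
                where
                -- L has at least the slots of L', and `rest` at most twice those of L'; hence L and
                -- L' contain two thirds of 571.
                rich : n * 380 ≤ (weight slot L + weight slot L') * 1000
                rich = linear (n ∷ weight slot L ∷ wsum rest (weight slot) ∷ e ∷ weight slot L' ∷
                  count rest * weight slot L' ∷ []) (
                  3800 ⋆ 571 ⊛ ‵ 0 ⊑ 1000 ⊛ (‵ 1 ⊕ ‵ 2) ⊕ 2000 ⊛ ‵ 3 by rest-slots ∙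
                  1891000 ⋆ ‵ 4 ⊑ ‵ 1 by top L' (∧₁ h) ∙
                  3800000 ⋆ ‵ 2 ⊑ ‵ 5 by wsum-bound rest (weight slot) (weight slot L') top' ∙
                  3800000 ⋆ ‵ 5 ⊑ 2 ⊛ ‵ 4 by ≤-trans (*-monoˡ-≤ (weight slot L') rest-few)
                      (≤-reflexive (*-comm 2 (weight slot L'))) ∙
                  380 ⋆ 20000 ⊛ ‵ 3 ⊑ ‵ 0 by tiny ∙ end) 5709 (380 ⊛ ‵ 0) (1000 ⊛ (‵ 1 ⊕ ‵ 4))
                go : (∃ λ w → L ⊑ w × n * 329 ≤ size w * 1000 × (∀ z → Child w z → size z * 1000 < n * 329)) →
                  (∃ λ w → L' ⊑ w × n * 329 ≤ size w * 1000 × (∀ z → Child w z → size z * 1000 < n * 329)) →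
                  (∃ λ ℓ → n * 335 < ℓ * 1000 × ℓ * 1000 ≤ n * 335 + 1000) → Cut
                go (w , Lw , la , li) (w' , Lw' , la' , li') (ℓ , lo , hi) = Pair.pair L L' bL (∧₁ h)
                  (λ { refl → not-elim (∧₂ {big L} h) (==-refl L) }) rich w w' Lw Lw' la la' li li' ℓ lo hi

        not-huge : Cut
        not-huge = case exists? big of λ
          { (inj₂ none) → no-big none
          ; (inj₁ (L , bL)) → case n * 80 ≤? wsum small (weight slot) * 1000 of λ
            { (yes rich) → WithSmall.with-small L bL rich
            ; (no ¬rich) → case argmax (weight slot) big bL of λ
              { (L₁ , b₁ , top) → WithBig.Largest.two-big (≰⇒> ¬rich) L₁ b₁ top } } }

      centre-cut : Cut
      centre-cut = case exists? (λ z → child r z ∧ ⌊ n * 335 ≤? size z * 1000 ⌋) of λ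
        { (inj₁ (z , h)) → huge z (∧₁ h) (⌊⌋-elim (n * 335 ≤? size z * 1000) (∧₂ {child r z} h))
        ; (inj₂ none) → NotHuge.not-huge
            (λ z c → ≰⇒> (λ le → none z (both c (⌊⌋-intro (n * 335 ≤? size z * 1000) le)))) }

    balanced-cut : Cut
    balanced-cut = case centroid T rooted r₀ of λ { (r , R , half) → Centre.centre-cut R half }

-- Spanning the larger class

-- χ is the colour that is dense across (U₁, U₂); e bounds μn, cn and the slack in all size conditions.
record Setting {n N} {T : SimpleGraph n} {e} (B : Bipartition T e) (G : ColouredKN N) (χ : Colour)
    (U₁ U₂ : Fin N → Bool) : Set where
  open Bipartition B public
  field
    10≤e       : 10 ≤ e
    tiny       : e * 20000 ≤ n
    unbalanced : t₂ * 2 ≤ t₁ + e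
    below      : N + 1 ≤ t₁ * 2 + e
    above₁     : t₁ * 2 ≤ N + 1
    above₂     : t₁ + t₂ * 2 ≤ N + 1
    disjoint   : ∀ u → U₁ u ≡ true → U₂ u ≡ true → ⊥
    large₁     : t₁ ≤ count U₁ + e
    large₂     : t₁ ≤ count U₂ + e
    sparse₁    : ∀ u → U₁ u ≡ true → deg G χ u U₁ ≤ e × deg G (other χ) u U₂ ≤ e
    sparse₂    : ∀ u → U₂ u ≡ true → deg G χ u U₂ ≤ e × deg G (other χ) u U₁ ≤ e

mirror : ∀ {n N T e B G χ U₁ U₂} → Setting {n} {N} {T} {e} B G χ U₁ U₂ → Setting B G χ U₂ U₁
mirror S = record
  { 10≤e = 10≤e ; tiny = tiny ; unbalanced = unbalanced ; below = below ; above₁ = above₁ ; above₂ = above₂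
  ; disjoint = λ u p q → disjoint u q p ; large₁ = large₂ ; large₂ = large₁ ; sparse₁ = sparse₂ ; sparse₂ = sparse₁
      }
  where open Setting S

deg-mono : ∀ {N} (G : ColouredKN N) k u {P Q : Fin N → Bool} → P ⊆ Q → deg G k u P ≤ deg G k u Q
deg-mono G k u {P} {Q} h = count-mono (λ w → P w ∧ not ⌊ w ≟ᶠ u ⌋ ∧ (colour G u w ==ᶜ k))
    (λ w → Q w ∧ not ⌊ w ≟ᶠ u ⌋ ∧ (colour G u w ==ᶜ k))
  (λ i e → both (h i (∧₁ e)) (∧₂ {P i} e))

-- The summand 1 stands for u itself, which neither degree counts.
deg-total : ∀ {N} (G : ColouredKN N) k u (P : Fin N → Bool) → count P ≤ deg G k u P + deg G (other k) u P + 1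
deg-total G k u P = linear (count P ∷ count (λ w → (w == u) ∨ (P w ∧ not (w == u) ∧ (colour G u w ==ᶜ k))) ∷
  deg G (other k) u P ∷ count (_== u) ∷ deg G k u P ∷ []) (
  1 ⋆ ‵ 0 ⊑ ‵ 1 ⊕ ‵ 2 by count-cover P (λ w → (w == u) ∨ (P w ∧ not (w == u) ∧ (colour G u w ==ᶜ k)))
      (λ w → P w ∧ not ⌊ w ≟ᶠ u ⌋ ∧ (colour G u w ==ᶜ other k)) cases ∙
  1 ⋆ ‵ 1 ⊑ ‵ 3 ⊕ ‵ 4 by count-cover (λ w → (w == u) ∨ (P w ∧ not (w == u) ∧ (colour G u w ==ᶜ k))) (_== u)
      (λ w → P w ∧ not ⌊ w ≟ᶠ u ⌋ ∧ (colour G u w ==ᶜ k)) (λ w → ∨-elim) ∙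
  1 ⋆ ‵ 3 ⊑ κ 1 by count-== u ∙ end) 1 (‵ 0) (‵ 4 ⊕ ‵ 2 ⊕ κ 1)
  where
  cases : ∀ w → P w ≡ true → (w == u) ∨ (P w ∧ not (w == u) ∧ (colour G u w ==ᶜ k)) ≡ true ⊎
    P w ∧ not ⌊ w ≟ᶠ u ⌋ ∧ (colour G u w ==ᶜ other k) ≡ true
  cases w p with truth (w == u) | truth (colour G u w ==ᶜ k)
  ... | inj₁ eq | _      = inj₁ (∨₁ eq)
  ... | inj₂ ne | inj₁ c = inj₁ (∨₂ {w == u} (both p (both ne c)))
  ... | inj₂ ne | inj₂ c = inj₂ (both p
      (both ne (subst (λ d → (d ==ᶜ other k) ≡ true) (sym (not-this _ k (not-elim c))) (==ᶜ-refl (other k)))))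

-- The non-slots are embedded greedily with `p₀` pinned to `y₀`; then the slots are assigned to what
-- is left of A. The leaf `ℓ₀` is reserved for `x₀` outside A, so t₁ - 1 vertices in A are enough.
module Spanning {n N} {T : SimpleGraph n} {e} {B : Bipartition T e} {G : ColouredKN N} {χ U₁ U₂}
    (S : Setting B G χ U₁ U₂)
  (A : Fin N → Bool) (k : ℕ) (k≤ : k ≤ e * 2) (robust : Bipartition.Robust B k)
  (almost : ∀ x → A x ≡ true → deg G (other χ) x U₂ < k) (enough : Bipartition.t₁ B ≤ count A + 1)
  (x₀ y₀ : Fin N) (x₀∉A : ¬ (A x₀ ≡ true)) (y₀∈U₂ : U₂ y₀ ≡ true) (x₀≢y₀ : x₀ ≢ y₀) (x₀y₀ : colour G x₀ y₀ ≡ χ)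
  (ℓ₀ p₀ : Fin n) (ℓ₀-class : Bipartition.class B ℓ₀ ≡ true) (ℓ₀p₀ : adj T ℓ₀ p₀ ≡ true)
  (only : ∀ q → adj T ℓ₀ q ≡ true → q ≡ p₀) where
  open Setting S

  t₁-large : n * 66 ≤ t₁ * 100
  t₁-large = linear (n ∷ t₁ ∷ t₂ ∷ e ∷ []) (880000 ⋆ ‵ 0 ⊑ ‵ 1 ⊕ ‵ 2 by ≤-reflexive (sym total) ∙
    440000 ⋆ 2 ⊛ ‵ 2 ⊑ ‵ 1 ⊕ ‵ 3 by unbalanced ∙ 22 ⋆ 20000 ⊛ ‵ 3 ⊑ ‵ 0 by tiny ∙ end) 13333 (66 ⊛ ‵ 0) (100 ⊛ ‵ 1)

  -- A vertex of A has few edges to U₂ in the other colour and a vertex of U₂ has few in colour χ;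
  -- both at once would make U₂ small.
  A∉U₂ : ∀ {x} → A x ≡ true → ¬ (U₂ x ≡ true)
  A∉U₂ {x} a u = linear-absurd (count U₂ ∷ deg G χ x U₂ ∷ deg G (other χ) x U₂ ∷ k ∷ e ∷ t₁ ∷ n ∷ []) (
    100 ⋆ ‵ 0 ⊑ ‵ 1 ⊕ ‵ 2 ⊕ κ 1 by deg-total G χ x U₂ ∙ 100 ⋆ κ 1 ⊕ ‵ 2 ⊑ ‵ 3 by almost x a ∙
    100 ⋆ ‵ 3 ⊑ 2 ⊛ ‵ 4 by k≤ ∙ 100 ⋆ ‵ 1 ⊑ ‵ 4 by proj₁ (sparse₂ x u) ∙ 100 ⋆ ‵ 5 ⊑ ‵ 0 ⊕ ‵ 4 by large₂ ∙
    1 ⋆ 66 ⊛ ‵ 6 ⊑ 100 ⊛ ‵ 5 by t₁-large ∙ 66 ⋆ 20000 ⊛ ‵ 4 ⊑ ‵ 6 by tiny ∙ 1319600 ⋆ κ 10 ⊑ ‵ 4 by 10≤e ∙ end)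

  opposite : ∀ {x y} → adj T x y ≡ true → class x ≡ true → coclass y ≡ true
  opposite {x} {y} a c = trans (sym (alternate x y a)) c

  D : Fin n → Bool
  D x = not (slot x)

  side₁ side₂ : Fin N → Bool
  side₁ h = U₁ h ∧ not ((h == x₀) ∨ (h == y₀))
  side₂ h = U₂ h ∧ not ((h == x₀) ∨ (h == y₀))

  V : Bool → Fin N → Bool
  V true  = side₁
  V false = side₂

  coclass-D : ∀ {x} → coclass x ≡ true → D x ≡ true
  coclass-D c = not-intro (λ s → not-elim c (∧₁ s))

  p₀-coclass : coclass p₀ ≡ true
  p₀-coclass = opposite ℓ₀p₀ ℓ₀-class

  trimmed : ∀ (U : Fin N → Bool) → count U ≤ count (λ h → U h ∧ not ((h == x₀) ∨ (h == y₀))) + 2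
  trimmed U = linear (count U ∷ count (λ h → U h ∧ ((h == x₀) ∨ (h == y₀))) ∷
    count (λ h → U h ∧ not ((h == x₀) ∨ (h == y₀))) ∷ count (_== x₀) ∷ count (_== y₀) ∷ []) (
    1 ⋆ ‵ 0 ⊑ ‵ 1 ⊕ ‵ 2 by ≤-reflexive (count-split U (λ h → (h == x₀) ∨ (h == y₀))) ∙
    1 ⋆ ‵ 1 ⊑ ‵ 3 ⊕ ‵ 4 by count-cover (λ h → U h ∧ ((h == x₀) ∨ (h == y₀))) (_== x₀) (_== y₀)
        (λ h q → ∨-elim (∧₂ {U h} q)) ∙
    1 ⋆ ‵ 3 ⊑ κ 1 by count-== x₀ ∙ 1 ⋆ ‵ 4 ⊑ κ 1 by count-== y₀ ∙ end) 1 (‵ 0) (‵ 2 ⊕ κ 2)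

  residual : count (λ x → D x ∧ class x) + count slot ≤ t₁
  residual = count-pack class (λ x → D x ∧ class x) slot (λ x h → ∧₂ {D x} h) (λ x → ∧₁)
      (λ x h s → not-elim (∧₁ h) s)

  plenty : n * 65 ≤ count slot * 100 + e * 100
  plenty = linear (t₁ ∷ n ∷ count slot ∷ t₂ ∷ e ∷ []) (60 ⋆ 65 ⊛ ‵ 0 ⊑ ‵ 1 ⊕ 65 ⊛ ‵ 2 by many-slots p₀ ∙
    2600 ⋆ ‵ 1 ⊑ ‵ 0 ⊕ ‵ 3 by ≤-reflexive (sym total) ∙ 1300 ⋆ 2 ⊛ ‵ 3 ⊑ ‵ 0 ⊕ ‵ 4 by unbalanced ∙
    5 ⋆ 20000 ⊛ ‵ 4 ⊑ ‵ 1 by tiny ∙ 102600 ⋆ κ 10 ⊑ ‵ 4 by 10≤e ∙ end) 39 (65 ⊛ ‵ 1) (100 ⊛ ‵ 2 ⊕ 100 ⊛ ‵ 4)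

  V-dense : ∀ x y → adj T x y ≡ true → ∀ h → V (class x) h ≡ true → deg G (other χ) h (V (class y)) ≤ e
  V-dense x y xy h v with class x | class y | alternate x y xy
  ... | true  | false | _ = ≤-trans (deg-mono G (other χ) h {side₂} {U₂} (λ i → ∧₁)) (proj₂ (sparse₁ h (∧₁ v)))
  ... | false | true  | _ = ≤-trans (deg-mono G (other χ) h {side₁} {U₁} (λ i → ∧₁)) (proj₂ (sparse₂ h (∧₁ v)))
  ... | true  | true  | ()
  ... | false | false | ()

  Embedded : (Fin n → Fin N) → Set
  Embedded f = f p₀ ≡ y₀ × f p₀ ≡ y₀ × (∀ x → D x ≡ true → x ≢ p₀ → x ≢ p₀ → V (class x) (f x) ≡ true) ×
    (∀ x y → D x ≡ true → D y ≡ true → f x ≡ f y → x ≡ y) ×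
    (∀ x y → D x ≡ true → D y ≡ true → adj T x y ≡ true → colour G (f x) (f y) ≡ χ)

  -- Both special vertices are `p₀`, and there are no ports: being in U₂, the host `y₀` is as well
  -- connected to U₁ as `dense-a` demands.
  partial-copy : ∃ Embedded
  partial-copy = embed (rooted p₀) G χ p₀ y₀ y₀ (λ _ → refl) (λ ne → ⊥-elim (ne refl)) (false-elim (irrefl T p₀))
    D (λ _ → false) class (coclass-D p₀-coclass) (coclass-D p₀-coclass) V (λ h p q → disjoint h (∧₁ p) (∧₁ q))
    y₀∉V y₀∉V e (λ _ ()) (λ _ _ ()) (λ _ _ ()) (λ x y xy _ _ _ _ _ _ h v → V-dense x y xy h v)
    from-p₀ from-p₀ room
    where
    y₀∉V : ∀ i → ¬ (V i y₀ ≡ true)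
    y₀∉V true  v = not-elim (∧₂ {U₁ y₀} v) (∨₂ {y₀ == x₀} (==-refl y₀))
    y₀∉V false v = not-elim (∧₂ {U₂ y₀} v) (∨₂ {y₀ == x₀} (==-refl y₀))
    from-p₀ : ∀ w → D w ≡ true → ¬ (false ≡ true) → adj T p₀ w ≡ true → deg G (other χ) y₀ (V (class w)) ≤ e
    from-p₀ w _ _ pw with class w | alternate w p₀ (trans (adj-sym T w p₀) pw)
    ... | true  | _  = ≤-trans (deg-mono G (other χ) y₀ {side₁} {U₁} (λ i → ∧₁)) (proj₂ (sparse₂ y₀ y₀∈U₂))
    ... | false | eq = ⊥-elim (not-elim p₀-coclass (trans (sym (not-involutive (class p₀))) (cong not (sym eq))))
    room : ∀ i → count (λ x → D x ∧ same (class x) i) + e * 2 ≤ count (V i)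
    room true = linear (count (λ x → D x ∧ same (class x) true) ∷ count (λ x → D x ∧ class x) ∷ count slot ∷ t₁ ∷
      n ∷ e ∷ count U₁ ∷ count side₁ ∷ []) (
      100 ⋆ ‵ 0 ⊑ ‵ 1 by count-mono (λ x → D x ∧ same (class x) true) (λ x → D x ∧ class x)
          (λ x h → both (∧₁ h) (⌊⌋-elim (class x ≟ᵇ true) (∧₂ {D x} h))) ∙
      100 ⋆ ‵ 1 ⊕ ‵ 2 ⊑ ‵ 3 by residual ∙ 1 ⋆ 65 ⊛ ‵ 4 ⊑ 100 ⊛ ‵ 2 ⊕ 100 ⊛ ‵ 5 by plenty ∙
      100 ⋆ ‵ 6 ⊑ ‵ 7 ⊕ κ 2 by trimmed U₁ ∙ 100 ⋆ ‵ 3 ⊑ ‵ 6 ⊕ ‵ 5 by large₁ ∙ 65 ⋆ 20000 ⊛ ‵ 5 ⊑ ‵ 4 by tiny ∙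
      1299600 ⋆ κ 10 ⊑ ‵ 5 by 10≤e ∙ end) 100 (‵ 0 ⊕ 2 ⊛ ‵ 5) (‵ 7)
    room false = linear (count (λ x → D x ∧ same (class x) false) ∷ t₂ ∷ count U₂ ∷ count side₂ ∷ t₁ ∷ e ∷ n ∷ []) (
      50 ⋆ ‵ 0 ⊑ ‵ 1 by count-mono (λ x → D x ∧ same (class x) false) coclass
          (λ x h → cong not (⌊⌋-elim (class x ≟ᵇ false) (∧₂ {D x} h))) ∙
      50 ⋆ ‵ 2 ⊑ ‵ 3 ⊕ κ 2 by trimmed U₂ ∙ 50 ⋆ ‵ 4 ⊑ ‵ 2 ⊕ ‵ 5 by large₂ ∙ 1 ⋆ 66 ⊛ ‵ 6 ⊑ 100 ⊛ ‵ 4 by t₁-large ∙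
      50 ⋆ ‵ 4 ⊕ ‵ 1 ⊑ ‵ 6 by ≤-reflexive total ∙ 16 ⋆ 20000 ⊛ ‵ 5 ⊑ ‵ 6 by tiny ∙ 319850 ⋆ κ 10 ⊑ ‵ 5 by 10≤e ∙
      end) 50 (‵ 0 ⊕ 2 ⊛ ‵ 5) (‵ 3)

  module Complete (f : Fin n → Fin N) (Pf : Embedded f) where
    f-p₀ = proj₁ Pf
    f-injective = proj₁ (proj₂ (proj₂ (proj₂ Pf)))
    f-edges = proj₂ (proj₂ (proj₂ (proj₂ Pf)))

    f-coclass : ∀ {x} → coclass x ≡ true → U₂ (f x) ≡ true
    f-coclass {x} c = case x ≟ᶠ p₀ of λ
      { (yes refl) → subst (λ h → U₂ h ≡ true) (sym f-p₀) y₀∈U₂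
      ; (no ne) → ∧₁ (subst (λ i → V i (f x) ≡ true) (false-intro {class x} (not-elim c))
          (proj₁ (proj₂ (proj₂ Pf)) x (coclass-D c) ne ne)) }

    f≢x₀ : ∀ {x} → D x ≡ true → f x ≢ x₀
    f≢x₀ {x} d eq = case x ≟ᶠ p₀ of λ
      { (yes refl) → x₀≢y₀ (trans (sym eq) f-p₀)
      ; (no ne) → absurd (class x) (proj₁ (proj₂ (proj₂ Pf)) x d ne ne) }
      where
      absurd : ∀ i → ¬ (V i (f x) ≡ true)
      absurd true  v = not-elim (∧₂ {U₁ (f x)} v) (∨₁ (⌊⌋-intro (f x ≟ᶠ x₀) eq))
      absurd false v = not-elim (∧₂ {U₂ (f x)} v) (∨₁ (⌊⌋-intro (f x ≟ᶠ x₀) eq))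

    I : Fin n → Bool
    I x = slot x ∧ not (x == ℓ₀)

    A' : Fin N → Bool
    A' h = A h ∧ not (image f D h)

    good : Fin N → Fin n → Bool
    good h p = colour G h (f p) ==ᶜ χ

    ok : Fin n → Fin N → Bool
    ok i h = free (λ p → not (good h p)) i

    ok-elim : ∀ {i h} → ok i h ≡ true → ∀ p → adj T i p ≡ true → colour G h (f p) ≡ χ
    ok-elim {i} {h} o p ip with truth (good h p)
    ... | inj₁ g = ==ᶜ-elim _ _ g
    ... | inj₂ g = ⊥-elim (free-elim {λ q → not (good h q)} o p g ip)

    -- N is less than 2t₁ + e, and each of the two sets has at least t₁ - e vertices.
    outside : count (λ h → not (U₁ h) ∧ not (U₂ h)) ≤ e * 3
    outside = linear (count U₁ ∷ count (not ∘ U₁) ∷ N ∷ count (λ h → not (U₁ h) ∧ U₂ h) ∷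
      count (λ h → not (U₁ h) ∧ not (U₂ h)) ∷ count U₂ ∷ t₁ ∷ e ∷ []) (
      1 ⋆ ‵ 0 ⊕ ‵ 1 ⊑ ‵ 2 by ≤-reflexive (count-not U₁) ∙
      1 ⋆ ‵ 3 ⊕ ‵ 4 ⊑ ‵ 1 by ≤-reflexive (sym (count-split (not ∘ U₁) U₂)) ∙
      1 ⋆ ‵ 5 ⊑ ‵ 3 by count-mono U₂ (λ h → not (U₁ h) ∧ U₂ h) (λ h q → both (not-intro (λ q' → disjoint h q' q))
          q) ∙
      1 ⋆ ‵ 2 ⊕ κ 1 ⊑ 2 ⊛ ‵ 6 ⊕ ‵ 7 by below ∙ 1 ⋆ ‵ 6 ⊑ ‵ 0 ⊕ ‵ 7 by large₁ ∙ 1 ⋆ ‵ 6 ⊑ ‵ 5 ⊕ ‵ 7 by large₂ ∙ end)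
      1 (‵ 4) (3 ⊛ ‵ 7)

    -- At most e misses in U₁ and 3e outside both sets; there are none in U₂, which A avoids.
    missed : ∀ {p} → coclass p ≡ true → count (λ h → A h ∧ not (good h p)) ≤ e * 4
    missed {p} c = linear (count (λ h → A h ∧ not (good h p)) ∷ deg G (other χ) (f p) U₁ ∷
      count (λ h → not (U₁ h) ∧ not (U₂ h)) ∷ e ∷ []) (
      1 ⋆ ‵ 0 ⊑ ‵ 1 ⊕ ‵ 2 by count-cover (λ h → A h ∧ not (good h p)) (λ h → U₁ h ∧ miss G χ (f p) h)
          (λ h → not (U₁ h) ∧ not (U₂ h)) cases ∙
      1 ⋆ ‵ 1 ⊑ ‵ 3 by proj₂ (sparse₂ (f p) (f-coclass c)) ∙ 1 ⋆ ‵ 2 ⊑ 3 ⊛ ‵ 3 by outside ∙ end) 1 (‵ 0) (4 ⊛ ‵ 3)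
      where
      cases : ∀ h → A h ∧ not (good h p) ≡ true → U₁ h ∧ miss G χ (f p) h ≡ true ⊎ not (U₁ h) ∧ not (U₂ h) ≡ true
      cases h q with truth (U₁ h)
      ... | inj₂ u = inj₂ (both u (not-intro (A∉U₂ (∧₁ q))))
      ... | inj₁ u = inj₁ (both u (both
          (not-intro (λ eq → disjoint h u (subst (λ v → U₂ v ≡ true) (sym (==-elim {i = h} eq)) (f-coclass c))))
          (subst (λ d → (d ==ᶜ other χ) ≡ true)
              (sym (trans (colour-sym G (f p) h) (not-this _ χ (not-elim (∧₂ {A h} q))))) (==ᶜ-refl (other χ)))))

    few-bad : ∀ i → I i ≡ true → count (λ h → A' h ∧ not (ok i h)) ≤ e * 256
    few-bad i Ii = begin
      count (λ h → A' h ∧ not (ok i h))                              ≡⟨ count≡∑ (λ h → A' h ∧ not (ok i h)) ⟩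
      ∑ (λ h → bit (A' h ∧ not (ok i h)))                            ≤⟨ ∑-mono hit ⟩
      ∑ (λ h → ∑ (λ p → bit (adj T i p ∧ (A h ∧ not (good h p)))))   ≡⟨ ∑-swap
          (λ h p → bit (adj T i p ∧ (A h ∧ not (good h p)))) ⟩
      ∑ (λ p → ∑ (λ h → bit (adj T i p ∧ (A h ∧ not (good h p)))))   ≡⟨ ∑-cong row ⟩
      wsum (adj T i) (λ p → count (λ h → A h ∧ not (good h p)))
        ≤⟨ wsum-bound (adj T i) (λ p → count (λ h → A h ∧ not (good h p))) (e * 4)
            (λ p ip → missed (opposite ip (∧₁ (∧₁ Ii)))) ⟩
      degree T i * (e * 4)                                           ≤⟨ *-monoˡ-≤ (e * 4)
          (⌊⌋-elim (degree T i ≤? 64) (∧₂ {class i} (∧₁ Ii))) ⟩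
      64 * (e * 4)                                                   ≡⟨ *-comm 64 (e * 4) ⟩
      e * 4 * 64                                                     ≡⟨ *-assoc e 4 64 ⟩
      e * 256                                                        ∎
      where
      open ≤-Reasoning
      row : ∀ p → ∑ (λ h → bit (adj T i p ∧ (A h ∧ not (good h p)))) ≡
          (if adj T i p then count (λ h → A h ∧ not (good h p)) else 0)
      row p with adj T i p
      ... | true  = sym (count≡∑ (λ h → A h ∧ not (good h p)))
      ... | false = trans (∑-const N 0) (*-zeroʳ N)
      hit : ∀ h → bit (A' h ∧ not (ok i h)) ≤ ∑ (λ p → bit (adj T i p ∧ (A h ∧ not (good h p))))
      hit h with truth (A' h ∧ not (ok i h))
      ... | inj₂ q = ≤-trans (≤-reflexive (cong bit (false-intro (not-elim q)))) z≤n
      ... | inj₁ q with ⌊⌋-elim (any? (λ p → (not (good h p) ≟ᵇ true) ×-dec (adj T i p ≟ᵇ true)))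
                          (trans (sym (not-involutive _)) (∧₂ {A' h} q))
      ...   | p , g , ip = ≤-trans (bit-mono {b = adj T i p ∧ (A h ∧ not (good h p))}
          (λ _ → both ip (both (∧₁ (∧₁ q)) g)))
                (∑-point (λ p → bit (adj T i p ∧ (A h ∧ not (good h p)))) p)

    -- The vertices of the smaller class whose images h misses are fewer than k, so `robust` leaves
    -- n/50 slots. That is at least 400e, and more than 256e even without `ℓ₀`.
    many-ok : ∀ h → A' h ≡ true → e * 256 < count (λ i → I i ∧ ok i h)
    many-ok h a = linear (n ∷ count (λ i → slot i ∧ free Q i) ∷ count (_== ℓ₀) ∷ count (λ i → I i ∧ ok i h) ∷ e ∷
      []) (1 ⋆ ‵ 0 ⊑ 50 ⊛ ‵ 1 by robust Q (≤-<-trans few (almost h (∧₁ a))) ∙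
      50 ⋆ ‵ 1 ⊑ ‵ 2 ⊕ ‵ 3 by count-cover (λ i → slot i ∧ free Q i) (_== ℓ₀) (λ i → I i ∧ ok i h) cases ∙
      50 ⋆ ‵ 2 ⊑ κ 1 by count-== ℓ₀ ∙ 1 ⋆ 20000 ⊛ ‵ 4 ⊑ ‵ 0 by tiny ∙ 7200 ⋆ κ 10 ⊑ ‵ 4 by 10≤e ∙ end)
      50 (κ 1 ⊕ 256 ⊛ ‵ 4) (‵ 3)
      where
      Q : Fin n → Bool
      Q p = coclass p ∧ not (good h p)
      few : count Q ≤ deg G (other χ) h U₂
      few = count-injection Q (λ w → U₂ w ∧ miss G χ h w) f
        (λ p q → both (f-coclass (∧₁ q))
            (both (not-intro (λ eq → A∉U₂ (∧₁ a) (subst (λ v → U₂ v ≡ true) (==-elim {i = f p} eq)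
            (f-coclass (∧₁ q)))))
          (subst (λ d → (d ==ᶜ other χ) ≡ true) (sym (not-this _ χ (not-elim (∧₂ {coclass p} q))))
              (==ᶜ-refl (other χ)))))
        (λ p q p' q' → f-injective p q (coclass-D (∧₁ p')) (coclass-D (∧₁ q')))
      cases : ∀ i → slot i ∧ free Q i ≡ true → i == ℓ₀ ≡ true ⊎ I i ∧ ok i h ≡ true
      cases i q with truth (i == ℓ₀)
      ... | inj₁ eq = inj₁ eq
      ... | inj₂ ne = inj₂ (both (both (∧₁ q) ne) (free-intro (λ p g ip →
            free-elim {Q} (∧₂ {slot i} q) p (both (opposite ip (∧₁ (∧₁ q))) g) ip)))

    -- Setting `ℓ₀` aside makes up for the one vertex that A may lack. Only non-slots of the larger
    -- class can have used vertices of A, the others having gone to U₂.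
    fits : count I ≤ count A'
    fits = linear (count (λ x → slot x ∧ (x == ℓ₀)) ∷ count I ∷ count slot ∷ count A ∷
      count (λ h → A h ∧ image f D h) ∷ count A' ∷ count (λ x → D x ∧ class x) ∷ t₁ ∷ []) (
      1 ⋆ ‵ 0 ⊕ ‵ 1 ⊑ ‵ 2 by ≤-reflexive (sym (count-split slot (_== ℓ₀))) ∙
      1 ⋆ κ 1 ⊑ ‵ 0 by count-point (λ x → slot x ∧ (x == ℓ₀)) {ℓ₀} (both ℓ₀-slot (==-refl ℓ₀)) ∙
      1 ⋆ ‵ 3 ⊑ ‵ 4 ⊕ ‵ 5 by ≤-reflexive (count-split A (image f D)) ∙
      1 ⋆ ‵ 4 ⊑ ‵ 6 by image-count f D (λ x → D x ∧ class x) A hosts ∙ 1 ⋆ ‵ 6 ⊕ ‵ 2 ⊑ ‵ 7 by residual ∙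
      1 ⋆ ‵ 7 ⊑ ‵ 3 ⊕ κ 1 by enough ∙ end) 1 (‵ 1) (‵ 5)
      where
      ℓ₀-slot : slot ℓ₀ ≡ true
      ℓ₀-slot = both ℓ₀-class (⌊⌋-intro (degree T ℓ₀ ≤? 64) (≤-trans (≤-trans (count-mono (adj T ℓ₀) (_== p₀)
        (λ q h → ⌊⌋-intro (q ≟ᶠ p₀) (only q h))) (count-== p₀)) (s≤s z≤n)))
      hosts : ∀ x → D x ≡ true → A (f x) ≡ true → D x ∧ class x ≡ true
      hosts x d a with truth (class x)
      ... | inj₁ c = both d c
      ... | inj₂ c = ⊥-elim (A∉U₂ a (f-coclass c))

    Placed : (Fin n → Fin N) → Set
    Placed g = (∀ i → I i ≡ true → A' (g i) ≡ true) × (∀ i → I i ≡ true → ok i (g i) ≡ true) ×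
      (∀ i j → I i ≡ true → I j ≡ true → g i ≡ g j → i ≡ j)

    module Merge (g : Fin n → Fin N) (Pg : Placed g) where
      F : Fin n → Fin N
      F x = if x == ℓ₀ then x₀ else if slot x then g x else f x

      data Kind (x : Fin n) : Set where
        leaf′  : x ≡ ℓ₀ → F x ≡ x₀ → Kind x
        slot′  : I x ≡ true → F x ≡ g x → Kind x
        other′ : D x ≡ true → F x ≡ f x → Kind x

      kind : ∀ x → Kind x
      kind x = go (truth (x == ℓ₀)) (truth (slot x))
        where
        pick₁ : ∀ {b c} {u v w : Fin N} → b ≡ true → (if b then u else if c then v else w) ≡ u
        pick₁ refl = refl
        pick₂ : ∀ {b c} {u v w : Fin N} → not b ≡ true → c ≡ true → (if b then u else if c then v else w) ≡ v
        pick₂ {false} _ refl = refl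
        pick₃ : ∀ {b c} {u v w : Fin N} → not b ≡ true → not c ≡ true → (if b then u else if c then v else w) ≡ w
        pick₃ {false} {false} _ _ = refl
        go : x == ℓ₀ ≡ true ⊎ not (x == ℓ₀) ≡ true → slot x ≡ true ⊎ not (slot x) ≡ true → Kind x
        go (inj₁ eq) _        = leaf′ (==-elim eq) (pick₁ {c = slot x} eq)
        go (inj₂ ne) (inj₁ s) = slot′ (both s ne) (pick₂ ne s)
        go (inj₂ ne) (inj₂ d) = other′ d (pick₃ ne d)

      g∈A : ∀ {i} → I i ≡ true → A (g i) ≡ true
      g∈A Ii = ∧₁ (proj₁ Pg _ Ii)

      g≢f : ∀ {i x} → I i ≡ true → D x ≡ true → g i ≢ f x
      g≢f {i} {x} Ii d eq = not-elim (∧₂ {A (g i)} (proj₁ Pg i Ii)) (subst (λ v → image f D v ≡ true) (sym eq)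
          (image⇐ f D d))

      F-injective : ∀ {x y} → F x ≡ F y → x ≡ y
      F-injective {x} {y} eq = go (kind x) (kind y)
        where
        go : Kind x → Kind y → x ≡ y
        go (leaf′ a _)  (leaf′ b _)  = trans a (sym b)
        go (leaf′ _ p)  (slot′ b q)  = ⊥-elim (x₀∉A (subst (λ v → A v ≡ true) (trans (sym q) (trans (sym eq) p))
            (g∈A b)))
        go (leaf′ _ p)  (other′ d q) = ⊥-elim (f≢x₀ d (trans (sym q) (trans (sym eq) p)))
        go (slot′ a p)  (leaf′ _ q)  = ⊥-elim (x₀∉A (subst (λ v → A v ≡ true) (trans (sym p) (trans eq q)) (g∈A a)))
        go (slot′ a p)  (slot′ b q)  = proj₂ (proj₂ Pg) x y a b (trans (sym p) (trans eq q))
        go (slot′ a p)  (other′ d q) = ⊥-elim (g≢f a d (trans (sym p) (trans eq q)))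
        go (other′ d p) (leaf′ _ q)  = ⊥-elim (f≢x₀ d (trans (sym p) (trans eq q)))
        go (other′ d p) (slot′ b q)  = ⊥-elim (g≢f b d (trans (sym q) (trans (sym eq) p)))
        go (other′ d p) (other′ d' q) = f-injective x y d d' (trans (sym p) (trans eq q))

      F-coclass : ∀ {x} → coclass x ≡ true → F x ≡ f x
      F-coclass {x} c = go (kind x)
        where
        go : Kind x → F x ≡ f x
        go (leaf′ refl _) = ⊥-elim (not-elim c ℓ₀-class)
        go (slot′ a _)    = ⊥-elim (not-elim c (∧₁ (∧₁ a)))
        go (other′ _ q)   = q

      from-class : ∀ x y → adj T x y ≡ true → class x ≡ true → colour G (F x) (F y) ≡ χ
      from-class x y xy c = go (kind x)
        where
        y-coclass = opposite xy c
        go : Kind x → colour G (F x) (F y) ≡ χ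
        go (leaf′ refl p) = trans (cong₂ (colour G) p (trans (F-coclass y-coclass) (trans (cong f (only y xy))
            f-p₀))) x₀y₀
        go (slot′ a p)    = trans (cong₂ (colour G) p (F-coclass y-coclass)) (ok-elim (proj₁ (proj₂ Pg) x a) y xy)
        go (other′ d p)   = trans (cong₂ (colour G) p (F-coclass y-coclass)) (f-edges x y d (coclass-D y-coclass)
            xy)

      copy : HasMonochromaticCopy G T
      copy = χ , F , F-injective , λ x y xy → case truth (class x) of λ
        { (inj₁ c) → from-class x y xy c
        ; (inj₂ c) → trans (colour-sym G (F x) (F y)) (from-class y x (trans (adj-sym T y x) xy)
            (trans (alternate y x (trans (adj-sym T y x) xy)) c)) }

    complete : HasMonochromaticCopy G T
    complete = case assign I A' ok (e * 256) few-bad many-ok fits (λ _ → x₀) of λ { (g , Pg) → Merge.copy g Pg }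

  spanning-copy : HasMonochromaticCopy G T
  spanning-copy = case partial-copy of λ { (f , Pf) → Complete.complete f Pf }

-- Embedding a cut tree

module _ {n N} {T : SimpleGraph n} {e} {B : Bipartition T e} {G : ColouredKN N} {χ U₁ U₂} (S : Setting B G χ U₁ U₂)
    where
  open Setting S

  few₁⇒∉U₂ : ∀ x → deg G χ x U₁ ≤ e → ¬ (U₂ x ≡ true)
  few₁⇒∉U₂ x few u = linear-absurd (deg G χ x U₁ ∷ e ∷ deg G (other χ) x U₁ ∷ count U₁ ∷ t₁ ∷ n ∷ t₂ ∷ []) (
    3 ⋆ ‵ 0 ⊑ ‵ 1 by few ∙ 3 ⋆ ‵ 2 ⊑ ‵ 1 by proj₂ (sparse₂ x u) ∙ 3 ⋆ ‵ 3 ⊑ ‵ 0 ⊕ ‵ 2 ⊕ κ 1 by deg-total G χ x U₁ ∙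
    3 ⋆ ‵ 4 ⊑ ‵ 3 ⊕ ‵ 1 by large₁ ∙ 2 ⋆ ‵ 5 ⊑ ‵ 4 ⊕ ‵ 6 by ≤-reflexive (sym total) ∙
    1 ⋆ 2 ⊛ ‵ 6 ⊑ ‵ 4 ⊕ ‵ 1 by unbalanced ∙ 2 ⋆ 20000 ⊛ ‵ 1 ⊑ ‵ 5 by tiny ∙ 39990 ⋆ κ 10 ⊑ ‵ 1 by 10≤e ∙ end)

  -- In colour `other χ` both U₁ and U₂ are nearly complete. The part given by `side` goes to U₂,
  -- the rest to U₁. The two hosts miss little of U₁, and towards U₂ they need edges only for the
  -- ports, of which there are at most k.
  module Separated (cut : Cut B) (ha hb : Fin N) (a≡b→ : Cut.a cut ≡ Cut.b cut → ha ≡ hb)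
      (a≢b→ : Cut.a cut ≢ Cut.b cut → ha ≢ hb)
    (few-a : deg G χ ha U₁ ≤ e) (few-b : deg G χ hb U₁ ≤ e)
    (many-a : Cut.k cut ≤ deg G (other χ) ha U₂) (many-b : Cut.k cut ≤ deg G (other χ) hb U₂) where
    open Cut cut

    V : Bool → Fin N → Bool
    V i h = (if i then U₂ h else U₁ h) ∧ not ((h == ha) ∨ (h == hb))

    trimmed : ∀ (U : Fin N → Bool) → count U ≤ count (λ h → U h ∧ not ((h == ha) ∨ (h == hb))) + 2
    trimmed U = linear (count U ∷ count (λ h → U h ∧ ((h == ha) ∨ (h == hb))) ∷
      count (λ h → U h ∧ not ((h == ha) ∨ (h == hb))) ∷ count (_== ha) ∷ count (_== hb) ∷ []) (
      1 ⋆ ‵ 0 ⊑ ‵ 1 ⊕ ‵ 2 by ≤-reflexive (count-split U (λ h → (h == ha) ∨ (h == hb))) ∙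
      1 ⋆ ‵ 1 ⊑ ‵ 3 ⊕ ‵ 4 by count-cover (λ h → U h ∧ ((h == ha) ∨ (h == hb))) (_== ha) (_== hb)
          (λ h q → ∨-elim (∧₂ {U h} q)) ∙
      1 ⋆ ‵ 3 ⊑ κ 1 by count-== ha ∙ 1 ⋆ ‵ 4 ⊑ κ 1 by count-== hb ∙ end) 1 (‵ 0) (‵ 2 ⊕ κ 2)

    port : Fin n → Bool
    port x = side x ∧ (adj T a x ∨ adj T b x)

    V-sparse : ∀ i h → V i h ≡ true → deg G (other (other χ)) h (V i) ≤ e
    V-sparse true  h v = subst (λ c → deg G c h (V true) ≤ e) (sym (other-other χ))
      (≤-trans (deg-mono G χ h {V true} {U₂} (λ x → ∧₁)) (proj₁ (sparse₂ h (∧₁ v))))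
    V-sparse false h v = subst (λ c → deg G c h (V false) ≤ e) (sym (other-other χ))
      (≤-trans (deg-mono G χ h {V false} {U₁} (λ x → ∧₁)) (proj₁ (sparse₁ h (∧₁ v))))

    same-side : ∀ x y → adj T x y ≡ true → x ≢ a → x ≢ b → y ≢ a → y ≢ b → side x ≡ side y
    same-side x y xy xa xb ya yb with truth (side x) | truth (side y)
    ... | inj₁ p | inj₁ q = trans p (sym q)
    ... | inj₂ p | inj₂ q = trans (false-intro (not-elim p)) (sym (false-intro (not-elim q)))
    ... | inj₁ p | inj₂ q = [ (λ eq → ⊥-elim (ya eq)) , (λ eq → ⊥-elim (yb eq)) ]′ (crossing x y xy p (not-elim q))
    ... | inj₂ p | inj₁ q = [ (λ eq → ⊥-elim (xa eq)) , (λ eq → ⊥-elim (xb eq)) ]′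
        (crossing y x (trans (adj-sym T y x) xy) q (not-elim p))

    separated-copy : HasMonochromaticCopy G T
    separated-copy = from (embed (rooted a) G (other χ) b ha hb a≡b→ a≢b→ a≁b (λ _ → true) port side refl refl V
        (λ h p q → disjoint h (∧₁ q) (∧₁ p))
        (λ i v → not-elim (∧₂ {if i then U₂ ha else U₁ ha} v) (∨₁ (==-refl ha)))
        (λ i v → not-elim (∧₂ {if i then U₂ hb else U₁ hb} v) (∨₂ {hb == ha} (==-refl hb)))
        e (λ x p → ∨-elim (∧₂ {side x} p))
        (λ x y p q → ports-apart x y (∧₁ p) (∧₂ {side x} p) (∧₁ q) (∧₂ {side y} q))
        port-room
        (λ x y xy _ _ xa xb ya yb h v → subst (λ i → deg G (other (other χ)) h (V i) ≤ e)
            (same-side x y xy xa xb ya yb)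
          (V-sparse (side x) h v))
        (λ w _ np aw → from-special few-a w np (∨₁ aw)) (λ w _ np bw → from-special few-b w np (∨₂ {adj T a w} bw))
            room)
      where
      from : (∃ λ f → f a ≡ ha × f b ≡ hb × (∀ x → true ≡ true → x ≢ a → x ≢ b → V (side x) (f x) ≡ true) ×
        (∀ x y → true ≡ true → true ≡ true → f x ≡ f y → x ≡ y) ×
        (∀ x y → true ≡ true → true ≡ true → adj T x y ≡ true → colour G (f x) (f y) ≡ other χ)) →
            HasMonochromaticCopy G T
      from (f , _ , _ , _ , injective , edges) = other χ , f , (λ {x} {y} → injective x y refl refl) , λ x y → edges
          x y refl refl
      port-room : ∀ w → true ≡ true → port w ≡ true → count (λ x → port x ∧ same (side x) (side w)) ≤
        count (λ h → V (side w) h ∧ implies (adj T a w) (colour G ha h ==ᶜ other χ) ∧ implies (adj T b w)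
            (colour G hb h ==ᶜ other χ))
      port-room w _ p = ≤-trans (count-mono (λ x → port x ∧ same (side x) (side w)) port (λ x → ∧₁)) (≤-trans ports
        (subst (λ i → k ≤ count (λ h → V i h ∧ implies (adj T a w) (colour G ha h ==ᶜ other χ) ∧ implies (adj T b w)
            (colour G hb h ==ᶜ other χ)))
          (sym (∧₁ {side w} p)) ([ via-a , via-b ]′ (∨-elim (∧₂ {side w} p)))))
        where
        outside : ∀ {h} → U₂ h ≡ true → V true h ≡ true
        outside {h} u = both u (not-intro
            (λ q → [ (λ eq → few₁⇒∉U₂ ha few-a (subst (λ v → U₂ v ≡ true) (==-elim {i = h} eq) u)) ,
          (λ eq → few₁⇒∉U₂ hb few-b (subst (λ v → U₂ v ≡ true) (==-elim {i = h} eq) u)) ]′ (∨-elim {h == ha} q)))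
        allowed : Fin N → Bool
        allowed h = V true h ∧ implies (adj T a w) (colour G ha h ==ᶜ other χ) ∧ implies (adj T b w)
            (colour G hb h ==ᶜ other χ)
        -- A port that is also adjacent to b forces a ≡ b, hence equal hosts, and the second
        -- condition repeats the first.
        via-a : adj T a w ≡ true → k ≤ count allowed
        via-a aw = ≤-trans many-a (count-mono (λ h → U₂ h ∧ not ⌊ h ≟ᶠ ha ⌋ ∧ (colour G ha h ==ᶜ other χ)) allowed
          (λ h q → both (outside (∧₁ q)) (both (implies-intro (λ _ → ∧₂ {not (h == ha)} (∧₂ {U₂ h} q)))
            (implies-intro (λ bw → subst (λ v → (colour G v h ==ᶜ other χ) ≡ true) (a≡b→ (port-once w (∧₁ p) aw bw))
              (∧₂ {not (h == ha)} (∧₂ {U₂ h} q)))))))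
        via-b : adj T b w ≡ true → k ≤ count allowed
        via-b bw = ≤-trans many-b (count-mono (λ h → U₂ h ∧ not ⌊ h ≟ᶠ hb ⌋ ∧ (colour G hb h ==ᶜ other χ)) allowed
          (λ h q → both (outside (∧₁ q)) (both
            (implies-intro (λ aw → subst (λ v → (colour G v h ==ᶜ other χ) ≡ true)
                (sym (a≡b→ (port-once w (∧₁ p) aw bw)))
              (∧₂ {not (h == hb)} (∧₂ {U₂ h} q))))
            (implies-intro (λ _ → ∧₂ {not (h == hb)} (∧₂ {U₂ h} q))))))
      from-special : ∀ {h} → deg G χ h U₁ ≤ e → ∀ w → ¬ (port w ≡ true) → adj T a w ∨ adj T b w ≡ true →
        deg G (other (other χ)) h (V (side w)) ≤ e
      from-special {h} few w np aw = subst₂ (λ c i → deg G c h (V i) ≤ e) (sym (other-other χ))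
        (sym (false-intro {side w} (λ s → np (both s aw))))
        (≤-trans (deg-mono G χ h {V false} {U₁} (λ x → ∧₁)) few)
      room : ∀ i → count (λ x → true ∧ same (side x) i) + e * 2 ≤ count (V i)
      room true = linear (count (λ x → true ∧ same (side x) true) ∷ count side ∷ n ∷ count U₂ ∷ count (V true) ∷
        t₁ ∷ e ∷ t₂ ∷ []) (
        3000 ⋆ ‵ 0 ⊑ ‵ 1 by count-mono (λ x → true ∧ same (side x) true) side (λ x h → ⌊⌋-elim (side x ≟ᵇ true) h) ∙
        3 ⋆ 1000 ⊛ ‵ 1 ⊑ 665 ⊛ ‵ 2 ⊕ κ 1000 by part ∙ 3000 ⋆ ‵ 3 ⊑ ‵ 4 ⊕ κ 2 by trimmed U₂ ∙
        3000 ⋆ ‵ 5 ⊑ ‵ 3 ⊕ ‵ 6 by large₂ ∙ 2000 ⋆ ‵ 2 ⊑ ‵ 5 ⊕ ‵ 7 by ≤-reflexive (sym total) ∙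
        1000 ⋆ 2 ⊛ ‵ 7 ⊑ ‵ 5 ⊕ ‵ 6 by unbalanced ∙ 5 ⋆ 20000 ⊛ ‵ 6 ⊑ ‵ 2 by tiny ∙ 90000 ⋆ κ 10 ⊑ ‵ 6 by 10≤e ∙ end)
        3000 (‵ 0 ⊕ 2 ⊛ ‵ 6) (‵ 4)
      room false = linear (count (λ x → true ∧ same (side x) false) ∷ count (not ∘ side) ∷ n ∷ count U₁ ∷
        count (V false) ∷ t₁ ∷ e ∷ t₂ ∷ []) (
        3000 ⋆ ‵ 0 ⊑ ‵ 1 by count-mono (λ x → true ∧ same (side x) false) (not ∘ side)
            (λ x h → cong not (⌊⌋-elim (side x ≟ᵇ false) h)) ∙
        3 ⋆ 1000 ⊛ ‵ 1 ⊑ 665 ⊛ ‵ 2 ⊕ κ 1000 by copart ∙ 3000 ⋆ ‵ 3 ⊑ ‵ 4 ⊕ κ 2 by trimmed U₁ ∙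
        3000 ⋆ ‵ 5 ⊑ ‵ 3 ⊕ ‵ 6 by large₁ ∙ 2000 ⋆ ‵ 2 ⊑ ‵ 5 ⊕ ‵ 7 by ≤-reflexive (sym total) ∙
        1000 ⋆ 2 ⊛ ‵ 7 ⊑ ‵ 5 ⊕ ‵ 6 by unbalanced ∙ 5 ⋆ 20000 ⊛ ‵ 6 ⊑ ‵ 2 by tiny ∙ 90000 ⋆ κ 10 ⊑ ‵ 6 by 10≤e ∙ end)
        3000 (‵ 0 ⊕ 2 ⊛ ‵ 6) (‵ 4)

  -- Exchanging the two classes of the tree on S, which hangs off c, makes both sides fit with room to spare.
  record Exchange : Set where
    field
      c          : Fin n
      part       : Fin n → Bool
      c∉         : ¬ (part c ≡ true)
      attached   : ∀ x y → adj T x y ≡ true → part x ≡ true → ¬ (part y ≡ true) → y ≡ c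
      surplus    : count (λ x → part x ∧ coclass x) + e * 5 ≤ count (λ x → part x ∧ class x)
      moderate   : count (λ x → part x ∧ class x) * 2 + t₂ ≤ count (λ x → part x ∧ coclass x) * 2 + e * 10 + t₁

  -- Let the excess of a subtree be its surplus of `class` over `coclass`. A smallest subtree with
  -- excess at least (t₁ - t₂)/2 is taken; its child subtrees have less. A cheapest set of those
  -- with total excess at least 5e therefore stays below 5e + (t₁ - t₂)/2, which is `moderate`.
  exchange : Fin n → Exchange
  exchange r = from (argmin size lopsided {r} (⌊⌋-intro (_ ≤? _) (linear (t₁ ∷ weight class r ∷ weight coclass r ∷
    t₂ ∷ e ∷ n ∷ []) (60000 ⋆ ‵ 0 ⊑ ‵ 1 by ≤-reflexive (full class) ∙
    79998 ⋆ ‵ 2 ⊑ ‵ 3 by ≤-reflexive (sym (full coclass)) ∙ 20000 ⋆ 2 ⊛ ‵ 3 ⊑ ‵ 0 ⊕ ‵ 4 by unbalanced ∙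
    1 ⋆ ‵ 5 ⊑ ‵ 0 ⊕ ‵ 3 by ≤-reflexive (sym total) ∙ 1 ⋆ 20000 ⊛ ‵ 4 ⊑ ‵ 5 by tiny ∙ end)
    39999 (2 ⊛ ‵ 2 ⊕ ‵ 0) (2 ⊛ ‵ 1 ⊕ ‵ 3))))
    where
    open Subtrees (rooted r)
    full : ∀ P → count P ≡ weight P r
    full P = ≤-antisym (count-mono P (λ x → sub r x ∧ P x) (λ x p → both (sub⇐ (root-⊑ x)) p))
      (count-mono (λ x → sub r x ∧ P x) P (λ x → ∧₂ {sub r x}))
    lopsided : Fin n → Bool
    lopsided w = ⌊ weight coclass w * 2 + t₁ ≤? weight class w * 2 + t₂ ⌋
    gain : Fin n → ℕ
    gain z = weight class z ∸ weight coclass z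
    from : (∃ λ w → lopsided w ≡ true × (∀ z → lopsided z ≡ true → size w ≤ size z)) → Exchange
    from (w , lw , low) = build (cheapest C gain (e * 5) enough)
      where
      C : Fin n → Bool
      C z = child w z ∧ ⌊ weight coclass z ≤? weight class z ⌋
      gain-eq : ∀ z → C z ≡ true → weight coclass z + gain z ≡ weight class z
      gain-eq z h = m+[n∸m]≡n (⌊⌋-elim (weight coclass z ≤? weight class z) (∧₂ {child w z} h))
      wsum-+ : ∀ H (f g : Fin n → ℕ) → wsum H (λ z → f z + g z) ≡ wsum H f + wsum H g
      wsum-+ H f g = trans (∑-cong (λ z → one (H z) (f z) (g z))) (∑-+ (λ z → if H z then f z else 0)
          (λ z → if H z then g z else 0))
        where
        one : ∀ b x y → (if b then x + y else 0) ≡ (if b then x else 0) + (if b then y else 0)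
        one true  x y = refl
        one false x y = refl
      -- Up to the vertex w itself, the children inherit the excess of w, which is about n/6 or
      -- more; children with negative excess only help.
      enough : e * 5 ≤ wsum C gain
      enough = linear (weight class w ∷ bit (class w) ∷ wsum (child w) (weight class) ∷ bit (coclass w) ∷
        wsum (child w) (weight coclass) ∷ weight coclass w ∷ t₁ ∷ t₂ ∷
        wsum (child w) (λ z → weight coclass z + gain z) ∷ wsum (child w) gain ∷ wsum C gain ∷
        wsum (λ z → child w z ∧ not ⌊ weight coclass z ≤? weight class z ⌋) gain ∷
        count (λ z → child w z ∧ not ⌊ weight coclass z ≤? weight class z ⌋) * 0 ∷ e ∷ n ∷ []) (
        6 ⋆ ‵ 0 ⊑ ‵ 1 ⊕ ‵ 2 by weight-children class w ∙ 6 ⋆ ‵ 1 ⊑ κ 1 by bit≤1 (class w) ∙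
        6 ⋆ ‵ 3 ⊕ ‵ 4 ⊑ ‵ 5 by wsum-children≤ coclass w ∙
        3 ⋆ 2 ⊛ ‵ 5 ⊕ ‵ 6 ⊑ 2 ⊛ ‵ 0 ⊕ ‵ 7 by ⌊⌋-elim (weight coclass w * 2 + t₁ ≤? weight class w * 2 + t₂) lw ∙
        6 ⋆ ‵ 2 ⊑ ‵ 8 by wsum-mono {H = child w} {child w} {weight class} {λ z → weight coclass z + gain z}
            (λ z h → h) (λ z _ → m≤n+m∸n (weight class z) (weight coclass z)) ∙
        6 ⋆ ‵ 8 ⊑ ‵ 4 ⊕ ‵ 9 by ≤-reflexive (wsum-+ (child w) (weight coclass) gain) ∙
        6 ⋆ ‵ 9 ⊑ ‵ 10 ⊕ ‵ 11 by ≤-reflexive (wsum-split (child w) (λ z → ⌊ weight coclass z ≤? weight class z ⌋)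
            gain) ∙
        6 ⋆ ‵ 11 ⊑ ‵ 12 by wsum-bound (λ z → child w z ∧ not ⌊ weight coclass z ≤? weight class z ⌋) gain 0
            (λ z h → ≤-reflexive (m≤n⇒m∸n≡0
            (<⇒≤ (≰⇒> (λ le → not-elim (∧₂ {child w z} h) (⌊⌋-intro (weight coclass z ≤? weight class z) le)))))) ∙
        6 ⋆ ‵ 12 ⊑ κ 0 by ≤-reflexive (*-zeroʳ (count (λ z → child w z ∧ not ⌊ weight coclass z ≤? weight class z
            ⌋))) ∙
        2 ⋆ 2 ⊛ ‵ 7 ⊑ ‵ 6 ⊕ ‵ 13 by unbalanced ∙ 1 ⋆ ‵ 14 ⊑ ‵ 6 ⊕ ‵ 7 by ≤-reflexive (sym total) ∙
        1 ⋆ 20000 ⊛ ‵ 13 ⊑ ‵ 14 by tiny ∙ 19968 ⋆ κ 10 ⊑ ‵ 13 by 10≤e ∙ end) 6 (5 ⊛ ‵ 13) (‵ 10)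
      build : Cheapest C gain (e * 5) → Exchange
      build H = record
        { c = w ; part = union set ; c∉ = c∉ ; attached = attached
        ; surplus = linear (wsum set (weight class) ∷ count (λ x → union set x ∧ class x) ∷
          count (λ x → union set x ∧ coclass x) ∷ wsum set (weight coclass) ∷ wsum set gain ∷ e ∷ []) (
          1 ⋆ ‵ 0 ⊑ ‵ 1 by ≤-reflexive (sym (union-weight set class set-disjoint)) ∙
          1 ⋆ ‵ 2 ⊑ ‵ 3 by ≤-reflexive (union-weight set coclass set-disjoint) ∙
          1 ⋆ ‵ 3 ⊕ ‵ 4 ⊑ ‵ 0 by ≤-reflexive balance ∙ 1 ⋆ 5 ⊛ ‵ 5 ⊑ ‵ 4 by Cheapest.enough H ∙ end)
          1 (‵ 2 ⊕ 5 ⊛ ‵ 5) (‵ 1)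
        ; moderate = moderate (cheapest-inhabited H (linear (e ∷ []) (5 ⋆ κ 10 ⊑ ‵ 0 by 10≤e ∙ end)
          1 (κ 1 ⊕ κ 0) (5 ⊛ ‵ 0))) }
        where
        open Cheapest H using (set; inside; bound)
        set-disjoint : Disjoint set
        set-disjoint = disjoint-⊆ (λ z h → ∧₁ (inside z h)) (children-disjoint w)
        balance : wsum set (weight coclass) + wsum set gain ≡ wsum set (weight class)
        balance = trans (sym (wsum-+ set (weight coclass) gain)) (≤-antisym
          (wsum-mono {H = set} {set} {λ z → weight coclass z + gain z} {weight class} (λ z h → h)
              (λ z h → ≤-reflexive (gain-eq z (inside z h))))
          (wsum-mono {H = set} {set} {weight class} {λ z → weight coclass z + gain z} (λ z h → h)
            (λ z h → ≤-reflexive (sym (gain-eq z (inside z h))))))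
        c∉ : ¬ (union set w ≡ true)
        c∉ u = case union⇒ {set} u of λ { (z , h , zw) → 1+n≰n (≤-trans
          (≤-reflexive (sym (child-depth (child⇒ {w} {z} (∧₁ (inside z h)))))) (⊑-depth zw)) }
        attached : ∀ x y → adj T x y ≡ true → union set x ≡ true → ¬ (union set y ≡ true) → y ≡ w
        attached x y xy sx ny = case union⇒ {set} sx of λ { (z , h , zx) → case exit xy zx
            (λ zy → ny (union⇐ {set} h zy)) of λ
          { (refl , _ , eq) → trans (sym eq) (proj₂ (child⇒ {w} {z} (∧₁ (inside z h)))) } }
        moderate : (∃ λ z → set z ≡ true) → count (λ x → union set x ∧ class x) * 2 + t₂ ≤
          count (λ x → union set x ∧ coclass x) * 2 + e * 10 + t₁
        moderate (z , hz) = linear (count (λ x → union set x ∧ class x) ∷ wsum set (weight class) ∷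
          wsum set (weight coclass) ∷ count (λ x → union set x ∧ coclass x) ∷ wsum set gain ∷ e ∷ gain z ∷
          weight coclass z ∷ weight class z ∷ t₂ ∷ t₁ ∷ []) (
          2 ⋆ ‵ 0 ⊑ ‵ 1 by ≤-reflexive (union-weight set class set-disjoint) ∙
          2 ⋆ ‵ 2 ⊑ ‵ 3 by ≤-reflexive (sym (union-weight set coclass set-disjoint)) ∙
          2 ⋆ ‵ 1 ⊑ ‵ 2 ⊕ ‵ 4 by ≤-reflexive (sym balance) ∙ 2 ⋆ κ 1 ⊕ ‵ 4 ⊑ 5 ⊛ ‵ 5 ⊕ ‵ 6 by bound hz ∙
          2 ⋆ ‵ 7 ⊕ ‵ 6 ⊑ ‵ 8 by ≤-reflexive (gain-eq z (inside z hz)) ∙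
          1 ⋆ κ 1 ⊕ (2 ⊛ ‵ 8 ⊕ ‵ 9) ⊑ 2 ⊛ ‵ 7 ⊕ ‵ 10 by ≰⇒>
              (λ le → <⇒≱ (size-child (child⇒ {w} {z} (∧₁ (inside z hz)))) (low z (⌊⌋-intro (_ ≤? _) le))) ∙
          end) 1 (2 ⊛ ‵ 0 ⊕ ‵ 9) (2 ⊛ ‵ 3 ⊕ 10 ⊛ ‵ 5 ⊕ ‵ 10)

  -- All neighbours of c are ports. There are at most e of them, whence the e neighbours of `h₀` on
  -- each side, and the zones into which they fall do not matter. After the exchange U₁ receives at
  -- most t₁ - 5e vertices and U₂ at most n/2 + 5e.
  module Exchanged (E : Exchange) (h₀ : Fin N) (many₁ : e ≤ deg G χ h₀ U₁) (many₂ : e ≤ deg G χ h₀ U₂) where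
    open Exchange E

    V : Bool → Fin N → Bool
    V i h = (if i then U₁ h else U₂ h) ∧ not (h == h₀)

    trimmed : ∀ (U : Fin N → Bool) → count U ≤ count (λ h → U h ∧ not (h == h₀)) + 1
    trimmed U = linear (count U ∷ count (λ h → U h ∧ (h == h₀)) ∷ count (λ h → U h ∧ not (h == h₀)) ∷
      count (_== h₀) ∷ []) (1 ⋆ ‵ 0 ⊑ ‵ 1 ⊕ ‵ 2 by ≤-reflexive (count-split U (_== h₀)) ∙
      1 ⋆ ‵ 1 ⊑ ‵ 3 by count-mono (λ h → U h ∧ (h == h₀)) (_== h₀) (λ h → ∧₂ {U h}) ∙ 1 ⋆ ‵ 3 ⊑ κ 1 by count-== h₀ ∙
      end) 1 (‵ 0) (‵ 2 ⊕ κ 1)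

    z : Fin n → Bool
    z x = if part x then coclass x else class x

    opposite : ∀ x y → adj T x y ≡ true → x ≢ c → y ≢ c → z x ≡ not (z y)
    opposite x y xy xc yc with part x in px | part y in py
    ... | true  | true  = cong not (alternate x y xy)
    ... | false | false = alternate x y xy
    ... | true  | false = ⊥-elim (yc (attached x y xy px (false-elim py)))
    ... | false | true  = ⊥-elim (xc (attached y x (trans (adj-sym T y x) xy) py (false-elim px)))

    V-dense : ∀ i j h → i ≡ not j → V i h ≡ true → deg G (other χ) h (V j) ≤ e
    V-dense true  false h _ v = ≤-trans (deg-mono G (other χ) h {V false} {U₂} (λ i → ∧₁))
        (proj₂ (sparse₁ h (∧₁ v)))
    V-dense false true  h _ v = ≤-trans (deg-mono G (other χ) h {V true} {U₁} (λ i → ∧₁)) (proj₂ (sparse₂ h (∧₁ v)))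
    V-dense true  true  h ()
    V-dense false false h ()

    exchanged-copy : HasMonochromaticCopy G T
    exchanged-copy = from (embed (rooted c) G χ c h₀ h₀ (λ _ → refl) (λ ne → ⊥-elim (ne refl))
        (false-elim (irrefl T c))
        (λ _ → true) (adj T c) z refl refl V h₀-disjoint h₀∉V h₀∉V e (λ x → inj₁) apart port-room
        (λ x y xy _ _ xc _ yc _ h v → V-dense (z x) (z y) h (opposite x y xy xc yc) v)
        (λ w _ np cw → ⊥-elim (np cw)) (λ w _ np cw → ⊥-elim (np cw)) room)
      where
      from : (∃ λ f → f c ≡ h₀ × f c ≡ h₀ × (∀ x → true ≡ true → x ≢ c → x ≢ c → V (z x) (f x) ≡ true) ×
        (∀ x y → true ≡ true → true ≡ true → f x ≡ f y → x ≡ y) ×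
        (∀ x y → true ≡ true → true ≡ true → adj T x y ≡ true → colour G (f x) (f y) ≡ χ)) → HasMonochromaticCopy G
            T
      from (f , _ , _ , _ , injective , edges) = χ , f , (λ {x} {y} → injective x y refl refl) , λ x y → edges x y
          refl refl
      h₀-disjoint : ∀ h → V true h ≡ true → V false h ≡ true → ⊥
      h₀-disjoint h p q = disjoint h (∧₁ p) (∧₁ q)
      h₀∉V : ∀ i → ¬ (V i h₀ ≡ true)
      h₀∉V i v = not-elim (∧₂ {if i then U₁ h₀ else U₂ h₀} v) (==-refl h₀)
      apart : ∀ x y → adj T c x ≡ true → adj T c y ≡ true → ¬ (adj T x y ≡ true)
      apart x y cx cy xy with class c | class x | class y | alternate c x cx | alternate c y cy | alternate x y xy
      ... | true  | false | false | _  | _  | ()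
      ... | false | true  | true  | _  | _  | ()
      ... | true  | true  | _     | () | _  | _
      ... | false | false | _     | () | _  | _
      ... | true  | false | true  | _  | () | _
      ... | false | true  | false | _  | () | _
      port-room : ∀ w → true ≡ true → adj T c w ≡ true → count (λ x → adj T c x ∧ same (z x) (z w)) ≤
        count (λ h → V (z w) h ∧ implies (adj T c w) (colour G h₀ h ==ᶜ χ) ∧ implies (adj T c w)
            (colour G h₀ h ==ᶜ χ))
      port-room w _ _ = ≤-trans (≤-trans (count-mono (λ x → adj T c x ∧ same (z x) (z w)) (adj T c) (λ x → ∧₁))
          (degree≤ c)) (wide (z w))
        where
        ready : Fin N → Bool
        ready h = implies (adj T c w) (colour G h₀ h ==ᶜ χ) ∧ implies (adj T c w) (colour G h₀ h ==ᶜ χ)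
        ok : ∀ {h} → (colour G h₀ h ==ᶜ χ) ≡ true → ready h ≡ true
        ok {h} g = both {implies (adj T c w) (colour G h₀ h ==ᶜ χ)} (implies-intro (λ _ → g))
            (implies-intro (λ _ → g))
        wide : ∀ i → e ≤ count (λ h → V i h ∧ ready h)
        wide true = ≤-trans many₁ (count-mono (λ h → U₁ h ∧ not ⌊ h ≟ᶠ h₀ ⌋ ∧ (colour G h₀ h ==ᶜ χ))
            (λ h → V true h ∧ ready h)
          (λ h q → both (both {U₁ h} (∧₁ q) (∧₁ {not (h == h₀)} (∧₂ {U₁ h} q)))
              (ok (∧₂ {not (h == h₀)} (∧₂ {U₁ h} q)))))
        wide false = ≤-trans many₂ (count-mono (λ h → U₂ h ∧ not ⌊ h ≟ᶠ h₀ ⌋ ∧ (colour G h₀ h ==ᶜ χ))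
            (λ h → V false h ∧ ready h)
          (λ h q → both (both {U₂ h} (∧₁ q) (∧₁ {not (h == h₀)} (∧₂ {U₂ h} q)))
              (ok (∧₂ {not (h == h₀)} (∧₂ {U₂ h} q)))))
      swapped : ∀ P P' (Q : Fin n → Bool) → (∀ x → Q x ≡ true → (part x ≡ true → P' x ≡ true) ×
          (¬ (part x ≡ true) → P x ≡ true)) →
        count Q + count (λ x → part x ∧ P x) ≤ count P + count (λ x → part x ∧ P' x)
      swapped P P' Q h = linear (count (λ x → P x ∧ part x) ∷ count (λ x → P x ∧ not (part x)) ∷ count P ∷
        count (λ x → part x ∧ P x) ∷ count Q ∷ count (λ x → part x ∧ P' x) ∷ []) (
        1 ⋆ ‵ 0 ⊕ ‵ 1 ⊑ ‵ 2 by ≤-reflexive (sym (count-split P part)) ∙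
        1 ⋆ ‵ 3 ⊑ ‵ 0 by count-mono (λ x → part x ∧ P x) (λ x → P x ∧ part x) (λ x r → both (∧₂ {part x} r)
            (∧₁ r)) ∙
        1 ⋆ ‵ 4 ⊑ ‵ 5 ⊕ ‵ 1 by count-cover Q (λ x → part x ∧ P' x) (λ x → P x ∧ not (part x))
            (λ x r → case truth (part x) of λ { (inj₁ t) → inj₁ (both t (proj₁ (h x r) t)) ; (inj₂ t) → inj₂
            (both (proj₂ (h x r) (not-elim t)) t) }) ∙
        end) 1 (‵ 4 ⊕ ‵ 3) (‵ 2 ⊕ ‵ 5)
      in-part : ∀ {x b} → part x ≡ true → z x ≡ b → coclass x ≡ b
      in-part {x} p eq = trans (cong (λ i → if i then coclass x else class x) (sym p)) eq
      not-in-part : ∀ {x b} → ¬ (part x ≡ true) → z x ≡ b → class x ≡ b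
      not-in-part {x} p eq = trans (cong (λ i → if i then coclass x else class x) (sym (false-intro p))) eq
      room : ∀ i → count (λ x → true ∧ same (z x) i) + e * 2 ≤ count (V i)
      room true = linear (count (λ x → same (z x) true) ∷ count (λ x → part x ∧ class x) ∷ t₁ ∷
        count (λ x → part x ∧ coclass x) ∷ e ∷ count U₁ ∷ count (V true) ∷ []) (
        1 ⋆ ‵ 0 ⊕ ‵ 1 ⊑ ‵ 2 ⊕ ‵ 3 by swapped class coclass (λ x → same (z x) true)
            (λ x s → (λ p → in-part p (⌊⌋-elim (z x ≟ᵇ true) s)) ,
            (λ p → not-in-part p (⌊⌋-elim (z x ≟ᵇ true) s))) ∙
        1 ⋆ ‵ 3 ⊕ 5 ⊛ ‵ 4 ⊑ ‵ 1 by surplus ∙ 1 ⋆ ‵ 5 ⊑ ‵ 6 ⊕ κ 1 by trimmed U₁ ∙ 1 ⋆ ‵ 2 ⊑ ‵ 5 ⊕ ‵ 4 by large₁ ∙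
        2 ⋆ κ 10 ⊑ ‵ 4 by 10≤e ∙ end) 1 (‵ 0 ⊕ 2 ⊛ ‵ 4) (‵ 6)
      room false = linear (count (λ x → same (z x) false) ∷ count (λ x → part x ∧ coclass x) ∷ t₂ ∷
        count (λ x → part x ∧ class x) ∷ e ∷ t₁ ∷ count U₂ ∷ count (V false) ∷ n ∷ []) (
        6 ⋆ ‵ 0 ⊕ ‵ 1 ⊑ ‵ 2 ⊕ ‵ 3 by swapped coclass class (λ x → same (z x) false)
            (λ x s → (λ p → from-false (in-part p (⌊⌋-elim (z x ≟ᵇ false) s))) ,
            (λ p → cong not (not-in-part p (⌊⌋-elim (z x ≟ᵇ false) s)))) ∙
        3 ⋆ 2 ⊛ ‵ 3 ⊕ ‵ 2 ⊑ 2 ⊛ ‵ 1 ⊕ 10 ⊛ ‵ 4 ⊕ ‵ 5 by moderate ∙ 6 ⋆ ‵ 6 ⊑ ‵ 7 ⊕ κ 1 by trimmed U₂ ∙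
        6 ⋆ ‵ 5 ⊑ ‵ 6 ⊕ ‵ 4 by large₂ ∙ 1 ⋆ ‵ 8 ⊑ ‵ 5 ⊕ ‵ 2 by ≤-reflexive (sym total) ∙
        2 ⋆ 2 ⊛ ‵ 2 ⊑ ‵ 5 ⊕ ‵ 4 by unbalanced ∙ 1 ⋆ 20000 ⊛ ‵ 4 ⊑ ‵ 8 by tiny ∙ 19950 ⋆ κ 10 ⊑ ‵ 4 by 10≤e ∙ end)
        6 (‵ 0 ⊕ 2 ⊛ ‵ 4) (‵ 7)
        where
        from-false : ∀ {b} → not b ≡ false → b ≡ true
        from-false {true} _ = refl

-- Two near-cliques with one common vertex

module Cliques {n N} {T : SimpleGraph n} {e} (B : Bipartition T e) (G : ColouredKN N) (χ : Colour) where
  open Bipartition B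

  -- Each W i is completely joined only to its core U i; pairs within W i that avoid the core may
  -- have any colour. Tree vertices placed there must be pairwise nonadjacent.
  module _ (10≤e : 10 ≤ e) (tiny : e * 20000 ≤ n) (unbalanced : t₂ * 2 ≤ t₁)
    (W U : Bool → Fin N → Bool) (v : Fin N) (U⊆W : ∀ i → U i ⊆ W i) (W-disjoint : ∀ h → W true h ≡ true → W false
        h ≡ true → ⊥)
    (v∉W : ∀ i → ¬ (W i v ≡ true)) (W-large : ∀ i → t₁ ≤ count (W i) + 1) (U-large : ∀ i → t₁ ≤ count (U i) + e)
    (W-U : ∀ i x h → W i x ≡ true → U i h ≡ true → x ≢ h → colour G x h ≡ χ)
    (v-U : ∀ i h → U i h ≡ true → colour G v h ≡ χ) where

    -- With r on the common vertex, both remaining parts have at most t₁ - 1 vertices: the second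
    -- has at most n - 1 - t₂.
    record Split : Set where
      field
        r        : Fin n
        side     : Fin n → Bool
        r∉       : ¬ (side r ≡ true)
        attached : ∀ x y → adj T x y ≡ true → side x ≡ true → ¬ (side y ≡ true) → y ≡ r
        low      : t₂ ≤ count side
        high     : count side < t₁

    -- At a centroid a branch of at least t₂ vertices suffices alone, having at most n/2 < t₁. If
    -- all branches are smaller, a cheapest collection that reaches t₂ stays below 2t₂ ≤ t₁.
    split : Fin n → Split
    split r₀ = from (centroid T rooted r₀)
      where
      from : (∃ λ r → Σ (Rooted T r) λ R → let open Subtrees R in ∀ u → Child r u → size u * 2 ≤ n) → Split
      from (r , R , half) = decide (exists? (λ z → child r z ∧ ⌊ t₂ ≤? size z ⌋))
        where
        open Subtrees R
        build : ∀ H → H ⊆ child r → t₂ ≤ wsum H size → wsum H size < t₁ → Split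
        build H H⊆ lo hi = record
          { r = r ; side = union H
          ; r∉ = λ u → case union⇒ {H} u of λ { (z , h , zr) → 1+n≰n (≤-trans
              (≤-reflexive (sym (child-depth (child⇒ {r} {z} (H⊆ z h))))) (⊑-depth zr)) }
          ; attached = λ x y xy sx ny → case union⇒ {H} sx of λ { (z , h , zx) → case exit xy zx
              (λ zy → ny (union⇐ {H} h zy)) of λ
              { (refl , _ , eq) → trans (sym eq) (proj₂ (child⇒ {r} {z} (H⊆ z h))) } }
          ; low = subst (t₂ ≤_) (sym (union-size H d)) lo ; high = subst (_< t₁) (sym (union-size H d)) hi }
          where
          d : Disjoint H
          d = disjoint-⊆ H⊆ (children-disjoint r)
        decide : (∃ λ z → child r z ∧ ⌊ t₂ ≤? size z ⌋ ≡ true) ⊎ (∀ z → ¬ (child r z ∧ ⌊ t₂ ≤? size z ⌋ ≡ true)) →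
            Split
        decide (inj₁ (z , h)) = build (λ x → child r x ∧ (x == z)) (λ x → ∧₁)
          (linear (t₂ ∷ size z ∷ wsum (λ x → child r x ∧ (x == z)) size ∷ []) (
            1 ⋆ ‵ 0 ⊑ ‵ 1 by ⌊⌋-elim (t₂ ≤? size z) (∧₂ {child r z} h) ∙
            1 ⋆ ‵ 1 ⊑ ‵ 2 by wsum-point (λ x → child r x ∧ (x == z)) size {z} (both (∧₁ h) (==-refl z)) ∙ end)
            1 (‵ 0) (‵ 2))
          (linear (wsum (λ x → child r x ∧ (x == z)) size ∷ size z ∷ n ∷ t₁ ∷ t₂ ∷ e ∷ []) (
            6 ⋆ ‵ 0 ⊑ ‵ 1 by wsum-single (child r) size z ∙ 3 ⋆ 2 ⊛ ‵ 1 ⊑ ‵ 2 by half z (child⇒ (∧₁ h)) ∙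
            4 ⋆ ‵ 2 ⊑ ‵ 3 ⊕ ‵ 4 by ≤-reflexive (sym total) ∙ 2 ⋆ 2 ⊛ ‵ 4 ⊑ ‵ 3 by unbalanced ∙
            1 ⋆ 20000 ⊛ ‵ 5 ⊑ ‵ 2 by tiny ∙ 20000 ⋆ κ 10 ⊑ ‵ 5 by 10≤e ∙ end) 6 (κ 1 ⊕ ‵ 0) (‵ 3))
        decide (inj₂ none) = build set inside enough (case t₂ ≤? 0 of λ
          -- For t₂ = 0 the set may be empty, so there is no member to which `bound` could be
          -- applied.
          { (yes none-needed) → ≤-<-trans (≤-pred (small-sum none-needed)) positive
          ; (no some) → case cheapest-inhabited H (≰⇒> some) of λ { (z , h) →
              (linear (wsum set size ∷ t₂ ∷ size z ∷ t₁ ∷ []) (1 ⋆ κ 1 ⊕ ‵ 0 ⊑ ‵ 1 ⊕ ‵ 2 by bound h ∙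
                1 ⋆ κ 1 ⊕ ‵ 2 ⊑ ‵ 1 by ≰⇒> (λ le → none z (both (inside z h) (⌊⌋-intro (t₂ ≤? size z) le))) ∙
                1 ⋆ 2 ⊛ ‵ 1 ⊑ ‵ 3 by unbalanced ∙ end) 1 (κ 1 ⊕ ‵ 0) (‵ 3)) } })
          where
          H : Cheapest (child r) size t₂
          H = cheapest (child r) size t₂ (linear (size r ∷ wsum (child r) size ∷ n ∷ t₁ ∷ t₂ ∷ e ∷ []) (
            3 ⋆ ‵ 0 ⊑ κ 1 ⊕ ‵ 1 by size-children r ∙ 3 ⋆ ‵ 2 ⊑ ‵ 0 by ≤-reflexive (sym size-root) ∙
            1 ⋆ ‵ 3 ⊕ ‵ 4 ⊑ ‵ 2 by ≤-reflexive total ∙ 1 ⋆ 2 ⊛ ‵ 4 ⊑ ‵ 3 by unbalanced ∙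
            2 ⋆ 20000 ⊛ ‵ 5 ⊑ ‵ 2 by tiny ∙ 40000 ⋆ κ 10 ⊑ ‵ 5 by 10≤e ∙ end) 3 (‵ 4) (‵ 1))
          open Cheapest H
          positive : 0 < t₁
          positive = linear (n ∷ t₁ ∷ t₂ ∷ e ∷ []) (2 ⋆ ‵ 0 ⊑ ‵ 1 ⊕ ‵ 2 by ≤-reflexive (sym total) ∙
            1 ⋆ 2 ⊛ ‵ 2 ⊑ ‵ 1 by unbalanced ∙ 2 ⋆ 20000 ⊛ ‵ 3 ⊑ ‵ 0 by tiny ∙ 40000 ⋆ κ 10 ⊑ ‵ 3 by 10≤e ∙ end)
            3 (κ 1 ⊕ κ 0) (‵ 1)
          small-sum : t₂ ≤ 0 → wsum set size < 1
          small-sum z = ≤-<-trans (≤-trans (wsum-bound set size 0 (λ y h → ⊥-elim (none y (both (inside y h)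
            (⌊⌋-intro (t₂ ≤? size y) (≤-trans z z≤n)))))) (≤-reflexive (*-zeroʳ (count set)))) (s≤s z≤n)

    module Place (D : Split) where
      open Split D

      -- Fillers are independent, so they may use the part of W (side x) outside U (side x).
      filler : Fin n → Bool
      filler x = class x ∧ not (adj T r x)

      pool : Fin n → Fin N → Bool
      pool x h = if filler x then W (side x) h else U (side x) h

      Z : Fin n → Fin N → Bool
      Z x h = if x == r then h == v else pool x h

      Z-r : ∀ {x h} → x ≡ r → Z x h ≡ true → h ≡ v
      Z-r {x} refl p rewrite ==-refl x = ==-elim p

      Z-pool : ∀ {x h} → x ≢ r → Z x h ≡ true → pool x h ≡ true
      Z-pool {x} ne p rewrite false-intro {x == r} (ne ∘ ==-elim) = p

      Z-r⁻¹ : Z r v ≡ true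
      Z-r⁻¹ rewrite ==-refl r = ==-refl v

      Z-pool⁻¹ : ∀ {x h} → x ≢ r → pool x h ≡ true → Z x h ≡ true
      Z-pool⁻¹ {x} ne p rewrite false-intro {x == r} (ne ∘ ==-elim) = p

      pool⊆W : ∀ x → pool x ⊆ W (side x)
      pool⊆W x h p with filler x
      ... | true  = p
      ... | false = U⊆W (side x) h p

      pool-U : ∀ {x h} → ¬ (filler x ≡ true) → pool x h ≡ true → U (side x) h ≡ true
      pool-U {x} nf p rewrite false-intro nf = p

      -- Fillers come last. The core has at most t₂ + e vertices and fits into either U with room to
      -- spare; only for the fillers is the count exact.
      phase : Fin n → ℕ
      phase x = if filler x then 1 else 0

      abstract
        ordering : ∃ λ (rank : Fin n → ℕ) → (∀ x y → rank x ≡ rank y → x ≡ y) × (∀ x y → rank x < rank y → phase x ≤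
            phase y)
        ordering = lexicographic phase

      rank : Fin n → ℕ
      rank = proj₁ ordering

      members : Bool → Fin n → Bool
      members i x = same (side x) i ∧ not (x == r)

      members-few : ∀ i → count (members i) < t₁
      members-few true = ≤-<-trans (count-mono (members true) side (λ x h → ⌊⌋-elim (side x ≟ᵇ true) (∧₁ h))) high
      members-few false = linear (count side ∷ count (not ∘ side) ∷ n ∷ t₂ ∷ t₁ ∷ count (_== r) ∷
        count (members false) ∷ []) (1 ⋆ ‵ 0 ⊕ ‵ 1 ⊑ ‵ 2 by ≤-reflexive (count-not side) ∙ 1 ⋆ ‵ 3 ⊑ ‵ 0 by low ∙
        1 ⋆ ‵ 2 ⊑ ‵ 4 ⊕ ‵ 3 by ≤-reflexive (sym total) ∙ 1 ⋆ κ 1 ⊑ ‵ 5 by count-point (_== r) {r} (==-refl r) ∙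
        1 ⋆ ‵ 6 ⊕ ‵ 5 ⊑ ‵ 1 by count-pack (not ∘ side) (members false) (_== r)
            (λ x h → cong not (⌊⌋-elim (side x ≟ᵇ false) (∧₁ h))) (λ x h → subst (λ y → not (side y) ≡ true)
            (sym (==-elim h)) (not-intro r∉)) (λ x h k → not-elim (∧₂ {same (side x) false} h) k) ∙
        end) 1 (κ 1 ⊕ ‵ 6) (‵ 4)

      core-few : count (not ∘ filler) ≤ t₂ + e
      core-few = ≤-trans (count-cover (not ∘ filler) coclass (adj T r) (λ x h → case truth (class x) of λ
        { (inj₂ c) → inj₁ c ; (inj₁ c) → inj₂ (case truth (adj T r x) of λ
          { (inj₁ a) → a ; (inj₂ na) → ⊥-elim (not-elim h (both c na)) }) })) (+-monoʳ-≤ t₂ (degree≤ r))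

      -- No colour is examined during the placement: every edge of T has an end in the core other
      -- than r, so the zones alone determine its colour.
      E : Fin n → Fin n → Set
      E _ _ = ⊥

      C : Fin N → Fin N → Set
      C _ _ = ⊤

      module Step (f : Fin n → Fin N) (w : Fin n)
        (P : Partial rank (proj₁ (proj₂ ordering)) (λ _ → true) Z E C (λ _ _ _ → tt) (λ _ _ ()) (rank w) f) where
        open Partial P

        Choice : Set
        Choice = ∃ λ h → Z w h ≡ true × (∀ x → true ≡ true → rank x < rank w → f x ≢ h) ×
          (∀ x → true ≡ true → rank x < rank w → E x w → C (f x) h)

        earlier : Fin n → Bool
        earlier x = ⌊ rank x <? rank w ⌋

        hosted : ∀ x → earlier x ≡ true → x ≢ r → pool x (f x) ≡ true
        hosted x lt ne = Z-pool ne (zoned x refl (⌊⌋-elim (rank x <? rank w) lt))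

        at-root : w ≡ r → Choice
        at-root refl = v , Z-r⁻¹ , (λ x _ lt eq → v∉W (side x) (subst (λ h → W (side x) h ≡ true) eq
          (pool⊆W x (f x) (hosted x (⌊⌋-intro (rank x <? rank w) lt) (λ { refl → <-irrefl refl lt }))))) , λ _ _ _
              _ → tt

        occupied : Fin N → Bool
        occupied h = pool w h ∧ image f earlier h

        elsewhere : w ≢ r → count occupied < count (pool w) → Choice
        elsewhere ne lt = from (pick (pool w) occupied lt)
          where
          from : (∃ λ h → pool w h ≡ true × ¬ (occupied h ≡ true)) → Choice
          from (h , p , new) = h , Z-pool⁻¹ ne p ,
              (λ { x _ lt refl → new (both p (image⇐ f earlier (⌊⌋-intro (rank x <? rank w) lt))) }) ,
            λ _ _ _ _ → tt

        side-eq : ∀ {i j h} → W i h ≡ true → W j h ≡ true → i ≡ j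
        side-eq {true}  {true}  _ _ = refl
        side-eq {false} {false} _ _ = refl
        side-eq {true}  {false} p q = ⊥-elim (W-disjoint _ p q)
        side-eq {false} {true}  p q = ⊥-elim (W-disjoint _ q p)

        room : w ≢ r → count occupied < count (pool w)
        room ne = [ for-filler , for-core ]′ (truth (filler w))
          where
          for-core : not (filler w) ≡ true → count occupied < count (pool w)
          for-core nf = linear (count occupied ∷ count (not ∘ filler) ∷ t₂ ∷ e ∷ t₁ ∷ count (U (side w)) ∷
            count (pool w) ∷ n ∷ []) (
            3 ⋆ ‵ 0 ⊑ ‵ 1 by image-count f earlier (not ∘ filler) (pool w)
                (λ x lt _ → not-intro (λ fl → 1+n≰n (subst₂ _≤_ (cong (λ i → if i then 1 else 0) fl)
                (cong (λ i → if i then 1 else 0) (false-intro (not-elim nf))) (proj₂ (proj₂ ordering) x w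
                (⌊⌋-elim (rank x <? rank w) lt))))) ∙
            3 ⋆ ‵ 1 ⊑ ‵ 2 ⊕ ‵ 3 by core-few ∙ 3 ⋆ ‵ 4 ⊑ ‵ 5 ⊕ ‵ 3 by U-large (side w) ∙
            3 ⋆ ‵ 5 ⊑ ‵ 6 by count-mono (U (side w)) (pool w)
                (λ h q → subst (λ i → (if i then W (side w) h else U (side w) h) ≡ true)
                (sym (false-intro (not-elim nf))) q) ∙
            1 ⋆ ‵ 7 ⊑ ‵ 4 ⊕ ‵ 2 by ≤-reflexive (sym total) ∙ 2 ⋆ 2 ⊛ ‵ 2 ⊑ ‵ 4 by unbalanced ∙
            1 ⋆ 20000 ⊛ ‵ 3 ⊑ ‵ 7 by tiny ∙ 19994 ⋆ κ 10 ⊑ ‵ 3 by 10≤e ∙ end) 3 (κ 1 ⊕ ‵ 0) (‵ 6)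
          for-filler : filler w ≡ true → count occupied < count (pool w)
          for-filler fl = linear (count occupied ∷ count (λ x → members (side w) x ∧ not (x == w)) ∷
            count (λ x → members (side w) x ∧ (x == w)) ∷ count (members (side w)) ∷ t₁ ∷ count (W (side w)) ∷
            count (pool w) ∷ []) (
            1 ⋆ ‵ 0 ⊑ ‵ 1 by image-count f earlier (λ x → members (side w) x ∧ not (x == w)) (pool w) rivals ∙
            1 ⋆ ‵ 2 ⊕ ‵ 1 ⊑ ‵ 3 by ≤-reflexive (sym (count-split (members (side w)) (_== w))) ∙
            1 ⋆ κ 1 ⊑ ‵ 2 by count-point (λ x → members (side w) x ∧ (x == w)) {w}
                (both (both (same-refl (side w)) (not-intro (ne ∘ ==-elim))) (==-refl w)) ∙
            1 ⋆ κ 1 ⊕ ‵ 3 ⊑ ‵ 4 by members-few (side w) ∙ 1 ⋆ ‵ 4 ⊑ ‵ 5 ⊕ κ 1 by W-large (side w) ∙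
            1 ⋆ ‵ 5 ⊑ ‵ 6 by count-mono (W (side w)) (pool w)
                (λ h q → subst (λ i → (if i then W (side w) h else U (side w) h) ≡ true) (sym fl) q) ∙
            end) 1 (κ 1 ⊕ ‵ 0) (‵ 6)
            where
            rivals : ∀ x → earlier x ≡ true → pool w (f x) ≡ true → members (side w) x ∧ not (x == w) ≡ true
            rivals x lt p = both (both (⌊⌋-intro (side x ≟ᵇ side w) (side-eq (pool⊆W x (f x) (hosted x lt x≢r))
                (pool⊆W w (f x) p)))
                (not-intro (x≢r ∘ ==-elim))) (not-intro (λ eq → case ==-elim eq of λ
                    { refl → <-irrefl refl (⌊⌋-elim (rank x <? rank w) lt) }))
              where
              x≢r : x ≢ r
              x≢r eq = v∉W (side w) (subst (λ h → W (side w) h ≡ true)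
                  (Z-r eq (zoned x refl (⌊⌋-elim (rank x <? rank w) lt)))
                (pool⊆W w (f x) p))

        choice : Choice
        choice = case w ≟ᶠ r of λ { (yes eq) → at-root eq ; (no ne) → elsewhere ne (room ne) }

      placed-copy : HasMonochromaticCopy G T
      placed-copy = from (greedy rank (proj₁ (proj₂ ordering)) (λ _ → true) Z E C (λ _ _ _ → tt) (λ _ _ ()) (λ _ ())
        (λ f w _ P → Step.choice f w P) (λ _ → v))
        where
        from : (∃ λ f → (∀ x → true ≡ true → Z x (f x) ≡ true) × (∀ x y → true ≡ true → true ≡ true → f x ≡ f y →
            x ≡ y) ×
          (∀ x y → true ≡ true → true ≡ true → E x y → C (f x) (f y))) → HasMonochromaticCopy G T
        from (f , zoned , injective , _) = χ , f , (λ {x} {y} → injective x y refl refl) , edges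
          where
          distinct : ∀ {x y} → adj T x y ≡ true → f x ≢ f y
          distinct {x} {y} xy eq with injective x y refl refl eq
          ... | refl = false-elim (irrefl T x) xy
          hosted : ∀ x → x ≢ r → pool x (f x) ≡ true
          hosted x ne = Z-pool ne (zoned x refl)
          core : ∀ x → x ≢ r → ¬ (filler x ≡ true) → U (side x) (f x) ≡ true
          core x ne nf = pool-U nf (hosted x ne)
          from-r : ∀ y → adj T r y ≡ true → colour G (f r) (f y) ≡ χ
          from-r y ry = subst (λ h → colour G h (f y) ≡ χ) (sym (Z-r refl (zoned r refl)))
            (v-U (side y) (f y) (core y (λ { refl → false-elim (irrefl T r) ry }) (λ fl → not-elim (∧₂ {class y} fl)
                ry)))
          same-side : ∀ x y → adj T x y ≡ true → x ≢ r → y ≢ r → side x ≡ side y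
          same-side x y xy xr yr with truth (side x) | truth (side y)
          ... | inj₁ p | inj₁ q = trans p (sym q)
          ... | inj₂ p | inj₂ q = trans (false-intro (not-elim p)) (sym (false-intro (not-elim q)))
          ... | inj₁ p | inj₂ q = ⊥-elim (yr (attached x y xy p (not-elim q)))
          ... | inj₂ p | inj₁ q = ⊥-elim (xr (attached y x (trans (adj-sym T y x) xy) q (not-elim p)))
          to-core : ∀ x y → adj T x y ≡ true → x ≢ r → y ≢ r → ¬ (filler y ≡ true) → colour G (f x) (f y) ≡ χ
          to-core x y xy xr yr nf = W-U (side y) (f x) (f y)
            (subst (λ i → W i (f x) ≡ true) (same-side x y xy xr yr) (pool⊆W x (f x) (hosted x xr))) (core y yr nf)
                (distinct xy)
          edges : ∀ x y → adj T x y ≡ true → colour G (f x) (f y) ≡ χ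
          edges x y xy = case x ≟ᶠ r of λ
            { (yes refl) → from-r y xy
            ; (no xr) → case y ≟ᶠ r of λ
              { (yes refl) → trans (colour-sym G (f x) (f y)) (from-r x (trans (adj-sym T y x) xy))
              ; (no yr) → case truth (filler y) of λ
                { (inj₂ nf) → to-core x y xy xr yr (not-elim nf)
                ; (inj₁ fy) → trans (colour-sym G (f x) (f y)) (to-core y x (trans (adj-sym T y x) xy) yr xr
                    (λ fx → not-elim (trans (sym (alternate x y xy)) (∧₁ fx)) (∧₁ fy))) } } }

    cliques-copy : Fin n → HasMonochromaticCopy G T
    cliques-copy r₀ = Place.placed-copy (split r₀)

-- The extremal structure

module Half {n N} {T : SimpleGraph n} {e} {B : Bipartition T e} {G : ColouredKN N} {χ U₁ U₂}
    (S : Setting B G χ U₁ U₂)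
  (cut : Cut B) (ℓ₀ p₀ : Fin n) (ℓ₀-class : Bipartition.class B ℓ₀ ≡ true) (ℓ₀p₀ : adj T ℓ₀ p₀ ≡ true)
  (only : ∀ q → adj T ℓ₀ q ≡ true → q ≡ p₀) where
  open Setting S
  open Cut cut using (k; k≤; robust)

  A P : Fin N → Bool
  A x = ⌊ deg G (other χ) x U₂ <? k ⌋
  P x = ⌊ deg G χ x U₁ ≤? e ⌋

  A⇒ : ∀ {x} → A x ≡ true → deg G (other χ) x U₂ < k
  A⇒ {x} = ⌊⌋-elim (deg G (other χ) x U₂ <? k)

  span : ∀ A' → A' ⊆ A → t₁ ≤ count A' + 1 → ∀ x y → ¬ (A' x ≡ true) → U₂ y ≡ true → x ≢ y → colour G x y ≡ χ →
    HasMonochromaticCopy G T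
  span A' A'⊆A enough x y x∉A' y∈U₂ x≢y xy = Spanning.spanning-copy S A' k k≤ robust (λ h a → A⇒ (A'⊆A h a)) enough
    x y x∉A' y∈U₂ x≢y xy ℓ₀ p₀ ℓ₀-class ℓ₀p₀ only

  -- One vertex x of A is given up to host the leaf, and any χ-neighbour of x in U₂ hosts the
  -- parent. This reduces the case to a set of at least t₁ - 1 vertices with x outside it.
  many-A : t₁ ≤ count A → HasMonochromaticCopy G T
  many-A large = from-x (count-positive A (≤-trans (linear (n ∷ t₁ ∷ t₂ ∷ e ∷ []) (
    2 ⋆ ‵ 0 ⊑ ‵ 1 ⊕ ‵ 2 by ≤-reflexive (sym total) ∙ 1 ⋆ 2 ⊛ ‵ 2 ⊑ ‵ 1 ⊕ ‵ 3 by unbalanced ∙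
    2 ⋆ 20000 ⊛ ‵ 3 ⊑ ‵ 0 by tiny ∙ 39999 ⋆ κ 10 ⊑ ‵ 3 by 10≤e ∙ end) 3 (κ 1 ⊕ κ 0) (‵ 1)) large))
    where
    from-x : (∃ λ x → A x ≡ true) → HasMonochromaticCopy G T
    from-x (x , a) = from-y (count-positive (λ w → U₂ w ∧ not ⌊ w ≟ᶠ x ⌋ ∧ (colour G x w ==ᶜ χ))
      (linear (count U₂ ∷ deg G χ x U₂ ∷ deg G (other χ) x U₂ ∷ k ∷ e ∷ t₁ ∷ n ∷ t₂ ∷ []) (
        3 ⋆ ‵ 0 ⊑ ‵ 1 ⊕ ‵ 2 ⊕ κ 1 by deg-total G χ x U₂ ∙ 3 ⋆ κ 1 ⊕ ‵ 2 ⊑ ‵ 3 by A⇒ a ∙ 3 ⋆ ‵ 3 ⊑ 2 ⊛ ‵ 4 by k≤ ∙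
        3 ⋆ ‵ 5 ⊑ ‵ 0 ⊕ ‵ 4 by large₂ ∙ 2 ⋆ ‵ 6 ⊑ ‵ 5 ⊕ ‵ 7 by ≤-reflexive (sym total) ∙
        1 ⋆ 2 ⊛ ‵ 7 ⊑ ‵ 5 ⊕ ‵ 4 by unbalanced ∙ 2 ⋆ 20000 ⊛ ‵ 4 ⊑ ‵ 6 by tiny ∙ 39990 ⋆ κ 10 ⊑ ‵ 4 by 10≤e ∙ end)
        3 (κ 1 ⊕ κ 0) (‵ 1)))
      where
      from-y : (∃ λ w → U₂ w ∧ not ⌊ w ≟ᶠ x ⌋ ∧ (colour G x w ==ᶜ χ) ≡ true) → HasMonochromaticCopy G T
      from-y (y , h) = span (λ w → A w ∧ not (w == x)) (λ w → ∧₁)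
        (linear (count A ∷ count (λ w → A w ∧ (w == x)) ∷ count (λ w → A w ∧ not (w == x)) ∷ count (_== x) ∷ t₁ ∷
          []) (1 ⋆ ‵ 0 ⊑ ‵ 1 ⊕ ‵ 2 by ≤-reflexive (count-split A (_== x)) ∙
          1 ⋆ ‵ 1 ⊑ ‵ 3 by count-mono (λ w → A w ∧ (w == x)) (_== x) (λ w → ∧₂ {A w}) ∙
          1 ⋆ ‵ 3 ⊑ κ 1 by count-== x ∙ 1 ⋆ ‵ 4 ⊑ ‵ 0 by large ∙ end) 1 (‵ 4) (‵ 2 ⊕ κ 1))
        x y (λ q → not-elim (∧₂ {A x} q) (==-refl x)) (∧₁ h) (λ { refl → not-elim (∧₁ (∧₂ {U₂ y} h)) (==-refl y) })
        (==ᶜ-elim _ _ (∧₂ {not ⌊ y ≟ᶠ x ⌋} (∧₂ {U₂ y} h)))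

  -- The vertices fit to carry a cut vertex: in colour `other χ` they reach almost all of U₁ and at
  -- least k vertices of U₂.
  joint : Fin N → Bool
  joint x = P x ∧ not (A x)

  two-joints : 1 < count joint → HasMonochromaticCopy G T
  two-joints many = from (count-positive joint (<-trans (s≤s z≤n) many))
    where
    few : ∀ {x} → joint x ≡ true → deg G χ x U₁ ≤ e
    few {x} j = ⌊⌋-elim (deg G χ x U₁ ≤? e) (∧₁ j)
    wide : ∀ {x} → joint x ≡ true → k ≤ deg G (other χ) x U₂
    wide {x} j = ≮⇒≥ (λ lt → not-elim (∧₂ {P x} j) (⌊⌋-intro (deg G (other χ) x U₂ <? k) lt))
    from : (∃ λ v → joint v ≡ true) → HasMonochromaticCopy G T
    from (v , jv) = with-second (pick joint (_== v) (≤-<-trans (count-== v) many))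
      where
      with-second : (∃ λ v' → joint v' ≡ true × ¬ (v' == v ≡ true)) → HasMonochromaticCopy G T
      with-second (v' , jv' , ne) = case Cut.a cut ≟ᶠ Cut.b cut of λ
        { (yes eq) → Separated.separated-copy S cut v v (λ _ → refl) (λ a≢b → ⊥-elim (a≢b eq)) (few jv) (few jv)
            (wide jv) (wide jv)
        ; (no a≢b) → Separated.separated-copy S cut v v' (λ eq → ⊥-elim (a≢b eq))
            (λ _ eq → ne (⌊⌋-intro (v' ≟ᶠ v) (sym eq)))
            (few jv) (few jv') (wide jv) (wide jv') }

  -- If A is at most one vertex short, a χ-edge from outside A to U₂ would yield a spanning copy
  -- through the leaf; in the remaining case there is no such edge.
  Clean : Set
  Clean = t₁ ≤ count A + 1 → ∀ x y → ¬ (A x ≡ true) → U₂ y ≡ true → x ≢ y → colour G x y ≡ other χ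

  Outcome : Set
  Outcome = HasMonochromaticCopy G T ⊎ (count A < t₁ × count joint ≤ 1 × Clean)

  clean? : HasMonochromaticCopy G T ⊎ Clean
  clean? = case t₁ ≤? count A + 1 of λ
    { (no short) → inj₂ (λ enough → ⊥-elim (short enough))
    ; (yes enough) → case exists? (λ x → not (A x) ∧ ⌊ any? (λ y → U₂ y ∧ not (x == y) ∧ (colour G x y ==ᶜ χ) ≟ᵇ
        true) ⌋) of λ
      { (inj₁ (x , h)) → case ⌊⌋-elim (any? (λ y → U₂ y ∧ not (x == y) ∧ (colour G x y ==ᶜ χ) ≟ᵇ true))
          (∧₂ {not (A x)} h) of λ
        { (y , q) → inj₁ (span A (λ _ a → a) enough x y (not-elim (∧₁ h)) (∧₁ q)
            (λ eq → not-elim (∧₁ (∧₂ {U₂ y} q)) (⌊⌋-intro (x ≟ᶠ y) eq))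
                (==ᶜ-elim _ _ (∧₂ {not (x == y)} (∧₂ {U₂ y} q)))) }
      ; (inj₂ none) → inj₂ (λ _ x y x∉A y∈U₂ x≢y → not-this _ χ (λ c → none x (both (not-intro x∉A)
          (⌊⌋-intro (any? _) (y , both y∈U₂ (both (not-intro (x≢y ∘ ==-elim)) c)))))) } }

  outcome : Outcome
  outcome = case t₁ ≤? count A of λ
    { (yes large) → inj₁ (many-A large)
    ; (no small) → case 1 <? count joint of λ
      { (yes many) → inj₁ (two-joints many)
      ; (no few) → case clean? of λ
        { (inj₁ copy) → inj₁ copy
        ; (inj₂ clean) → inj₂ (≰⇒> small , ≮⇒≥ few , clean) } } }

module _ {n N} {T : SimpleGraph n} {e} {B : Bipartition T e} {G : ColouredKN N} {χ : Colour}
  (cut : Cut B) (ℓ₀ p₀ : Fin n) (ℓ₀-class : Bipartition.class B ℓ₀ ≡ true) (ℓ₀p₀ : adj T ℓ₀ p₀ ≡ true)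
  (only : ∀ q → adj T ℓ₀ q ≡ true → q ≡ p₀) where

  module Deadlock {U₁ U₂} (S : Setting B G χ U₁ U₂) (either : ∀ x → deg G χ x U₁ ≤ e ⊎ deg G χ x U₂ ≤ e) where
    open Setting S
    module L = Half S cut ℓ₀ p₀ ℓ₀-class ℓ₀p₀ only
    module R = Half (mirror S) cut ℓ₀ p₀ ℓ₀-class ℓ₀p₀ only

    -- By cleanness a vertex outside A has no χ-edge to U₂, so it lies in B or is the only joint of
    -- the mirrored side. Thus N ≤ |A| + |B| + 1, which forces |B| = t₁ - 1 as well and transfers
    -- cleanness to B. Since N ≥ 2t₁ - 1, some v lies outside both sets and becomes the common
    -- vertex.
    unstuck : (count L.A < t₁ × count L.joint ≤ 1 × L.Clean) → (count R.A < t₁ × count R.joint ≤ 1 × R.Clean) →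
      t₁ ≤ count L.A + 1 → HasMonochromaticCopy G T
    unstuck (A-few , joint-few , clean-L) (B-few , joint-few' , clean-R) enough =
      from (pick (λ _ → true) (λ x → L.A x ∨ R.A x) (linear (N ∷ count {N} (λ _ → true) ∷
        count (λ x → L.A x ∨ R.A x) ∷ count L.A ∷ count R.A ∷ t₁ ∷ []) (
        1 ⋆ ‵ 0 ⊑ ‵ 1 by ≤-reflexive (sym (count-all N)) ∙
        1 ⋆ ‵ 2 ⊑ ‵ 3 ⊕ ‵ 4 by count-cover (λ x → L.A x ∨ R.A x) L.A R.A (λ x → ∨-elim) ∙
        1 ⋆ κ 1 ⊕ ‵ 3 ⊑ ‵ 5 by A-few ∙ 1 ⋆ κ 1 ⊕ ‵ 4 ⊑ ‵ 5 by B-few ∙ 1 ⋆ 2 ⊛ ‵ 5 ⊑ ‵ 0 ⊕ κ 1 by above₁ ∙ end)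
        1 (κ 1 ⊕ ‵ 2) (‵ 1)))
      where
      P₁⇒∉R : ∀ x → deg G χ x U₁ ≤ e → ¬ (R.A x ≡ true)
      P₁⇒∉R x few a = linear-absurd (deg G χ x U₁ ∷ e ∷ deg G (other χ) x U₁ ∷ Cut.k cut ∷ count U₁ ∷ t₁ ∷ n ∷ t₂ ∷
        []) (3 ⋆ ‵ 0 ⊑ ‵ 1 by few ∙ 3 ⋆ κ 1 ⊕ ‵ 2 ⊑ ‵ 3 by R.A⇒ a ∙ 3 ⋆ ‵ 3 ⊑ 2 ⊛ ‵ 1 by Cut.k≤ cut ∙
        3 ⋆ ‵ 4 ⊑ ‵ 0 ⊕ ‵ 2 ⊕ κ 1 by deg-total G χ x U₁ ∙ 3 ⋆ ‵ 5 ⊑ ‵ 4 ⊕ ‵ 1 by large₁ ∙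
        2 ⋆ ‵ 6 ⊑ ‵ 5 ⊕ ‵ 7 by ≤-reflexive (sym total) ∙ 1 ⋆ 2 ⊛ ‵ 7 ⊑ ‵ 5 ⊕ ‵ 1 by unbalanced ∙
        2 ⋆ 20000 ⊛ ‵ 1 ⊑ ‵ 6 by tiny ∙ 39987 ⋆ κ 10 ⊑ ‵ 1 by 10≤e ∙ end)
      P₂⇒∉L : ∀ x → deg G χ x U₂ ≤ e → ¬ (L.A x ≡ true)
      P₂⇒∉L x few a = linear-absurd (deg G χ x U₂ ∷ e ∷ deg G (other χ) x U₂ ∷ Cut.k cut ∷ count U₂ ∷ t₁ ∷ n ∷ t₂ ∷
        []) (3 ⋆ ‵ 0 ⊑ ‵ 1 by few ∙ 3 ⋆ κ 1 ⊕ ‵ 2 ⊑ ‵ 3 by L.A⇒ a ∙ 3 ⋆ ‵ 3 ⊑ 2 ⊛ ‵ 1 by Cut.k≤ cut ∙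
        3 ⋆ ‵ 4 ⊑ ‵ 0 ⊕ ‵ 2 ⊕ κ 1 by deg-total G χ x U₂ ∙ 3 ⋆ ‵ 5 ⊑ ‵ 4 ⊕ ‵ 1 by large₂ ∙
        2 ⋆ ‵ 6 ⊑ ‵ 5 ⊕ ‵ 7 by ≤-reflexive (sym total) ∙ 1 ⋆ 2 ⊛ ‵ 7 ⊑ ‵ 5 ⊕ ‵ 1 by unbalanced ∙
        2 ⋆ 20000 ⊛ ‵ 1 ⊑ ‵ 6 by tiny ∙ 39987 ⋆ κ 10 ⊑ ‵ 1 by 10≤e ∙ end)
      disjoint-LR : ∀ x → L.A x ≡ true → R.A x ≡ true → ⊥
      disjoint-LR x a b = [ (λ p → P₁⇒∉R x p b) , (λ p → P₂⇒∉L x p a) ]′ (either x)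
      no-red : ∀ x → ¬ (L.A x ≡ true) → deg G χ x U₂ ≤ e
      no-red x x∉A = ≤-trans (≤-reflexive (count-none (λ w → U₂ w ∧ not ⌊ w ≟ᶠ x ⌋ ∧ (colour G x w ==ᶜ χ)) (λ w h →
        other≢ χ (trans (sym (==ᶜ-elim _ _ (∧₂ {not ⌊ w ≟ᶠ x ⌋} (∧₂ {U₂ w} h)))) (clean-L enough x w x∉A (∧₁ h)
          (λ { refl → not-elim (∧₁ (∧₂ {U₂ w} h)) (==-refl w) })))))) z≤n
      cover : ∀ x → true ≡ true → L.A x ≡ true ⊎ R.A x ∨ R.joint x ≡ true
      cover x _ = case truth (L.A x) of λ
        { (inj₁ a) → inj₁ a
        ; (inj₂ na) → inj₂ (case truth (R.A x) of λ
          { (inj₁ b) → ∨₁ b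
          ; (inj₂ nb) → ∨₂ {R.A x} (both (⌊⌋-intro (deg G χ x U₂ ≤? e) (no-red x (not-elim na))) nb) }) }
      sizes : N ≤ count L.A + (count R.A + 1)
      sizes = linear (N ∷ count {N} (λ _ → true) ∷ count L.A ∷ count (λ x → R.A x ∨ R.joint x) ∷ count R.A ∷
        count R.joint ∷ []) (1 ⋆ ‵ 0 ⊑ ‵ 1 by ≤-reflexive (sym (count-all N)) ∙
        1 ⋆ ‵ 1 ⊑ ‵ 2 ⊕ ‵ 3 by count-cover (λ _ → true) L.A (λ x → R.A x ∨ R.joint x) cover ∙
        1 ⋆ ‵ 3 ⊑ ‵ 4 ⊕ ‵ 5 by count-cover (λ x → R.A x ∨ R.joint x) R.A R.joint (λ x → ∨-elim) ∙
        1 ⋆ ‵ 5 ⊑ κ 1 by joint-few' ∙ end) 1 (‵ 0) (‵ 2 ⊕ (‵ 4 ⊕ κ 1))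
      enough' : t₁ ≤ count R.A + 1
      enough' = linear (N ∷ count L.A ∷ count R.A ∷ t₁ ∷ []) (1 ⋆ ‵ 0 ⊑ ‵ 1 ⊕ (‵ 2 ⊕ κ 1) by sizes ∙
        1 ⋆ κ 1 ⊕ ‵ 1 ⊑ ‵ 3 by A-few ∙ 1 ⋆ 2 ⊛ ‵ 3 ⊑ ‵ 0 ⊕ κ 1 by above₁ ∙ end) 1 (‵ 3) (‵ 2 ⊕ κ 1)
      U₁⊆A : U₁ ⊆ L.A
      U₁⊆A u q with truth (L.A u)
      ... | inj₁ a = a
      ... | inj₂ na = ⊥-elim (linear-absurd (deg G χ u U₂ ∷ e ∷ deg G (other χ) u U₂ ∷ count U₂ ∷ t₁ ∷ n ∷ t₂ ∷
        []) (3 ⋆ ‵ 0 ⊑ ‵ 1 by no-red u (not-elim na) ∙ 3 ⋆ ‵ 2 ⊑ ‵ 1 by proj₂ (sparse₁ u q) ∙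
        3 ⋆ ‵ 3 ⊑ ‵ 0 ⊕ ‵ 2 ⊕ κ 1 by deg-total G χ u U₂ ∙ 3 ⋆ ‵ 4 ⊑ ‵ 3 ⊕ ‵ 1 by large₂ ∙
        2 ⋆ ‵ 5 ⊑ ‵ 4 ⊕ ‵ 6 by ≤-reflexive (sym total) ∙ 1 ⋆ 2 ⊛ ‵ 6 ⊑ ‵ 4 ⊕ ‵ 1 by unbalanced ∙
        2 ⋆ 20000 ⊛ ‵ 1 ⊑ ‵ 5 by tiny ∙ 39990 ⋆ κ 10 ⊑ ‵ 1 by 10≤e ∙ end))
      no-red' : ∀ x → ¬ (R.A x ≡ true) → deg G χ x U₁ ≤ e
      no-red' x x∉B = ≤-trans (≤-reflexive (count-none (λ w → U₁ w ∧ not ⌊ w ≟ᶠ x ⌋ ∧ (colour G x w ==ᶜ χ)) (λ w h →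
        other≢ χ (trans (sym (==ᶜ-elim _ _ (∧₂ {not ⌊ w ≟ᶠ x ⌋} (∧₂ {U₁ w} h)))) (clean-R enough' x w x∉B (∧₁ h)
          (λ { refl → not-elim (∧₁ (∧₂ {U₁ w} h)) (==-refl w) })))))) z≤n
      U₂⊆B : U₂ ⊆ R.A
      U₂⊆B u q with truth (R.A u)
      ... | inj₁ a = a
      ... | inj₂ na = ⊥-elim (linear-absurd (deg G χ u U₁ ∷ e ∷ deg G (other χ) u U₁ ∷ count U₁ ∷ t₁ ∷ n ∷ t₂ ∷
        []) (3 ⋆ ‵ 0 ⊑ ‵ 1 by no-red' u (not-elim na) ∙ 3 ⋆ ‵ 2 ⊑ ‵ 1 by proj₂ (sparse₂ u q) ∙
        3 ⋆ ‵ 3 ⊑ ‵ 0 ⊕ ‵ 2 ⊕ κ 1 by deg-total G χ u U₁ ∙ 3 ⋆ ‵ 4 ⊑ ‵ 3 ⊕ ‵ 1 by large₁ ∙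
        2 ⋆ ‵ 5 ⊑ ‵ 4 ⊕ ‵ 6 by ≤-reflexive (sym total) ∙ 1 ⋆ 2 ⊛ ‵ 6 ⊑ ‵ 4 ⊕ ‵ 1 by unbalanced ∙
        2 ⋆ 20000 ⊛ ‵ 1 ⊑ ‵ 5 by tiny ∙ 39990 ⋆ κ 10 ⊑ ‵ 1 by 10≤e ∙ end))
      from : (∃ λ v → true ≡ true × ¬ (L.A v ∨ R.A v ≡ true)) → HasMonochromaticCopy G T
      from (v , _ , v∉) = Cliques.cliques-copy B G (other χ) 10≤e tiny
        -- Here N = 2t₁ - 1, so N + 1 ≥ t₁ + 2t₂ sharpens the approximate ratio of the classes to
        -- 2t₂ ≤ t₁ without error.
        (linear (N ∷ count L.A ∷ count R.A ∷ t₁ ∷ t₂ ∷ []) (1 ⋆ ‵ 0 ⊑ ‵ 1 ⊕ (‵ 2 ⊕ κ 1) by sizes ∙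
          1 ⋆ κ 1 ⊕ ‵ 1 ⊑ ‵ 3 by A-few ∙ 1 ⋆ κ 1 ⊕ ‵ 2 ⊑ ‵ 3 by B-few ∙ 1 ⋆ ‵ 3 ⊕ 2 ⊛ ‵ 4 ⊑ ‵ 0 ⊕ κ 1 by above₂ ∙
          end) 1 (2 ⊛ ‵ 4) (‵ 3))
        (λ i → if i then R.A else L.A) (λ i → if i then U₂ else U₁) v
        (λ { true → U₂⊆B ; false → U₁⊆A }) (λ h p q → disjoint-LR h q p)
        (λ { true p → v∉ (∨₂ {L.A v} p) ; false p → v∉ (∨₁ p) })
        (λ { true → enough' ; false → enough }) (λ { true → large₂ ; false → large₁ })
        (λ { true x h b u ne → clean-L enough x h (λ a → disjoint-LR x a b) u ne
           ; false x h a u ne → clean-R enough' x h (λ b → disjoint-LR x a b) u ne })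
        (λ { true h u → clean-L enough v h (λ a → v∉ (∨₁ a)) u (λ { refl → v∉ (∨₂ {L.A v} (U₂⊆B v u)) })
           ; false h u → clean-R enough' v h (λ b → v∉ (∨₂ {L.A v} b)) u (λ { refl → v∉ (∨₁ (U₁⊆A v u)) }) })
        ℓ₀

  resolve : ∀ {U₁ U₂} → Setting B G χ U₁ U₂ → HasMonochromaticCopy G T
  resolve {U₁} {U₂} S = case exists? (λ x → ⌊ e ≤? deg G χ x U₁ ⌋ ∧ ⌊ e ≤? deg G χ x U₂ ⌋) of λ
    { (inj₁ (x , h)) → Exchanged.exchanged-copy S (exchange S ℓ₀) x (⌊⌋-elim (e ≤? deg G χ x U₁) (∧₁ h))
        (⌊⌋-elim (e ≤? deg G χ x U₂) (∧₂ {⌊ e ≤? deg G χ x U₁ ⌋} h))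
    ; (inj₂ none) → stuck (λ x → case e ≤? deg G χ x U₁ of λ
        { (no ¬p) → inj₁ (<⇒≤ (≰⇒> ¬p))
        ; (yes p) → inj₂ (<⇒≤ (≰⇒> (λ q → none x (both (⌊⌋-intro (e ≤? deg G χ x U₁) p)
            (⌊⌋-intro (e ≤? deg G χ x U₂) q))))) }) }
    where
    open Setting S
    module L = Half S cut ℓ₀ p₀ ℓ₀-class ℓ₀p₀ only
    module R = Half (mirror S) cut ℓ₀ p₀ ℓ₀-class ℓ₀p₀ only
    stuck : (∀ x → deg G χ x U₁ ≤ e ⊎ deg G χ x U₂ ≤ e) → HasMonochromaticCopy G T
    stuck either = go L.outcome R.outcome
      where
      either' : ∀ x → deg G χ x U₂ ≤ e ⊎ deg G χ x U₁ ≤ e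
      either' x = [ inj₂ , inj₁ ]′ (either x)
      go : L.Outcome → R.Outcome → HasMonochromaticCopy G T
      go (inj₁ copy) _ = copy
      go (inj₂ _) (inj₁ copy) = copy
      go (inj₂ l) (inj₂ r) = case t₁ ≤? count L.A + 1 of λ
        { (yes enough) → Deadlock.unstuck S either l r enough
        -- A, B and at most one joint on each side cover everything, so N ≤ |A| + |B| + 2. If |A| ≤
        -- t₁ - 2, then |B| ≥ t₁ - 1, and the argument runs with the sides exchanged.
        ; (no short) → Deadlock.unstuck (mirror S) either' r l (linear (N ∷ count {N} (λ _ → true) ∷
          count (λ x → L.A x ∨ L.joint x) ∷ count (λ x → R.A x ∨ R.joint x) ∷ count L.A ∷ count L.joint ∷
          count R.A ∷ count R.joint ∷ t₁ ∷ []) (1 ⋆ ‵ 0 ⊑ ‵ 1 by ≤-reflexive (sym (count-all N)) ∙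
          1 ⋆ ‵ 1 ⊑ ‵ 2 ⊕ ‵ 3 by count-cover (λ _ → true) (λ x → L.A x ∨ L.joint x) (λ x → R.A x ∨ R.joint x)
              cover ∙
          1 ⋆ ‵ 2 ⊑ ‵ 4 ⊕ ‵ 5 by count-cover (λ x → L.A x ∨ L.joint x) L.A L.joint (λ x → ∨-elim) ∙
          1 ⋆ ‵ 3 ⊑ ‵ 6 ⊕ ‵ 7 by count-cover (λ x → R.A x ∨ R.joint x) R.A R.joint (λ x → ∨-elim) ∙
          1 ⋆ ‵ 5 ⊑ κ 1 by proj₁ (proj₂ l) ∙ 1 ⋆ ‵ 7 ⊑ κ 1 by proj₁ (proj₂ r) ∙
          1 ⋆ κ 1 ⊕ (‵ 4 ⊕ κ 1) ⊑ ‵ 8 by ≰⇒> short ∙ 1 ⋆ 2 ⊛ ‵ 8 ⊑ ‵ 0 ⊕ κ 1 by above₁ ∙ end) 1 (‵ 8) (‵ 6 ⊕ κ 1)) }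
        where
        cover : ∀ x → true ≡ true → L.A x ∨ L.joint x ≡ true ⊎ R.A x ∨ R.joint x ≡ true
        cover x _ = [ (λ p → inj₁ (case truth (L.A x) of λ
            { (inj₁ a) → ∨₁ a ; (inj₂ na) → ∨₂ {L.A x} (both (⌊⌋-intro (deg G χ x U₁ ≤? e) p) na) })) ,
          (λ p → inj₂ (case truth (R.A x) of λ
            { (inj₁ a) → ∨₁ a ; (inj₂ na) → ∨₂ {R.A x} (both (⌊⌋-intro (deg G χ x U₂ ≤? e) p) na) })) ]′ (either x)

extremal-copy : ∀ {n N} {T : SimpleGraph n} {e} {B : Bipartition T e} {G : ColouredKN N} {χ U₁ U₂} → Setting B G χ
    U₁ U₂ →
  HasMonochromaticCopy G T
extremal-copy {n} {T = T} {e} {B} {G} S = from (leaf (linear (n ∷ t₁ ∷ t₂ ∷ e ∷ []) (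
  1 ⋆ ‵ 0 ⊑ ‵ 1 ⊕ ‵ 2 by ≤-reflexive (sym total) ∙ 2 ⋆ 2 ⊛ ‵ 2 ⊑ ‵ 1 ⊕ ‵ 3 by unbalanced ∙
  1 ⋆ 20000 ⊛ ‵ 3 ⊑ ‵ 0 by tiny ∙ 19998 ⋆ κ 10 ⊑ ‵ 3 by 10≤e ∙ end) 3 (κ 1 ⊕ ‵ 2) (‵ 1)) (linear (e ∷ n ∷ []) (
    1 ⋆ 20000 ⊛ ‵ 0 ⊑ ‵ 1 by tiny ∙ 20000 ⋆ κ 10 ⊑ ‵ 0 by 10≤e ∙ end) 1 (κ 2) (‵ 1)))
  where
  open Setting S
  from : (∃ λ ℓ → ∃ λ p → class ℓ ≡ true × adj T ℓ p ≡ true × (∀ q → adj T ℓ q ≡ true → q ≡ p)) →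
      HasMonochromaticCopy G T
  from (ℓ , p , c , ℓp , only) = resolve (BalancedCut.balanced-cut B (≤-trans (s≤s z≤n) 10≤e) tiny unbalanced ℓ) ℓ p
      c ℓp only S

-- From rational hypotheses to natural numbers

ℕ→ℚᵘ : ℕ → ℚᵘ.ℚᵘ
ℕ→ℚᵘ a = ℚᵘ.mkℚᵘ (ℤ.+ a) 0

toℚᵘ-ℕ : ∀ a → ℚ.toℚᵘ (ℕ→ℚ a) ℚᵘ.≃ ℕ→ℚᵘ a
toℚᵘ-ℕ a = ℚP.toℚᵘ-fromℚᵘ (ℕ→ℚᵘ a)

tinyℚ : ℚ
tinyℚ = (ℤ.+ 1) ℚ./ 20000

-- Replacing μ by its bound 1/20000 and clearing the denominator leaves an inequality between
-- naturals. The unnormalised rationals make numerators and denominators explicit.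
scaled-bound : ∀ {μ} → μ ℚ.≤ tinyℚ → ∀ x y z → ℕ→ℚ x ℚ.≤ ℕ→ℚ y ℚ.+ μ ℚ.* ℕ→ℚ z → x * 20000 ≤ y * 20000 + z
scaled-bound {μ} μ≤ x y z h = ℤP.drop‿+≤+ (subst₂ ℤ._≤_ left′ right′ (ℚᵘP.drop-*≤* bound))
  where
  instance
    nonNeg : ℚ.NonNegative (ℕ→ℚ z)
    nonNeg = ℚP.normalize-nonNeg z 1
  simplified : ℕ→ℚ x ℚ.≤ ℕ→ℚ y ℚ.+ tinyℚ ℚ.* ℕ→ℚ z
  simplified = ℚP.≤-trans h (ℚP.+-monoʳ-≤ (ℕ→ℚ y) (ℚP.*-monoʳ-≤-nonNeg (ℕ→ℚ z) μ≤))
  shape : ℚ.toℚᵘ (ℕ→ℚ y ℚ.+ tinyℚ ℚ.* ℕ→ℚ z) ℚᵘ.≃ ℕ→ℚᵘ y ℚᵘ.+ ℚᵘ.mkℚᵘ (ℤ.+ 1) 19999 ℚᵘ.* ℕ→ℚᵘ z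
  shape = ℚᵘP.≃-trans (ℚP.toℚᵘ-homo-+ (ℕ→ℚ y) (tinyℚ ℚ.* ℕ→ℚ z)) (ℚᵘP.+-cong (toℚᵘ-ℕ y)
    (ℚᵘP.≃-trans (ℚP.toℚᵘ-homo-* tinyℚ (ℕ→ℚ z)) (ℚᵘP.*-cong (ℚP.toℚᵘ-fromℚᵘ (ℚᵘ.mkℚᵘ (ℤ.+ 1) 19999)) (toℚᵘ-ℕ z))))
  bound : ℕ→ℚᵘ x ℚᵘ.≤ ℕ→ℚᵘ y ℚᵘ.+ ℚᵘ.mkℚᵘ (ℤ.+ 1) 19999 ℚᵘ.* ℕ→ℚᵘ z
  bound = ℚᵘP.≤-respʳ-≃ shape (ℚᵘP.≤-respˡ-≃ (toℚᵘ-ℕ x) (ℚP.toℚᵘ-mono-≤ simplified))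
  left′ : (ℤ.+ x) ℤ.* (ℤ.+ 20000) ≡ ℤ.+ (x * 20000)
  left′ = sym (ℤP.pos-* x 20000)
  right′ : ((ℤ.+ y) ℤ.* (ℤ.+ 20000) ℤ.+ ((ℤ.+ 1) ℤ.* (ℤ.+ z)) ℤ.* (ℤ.+ 1)) ℤ.* (ℤ.+ 1) ≡ ℤ.+ (y * 20000 + z)
  right′ = trans (ℤP.*-identityʳ _)
      (trans (cong₂ ℤ._+_ (sym (ℤP.pos-* y 20000)) (trans (ℤP.*-identityʳ _) (ℤP.*-identityˡ (ℤ.+ z))))
    (sym (ℤP.pos-+ (y * 20000) z)))

transpose : ∀ μ (s x y : ℚ) → (s ℚ.- μ) ℚ.* x ℚ.≤ y → s ℚ.* x ℚ.≤ y ℚ.+ μ ℚ.* x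
transpose μ s x y h = subst (ℚ._≤ y ℚ.+ μ ℚ.* x) (trans (sym (ℚP.*-distribʳ-+ x (s ℚ.- μ) μ)) (cong (ℚ._* x)
  (trans (ℚP.+-assoc s (ℚ.- μ) μ) (trans (cong (s ℚ.+_) (ℚP.+-inverseˡ μ)) (ℚP.+-identityʳ s)))))
      (ℚP.+-monoˡ-≤ (μ ℚ.* x) h)

small-deg : ∀ {μ} → μ ℚ.≤ tinyℚ → ∀ d n → ℕ→ℚ d ℚ.≤ μ ℚ.* ℕ→ℚ n → d ≤ n / 20000
small-deg {μ} μ≤ d n h = ≤-trans (≤-reflexive (sym (m*n/n≡m d 20000))) (/-monoˡ-≤ 20000
  (scaled-bound μ≤ d 0 n (subst (ℕ→ℚ d ℚ.≤_) (sym (ℚP.+-identityˡ (μ ℚ.* ℕ→ℚ n))) h)))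

theorem2p4 : Σ ℚ λ μ₀ → 0ℚ ℚ.< μ₀ × (∀ (μ : ℚ) → 0ℚ ℚ.< μ → μ ℚ.≤ μ₀ →
    Σ ℚ λ c₀ → 0ℚ ℚ.< c₀ × (∀ (c : ℚ) → 0ℚ ℚ.< c → c ℚ.≤ c₀ →
    Σ ℕ λ n₀ → ∀ (n t₁ t₂ : ℕ) → n ≥ n₀ → t₁ + t₂ ≡ n →
    (ℕ→ℚ 2 ℚ.- μ) ℚ.* ℕ→ℚ t₂ ℚ.≤ ℕ→ℚ t₁ →
    (G : ColouredKN (((t₁ + 2 * t₂) ⊔ (2 * t₁)) ∸ 1)) →
    TypeIIExtremal G μ t₁ t₂ →
    (T : SimpleGraph n) → IsTree T → MaxDegreeAtMost T c →
    HasBipartitionClasses T t₁ t₂ →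
    HasMonochromaticCopy G T))
-- With e the integer part of n/20000, a natural number that is at most μn or cn is at most e. The
-- bound n ≥ 200000 makes e at least 10, enough to absorb the additive constants.
theorem2p4 = tinyℚ , positive , λ μ _ μ≤ → tinyℚ , positive , λ c _ c≤ → 200000 , main μ μ≤ c c≤
  where
  positive : 0ℚ ℚ.< tinyℚ
  positive = ℚP.positive⁻¹ tinyℚ
  main : ∀ μ → μ ℚ.≤ tinyℚ → ∀ c → c ℚ.≤ tinyℚ → ∀ (n t₁ t₂ : ℕ) → n ≥ 200000 → t₁ + t₂ ≡ n →
    (ℕ→ℚ 2 ℚ.- μ) ℚ.* ℕ→ℚ t₂ ℚ.≤ ℕ→ℚ t₁ → (G : ColouredKN (((t₁ + 2 * t₂) ⊔ (2 * t₁)) ∸ 1)) → TypeIIExtremal G μ t₁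
        t₂ →
    (T : SimpleGraph n) → IsTree T → MaxDegreeAtMost T c → HasBipartitionClasses T t₁ t₂ → HasMonochromaticCopy G T
  main μ μ≤ c c≤ n t₁ t₂ n≥ n≡ ratio G extremal T tree Δ≤ (side , alternate , refl , refl) = [ with-colour red ,
      with-colour blue ]′ extremal
    where
    e : ℕ
    e = n / 20000
    B : Bipartition T e
    B = record { tree = tree ; class = side ; alternate = alternate ; degree≤ = λ v → small-deg c≤ (degree T v) n
        (Δ≤ v) }
    N : ℕ
    N = ((t₁ + 2 * t₂) ⊔ (2 * t₁)) ∸ 1
    division : n ≡ n % 20000 + e * 20000
    division = m≡m%n+[m/n]*n n 20000
    remainder : n % 20000 < 20000
    remainder = m%n<n n 20000
    unbalanced : t₂ * 2 ≤ t₁ + e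
    unbalanced = linear (t₂ ∷ t₁ ∷ n ∷ n % 20000 ∷ e ∷ []) (
      3 ⋆ 20000 ⊛ 2 ⊛ ‵ 0 ⊑ 20000 ⊛ ‵ 1 ⊕ ‵ 0 by subst (λ w → w * 20000 ≤ t₁ * 20000 + t₂) (*-comm 2 t₂)
          (scaled-bound μ≤ (2 * t₂) t₁ t₂ (subst (ℚ._≤ ℕ→ℚ t₁ ℚ.+ μ ℚ.* ℕ→ℚ t₂) doubled
          (transpose μ (ℕ→ℚ 2) (ℕ→ℚ t₂) (ℕ→ℚ t₁) ratio))) ∙
      1 ⋆ ‵ 1 ⊕ ‵ 0 ⊑ ‵ 2 by ≤-reflexive n≡ ∙ 1 ⋆ ‵ 2 ⊑ ‵ 3 ⊕ 20000 ⊛ ‵ 4 by ≤-reflexive division ∙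
      1 ⋆ κ 1 ⊕ ‵ 3 ⊑ κ 20000 by remainder ∙ end) 59999 (2 ⊛ ‵ 0) (‵ 1 ⊕ ‵ 4)
      where
      doubled : ℕ→ℚ 2 ℚ.* ℕ→ℚ t₂ ≡ ℕ→ℚ (2 * t₂)
      doubled = ℚP.toℚᵘ-injective (ℚᵘP.≃-trans (ℚP.toℚᵘ-homo-* (ℕ→ℚ 2) (ℕ→ℚ t₂)) (ℚᵘP.≃-trans
        (ℚᵘP.*-cong (toℚᵘ-ℕ 2) (toℚᵘ-ℕ t₂)) (ℚᵘP.≃-trans (ℚᵘ.*≡* (cong (ℤ._* (ℤ.+ 1)) (sym (ℤP.pos-* 2 t₂))))
        (ℚᵘP.≃-sym (toℚᵘ-ℕ (2 * t₂))))))
    10≤e : 10 ≤ e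
    10≤e = linear (n ∷ n % 20000 ∷ e ∷ []) (1 ⋆ ‵ 0 ⊑ ‵ 1 ⊕ 20000 ⊛ ‵ 2 by ≤-reflexive division ∙
      1 ⋆ κ 1 ⊕ ‵ 1 ⊑ κ 20000 by remainder ∙ 1 ⋆ κ 200000 ⊑ ‵ 0 by n≥ ∙ end) 20000 (κ 10) (‵ 2)
    N+1 : N + 1 ≡ (t₁ + 2 * t₂) ⊔ (2 * t₁)
    N+1 = m∸n+n≡m (≤-trans (≤-trans t₁-positive (m≤m+n t₁ (2 * t₂))) (m≤m⊔n (t₁ + 2 * t₂) (2 * t₁)))
      where
      t₁-positive : 1 ≤ t₁
      t₁-positive = linear (n ∷ t₁ ∷ t₂ ∷ e ∷ n % 20000 ∷ []) (2 ⋆ ‵ 0 ⊑ ‵ 1 ⊕ ‵ 2 by ≤-reflexive (sym n≡) ∙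
        1 ⋆ 2 ⊛ ‵ 2 ⊑ ‵ 1 ⊕ ‵ 3 by unbalanced ∙ 2 ⋆ ‵ 4 ⊕ 20000 ⊛ ‵ 3 ⊑ ‵ 0 by ≤-reflexive (sym division) ∙
        39999 ⋆ κ 10 ⊑ ‵ 3 by 10≤e ∙ end) 3 (κ 1) (‵ 1)
    large : ∀ U → (1ℚ ℚ.- μ) ℚ.* ℕ→ℚ t₁ ℚ.≤ ℕ→ℚ U → t₁ ≤ U + e
    large U h = linear (t₁ ∷ U ∷ t₂ ∷ n ∷ n % 20000 ∷ e ∷ []) (
      1 ⋆ 20000 ⊛ ‵ 0 ⊑ 20000 ⊛ ‵ 1 ⊕ ‵ 0 by scaled-bound μ≤ t₁ U t₁ (subst (ℚ._≤ ℕ→ℚ U ℚ.+ μ ℚ.* ℕ→ℚ t₁)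
          (ℚP.*-identityˡ (ℕ→ℚ t₁)) (transpose μ 1ℚ (ℕ→ℚ t₁) (ℕ→ℚ U) h)) ∙
      1 ⋆ ‵ 0 ⊕ ‵ 2 ⊑ ‵ 3 by ≤-reflexive n≡ ∙ 1 ⋆ ‵ 3 ⊑ ‵ 4 ⊕ 20000 ⊛ ‵ 5 by ≤-reflexive division ∙
      1 ⋆ κ 1 ⊕ ‵ 4 ⊑ κ 20000 by remainder ∙ end) 20000 (‵ 0) (‵ 1 ⊕ ‵ 5)
    with-colour : ∀ k → TypeIIWith k G μ t₁ t₂ → HasMonochromaticCopy G T
    with-colour k (U₁ , U₂ , apart , big₁ , big₂ , sparse₁ , sparse₂) = extremal-copy setting
      where
      low : ∀ {d} → ℕ→ℚ d ℚ.≤ μ ℚ.* ℕ→ℚ (t₁ + t₂) → d ≤ e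
      low {d} h = small-deg μ≤ d n (subst (λ m → ℕ→ℚ d ℚ.≤ μ ℚ.* ℕ→ℚ m) n≡ h)
      setting : Setting B G k U₁ U₂
      setting = record
        { 10≤e = 10≤e ; tiny = (linear (n % 20000 ∷ e ∷ n ∷ []) (
          1 ⋆ ‵ 0 ⊕ 20000 ⊛ ‵ 1 ⊑ ‵ 2 by ≤-reflexive (sym division) ∙ end) 1 (20000 ⊛ ‵ 1) (‵ 2)) ; unbalanced =
              unbalanced
        ; below = ≤-trans (≤-reflexive N+1) (⊔-lub
            (linear (t₂ ∷ t₁ ∷ e ∷ 2 * t₂ ∷ []) (1 ⋆ 2 ⊛ ‵ 0 ⊑ ‵ 1 ⊕ ‵ 2 by unbalanced ∙
              1 ⋆ ‵ 3 ⊑ 2 ⊛ ‵ 0 by ≤-reflexive (*-comm 2 t₂) ∙ end) 1 (‵ 1 ⊕ ‵ 3) (2 ⊛ ‵ 1 ⊕ ‵ 2))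
            (linear (2 * t₁ ∷ t₁ ∷ e ∷ []) (1 ⋆ ‵ 0 ⊑ 2 ⊛ ‵ 1 by ≤-reflexive (*-comm 2 t₁) ∙ end)
              1 (‵ 0) (2 ⊛ ‵ 1 ⊕ ‵ 2)))
        ; above₁ = ≤-trans (≤-reflexive (*-comm t₁ 2)) (≤-trans (m≤n⊔m (t₁ + 2 * t₂) (2 * t₁))
            (≤-reflexive (sym N+1)))
        ; above₂ = ≤-trans (≤-reflexive (cong (t₁ +_) (*-comm t₂ 2))) (≤-trans (m≤m⊔n (t₁ + 2 * t₂) (2 * t₁))
            (≤-reflexive (sym N+1)))
        ; disjoint = λ u p q → false-elim (apart u) (both p q)
        ; large₁ = large (count U₁) big₁ ; large₂ = large (count U₂) big₂
        ; sparse₁ = λ u q → low (proj₁ (sparse₁ u q)) , low (proj₂ (sparse₁ u q))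
        ; sparse₂ = λ u q → low (proj₁ (sparse₂ u q)) , low (proj₂ (sparse₂ u q)) }
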